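{- Let $\lambda$ be a partition and $n\in N(\lambda)$. Then \[\mathrm{ss}_{\lambda,n}=\sum_{\substack{\beta:\ \beta'\text{ even}\\ \nu\in V^n(\lambda)}}c^{\nu}_{\beta\lambda}\,s_\nu .\] In particular, $\mathrm{ss}_{\lambda,n}$ is a finite sum of Schur functions and hence Schur-positive.
   Context: Partitions are Young diagrams; a skew shape is a horizontal strip (resp. vertical strip) if it has at most one box in each column (resp. row). $N(\lambda)=\{n\ge|\lambda|: n\equiv|\lambda|\pmod 2\}$. $\beta'$ denotes the conjugate partition; "$\beta'$ even" means every part of $\beta'$ is even (every column of $\beta$ has even length). $c^\nu_{\beta\lambda}$ are the Littlewood–Richardson coefficients, $s_\beta s_\lambda=\sum_\nu c^\nu_{\beta\lambda}s_\nu$. $V^n(\lambda)$ is the set of partitions $\nu$ with $|\nu|=n$ for which there is a chain $\lambda=\nu^0\subseteq\nu^1\subseteq\dots\subseteq\nu^t=\nu$ of partitions with each $\nu^s/\nu^{s-1}$ a vertical strip of even size. An SSOT of shape $\lambda$ is a sequence of partitions $S=(S^1,S'^2,S^2,S'^3,\dots)$ such that, with $S^0=S'^1=\emptyset$: for all $i\ge1$, $S'^i\subseteq S^{i-1}$, $S'^i\subseteq S^i$, and $S^{i-1}/S'^i$, $S^i/S'^i$ are horizontal strips (possibly empty); and $S^i=S'^{i+1}=\lambda$ for all large $i$. Put $m_i(S)=|S^{i-1}/S'^i|+|S^i/S'^i|$, length $n=\sum_i m_i(S)$, $x^S=\prod_ix_i^{m_i(S)}$. $\mathrm{ss}_{\lambda,n}(x)=\sum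 x^S$ over SSOTs of shape $\lambda$ and length $n$ (infinitely many variables). -}

module Defs where

open import Data.Nat using (ℕ; zero; suc; _+_; _*_; _∸_; _≤_; _<_; _<?_; _≟_; _%_)
open import Data.Nat.Divisibility using (_∣_)
open import Data.List using (List; []; _∷_; length; map; upTo; filter; concat)
open import Data.Nat.ListAction using (sum)
open import Data.Empty using (⊥)
open import Function.Bundles using (_↔_)
open import Data.List.Relation.Unary.All using (All)
open import Data.Vec using (Vec; toList; lookup; zipWith)
open import Data.Fin using (Fin; toℕ)
open import Data.Product using (Σ; Σ-syntax; _×_; _,_)
open import Data.Unit using (⊤; tt)
open import Relation.Nullary using (¬_)
open import Relation.Binary.PropositionalEquality using (_≡_)
open import Data.Irrelevant using (Irrelevant)

IsPartition : List ℕ → Set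
IsPartition []            = ⊤
IsPartition (a ∷ [])      = 1 ≤ a
IsPartition (a ∷ b ∷ l)   = b ≤ a × IsPartition (b ∷ l)

-- The well-formedness proof is irrelevant, so a partition is determined
-- by its list of parts.
record Partition : Set where
  constructor mkPartition
  field
    parts : List ℕ
    .wf   : IsPartition parts
open Partition public

∅ₚ : Partition
∅ₚ = mkPartition [] tt

nth : List ℕ → ℕ → ℕ
nth []      _       = 0
nth (a ∷ l) zero    = a
nth (a ∷ l) (suc i) = nth l i

part : Partition → ℕ → ℕ
part λ′ i = nth (parts λ′) i

size : Partition → ℕ
size λ′ = sum (parts λ′)

_∋cell_,_ : Partition → ℕ → ℕ → Set
λ′ ∋cell i , j = j < part λ′ i

_⊆ₚ_ : Partition → Partition → Set
μ ⊆ₚ λ′ = ∀ i j → μ ∋cell i , j → λ′ ∋cell i , j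

InSkew : Partition → Partition → ℕ → ℕ → Set
InSkew λ′ μ i j = (λ′ ∋cell i , j) × ¬ (μ ∋cell i , j)

HorizStrip : Partition → Partition → Set
HorizStrip λ′ μ = μ ⊆ₚ λ′ × (∀ i i′ j → InSkew λ′ μ i j → InSkew λ′ μ i′ j → i ≡ i′)

VertStrip : Partition → Partition → Set
VertStrip λ′ μ = μ ⊆ₚ λ′ × (∀ i j j′ → InSkew λ′ μ i j → InSkew λ′ μ i j′ → j ≡ j′)

-- |λ/μ| (for μ ⊆ λ)
skewSize : Partition → Partition → ℕ
skewSize λ′ μ = size λ′ ∸ size μ

InN : Partition → ℕ → Set
InN λ′ n = size λ′ ≤ n × n % 2 ≡ size λ′ % 2

colLen : Partition → ℕ → ℕ
colLen β j = length (filter (j <?_) (parts β))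

conjParts : Partition → List ℕ
conjParts β = map (colLen β) (upTo (part β 0))

ConjEven : Partition → Set
ConjEven β = All (2 ∣_) (conjParts β)

data VChain (λ′ : Partition) : Partition → Set where
  start : VChain λ′ λ′
  step  : ∀ {μ ν} → VChain λ′ μ → VertStrip ν μ → 2 ∣ skewSize ν μ → VChain λ′ ν

InV : ℕ → Partition → Partition → Set
InV n λ′ ν = size ν ≡ n × VChain λ′ ν

-- Semistandard Young tableaux of shape ν, entries in {1,…,k}, content α.
-- The coefficient of x^α = x₁^α₁ ⋯ x_k^α_k in s_ν is the number of these.

entry : List (List ℕ) → ℕ → ℕ → ℕ
entry []       _       _ = 0
entry (r ∷ T)  zero    j = nth r j
entry (r ∷ T)  (suc i) j = entry T i j

occ : ℕ → List ℕ → ℕ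
occ v l = length (filter (_≟ v) l)

IsSSYT : (ν : Partition) {k : ℕ} → Vec ℕ k → List (List ℕ) → Set
IsSSYT ν {k} α T =
    map length T ≡ parts ν
  × (∀ i j → ν ∋cell i , j → 1 ≤ entry T i j × entry T i j ≤ k)
  × (∀ i j → ν ∋cell i , suc j → entry T i j ≤ entry T i (suc j))
  × (∀ i j → ν ∋cell suc i , j → entry T i j < entry T (suc i) j)
  × (∀ (r : Fin k) → occ (suc (toℕ r)) (concat T) ≡ lookup α r)

record SSYT (ν : Partition) {k : ℕ} (α : Vec ℕ k) : Set where
  constructor mkSSYT
  field
    rows   : List (List ℕ)
    .valid : IsSSYT ν α rows

-- SSOTs of shape λ with weight x^α, α supported on the first k variables
-- (i.e. m_i(S) = α_i for i ≤ k and m_i(S) = 0 for i > k).  Such an SSOT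
-- is determined by (S'¹,S¹), …, (S'ᵏ,Sᵏ), since m_i = 0 forces
-- S^{i-1} = S'^i = S^i, so S^i = S'^{i+1} = λ for all i ≥ k.
-- The list stores the pairs (S'^i , S^i); the first argument of
-- ValidSSOT is S^{i-1} (initially S⁰ = ∅).

ValidSSOT : Partition → List (Partition × Partition) → List ℕ → Partition → Set
ValidSSOT prev []              []       λ′ = prev ≡ λ′
ValidSSOT prev []              (_ ∷ _)  λ′ = ⊥
ValidSSOT prev (_ ∷ _)         []       λ′ = ⊥
ValidSSOT prev ((S′ , S) ∷ st) (a ∷ as) λ′ =
    S′ ⊆ₚ prev × S′ ⊆ₚ S
  × HorizStrip prev S′ × HorizStrip S S′
  × a ≡ skewSize prev S′ + skewSize S S′
  × ValidSSOT S st as λ′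

record SSOT (λ′ : Partition) {k : ℕ} (α : Vec ℕ k) : Set where
  constructor mkSSOT
  field
    steps  : List (Partition × Partition)
    .valid : ValidSSOT ∅ₚ steps (toList α) λ′

-- length of an SSOT = Σ m_i
weight : ∀ {k} → Vec ℕ k → ℕ
weight α = sum (toList α)

-- Coefficient of x^α in s_β s_λ : pairs of tableaux with contents α₁, α₂,
-- α₁ + α₂ = α.

ProdCoeff : Partition → Partition → {k : ℕ} → Vec ℕ k → Set
ProdCoeff β λ′ {k} α =
  Σ[ α₁ ∈ Vec ℕ k ] Σ[ α₂ ∈ Vec ℕ k ]
    (Irrelevant (zipWith _+_ α₁ α₂ ≡ α) × SSYT β α₁ × SSYT λ′ α₂)

-- Coefficient of x^α in Σ_ν c^ν_{βλ} s_ν (c β ν stands for c^ν_{βλ})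
LRExpansionCoeff : (Partition → Partition → ℕ) → Partition → {k : ℕ} → Vec ℕ k → Set
LRExpansionCoeff c β α = Σ[ ν ∈ Partition ] (Fin (c β ν) × SSYT ν α)

-- c β ν = c^ν_{βλ}: s_β s_λ = Σ_ν c^ν_{βλ} s_ν, as an identity of
-- coefficients of every monomial (counted via bijections of finite sets).
IsLRCoeffs : Partition → (Partition → Partition → ℕ) → Set
IsLRCoeffs λ′ c = ∀ β (k : ℕ) (α : Vec ℕ k) → ProdCoeff β λ′ α ↔ LRExpansionCoeff c β α

-- coefficient of x^α in ss_{λ,n}: SSOTs of shape λ, weight x^α, length n
SSCoeff : Partition → ℕ → {k : ℕ} → Vec ℕ k → Set
SSCoeff λ′ n α = SSOT λ′ α × Irrelevant (weight α ≡ n)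

RHSCoeff : (Partition → Partition → ℕ) → Partition → ℕ → {k : ℕ} → Vec ℕ k → Set
RHSCoeff c λ′ n α =
  Σ[ β ∈ Partition ] Σ[ ν ∈ Partition ]
    (Irrelevant (ConjEven β) × Irrelevant (InV n λ′ ν) × Fin (c β ν) × SSYT ν α)

{-# OPTIONS --safe #-}
module Submission where

-- Let U(x) and D(x) add and remove horizontal strips weighted by x.  An SSOT of shape λ is
-- a term of ⟨λ| U(x_k) D(x_k) ⋯ U(x_1) D(x_1) |∅⟩.  The local rule
-- D(y) U(x) = (1 − xy)⁻¹ U(x) D(y) gives the Pieri rule.  With E = Σ_{β′ even} β one has
-- D(x) E = U(x) E, since on both sides the strip is determined by its other end.  By
-- induction on the number of variables these two facts identify ss_λ with
-- Σ_{β′ even} s_β s_λ.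
--
-- It remains to see that c^ν_{βλ} ≠ 0 with β′ even forces ν ∈ V(λ).  Multiplication by s_λ
-- commutes with multiplication by h_1 and h_2, hence by e_2 = h_1² − h_2; since Schur
-- expansions are unique, this is an identity between the numbers c^ν_{βλ}.  So, building β
-- from ∅ by vertical strips of size 2, one finds such a chain from λ to ν as well.

open import Defs
open import Data.Empty using (⊥-elim; ⊥-elim-irr)
open import Data.Fin as Fin using (Fin; toℕ)
open import Data.Fin.Permutation using (↔⇒≡)
open import Data.Fin.Properties using (+↔⊎; *↔×; 0↔⊥; 1↔⊤; fromℕ<-toℕ; toℕ-fromℕ<; toℕ<n)
open import Data.Irrelevant using (Irrelevant; [_])
open import Data.List using (List; []; _∷_; length; map; filter; concat; take; replicate; applyUpTo; upTo; _++_)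
open import Data.List.Properties using (≡-dec; ∷-injectiveʳ; length-++; length-replicate; length-take; take-all; length-map; map-applyUpTo; length-applyUpTo; length-filter; filter-++)
import Data.List.Relation.Unary.All as All
import Data.List.Relation.Unary.All.Properties as AllP
open import Data.Nat
open import Data.Nat.Divisibility using (_∣_; divides; _∣0; ∣-refl; ∣m∣n⇒∣m+n; ∣m+n∣m⇒∣n; ∣1⇒≡1)
open import Data.Nat.ListAction using (sum)
open import Data.Nat.Properties
open import Data.Nat.Tactic.RingSolver using (solve-∀)
open import Data.Product using (Σ; Σ-syntax; ∃; _×_; _,_; proj₁; proj₂)
open import Data.Product.Function.NonDependent.Propositional using (_×-↔_)
open import Data.Sum using (_⊎_; inj₁; inj₂)
open import Data.Sum.Function.Propositional using (_⊎-↔_)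
open import Data.Unit using (⊤; tt)
open import Data.Vec using (Vec; []; _∷_; _∷ʳ_; toList; lookup; zipWith; reverse)
open import Data.Vec.Properties using (zipWith-assoc; zipWith-comm; ∷-injective; reverse-∷; reverse-involutive; reverse-injective) renaming (≡-dec to ≡ᵥ-dec)
open import Function using (_∘_; _∋_)
open import Function.Bundles using (_↔_; Inverse; mk↔ₛ′)
open import Function.Properties.Inverse using (↔-refl; ↔-sym; ↔-trans)
open import Relation.Binary.Definitions using (tri<; tri≈; tri>)
open import Relation.Binary.PropositionalEquality
open import Relation.Nullary using (¬_; Dec; yes; no; contradiction)
open import Relation.Nullary.Decidable using (recompute; _×-dec_; map′)
open import Relation.Nullary.Recomputable using (Recomputable; _×-recompute_; Π-recompute; ¬-recompute)

-- Coefficients are finite sets here, so each identity of symmetric functions is a bijection, and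
-- two obstacles shape the argument. There are no signs: a difference such as h_1² - h_2 becomes the
-- cancellation of a summand from a disjoint union, which is legitimate only through cardinalities,
-- and this is why partitions, strips and chains are enumerated. Moreover `c` is known only through
-- the expansions of the products s_β s_λ, so a statement about a single number `c β ν` has to be
-- extracted from the uniqueness of Schur expansions. Side conditions are kept irrelevant, so that
-- two tuples are equal as soon as their combinatorial data agree. Where a relevant proof of such a
-- condition is needed, it is recomputed from decidability.

unsquash : {A : Set} → Recomputable A → Irrelevant A → A
unsquash r [ a ] = r a

≤-rec : ∀ {m n} → Recomputable (m ≤ n)
≤-rec {m} {n} = recompute (m ≤? n)

≡-rec : {m n : ℕ} → Recomputable (m ≡ n)
≡-rec {m} {n} = recompute (m ≟ n)

-- Sums over initial segments of ℕ

sumTo : ℕ → (ℕ → ℕ) → ℕ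
sumTo zero    f = 0
sumTo (suc n) f = f 0 + sumTo n (f ∘ suc)

sumTo-cong : ∀ n {f g : ℕ → ℕ} → (∀ i → i < n → f i ≡ g i) → sumTo n f ≡ sumTo n g
sumTo-cong zero    h = refl
sumTo-cong (suc n) h = cong₂ _+_ (h 0 (s≤s z≤n)) (sumTo-cong n (λ i p → h (suc i) (s≤s p)))

sumTo-mono : ∀ n {f g : ℕ → ℕ} → (∀ i → i < n → f i ≤ g i) → sumTo n f ≤ sumTo n g
sumTo-mono zero    h = z≤n
sumTo-mono (suc n) h = +-mono-≤ (h 0 (s≤s z≤n)) (sumTo-mono n (λ i p → h (suc i) (s≤s p)))

sumTo-+ : ∀ n (f g : ℕ → ℕ) → sumTo n (λ i → f i + g i) ≡ sumTo n f + sumTo n g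
sumTo-+ zero    f g = refl
sumTo-+ (suc n) f g rewrite sumTo-+ n (f ∘ suc) (g ∘ suc) =
  lem (f 0) (g 0) (sumTo n (f ∘ suc)) (sumTo n (g ∘ suc))
  where
  lem : ∀ a b c d → a + b + (c + d) ≡ a + c + (b + d)
  lem = solve-∀

sumTo-zero : ∀ n {f : ℕ → ℕ} → (∀ i → i < n → f i ≡ 0) → sumTo n f ≡ 0
sumTo-zero zero    h = refl
sumTo-zero (suc n) h = cong₂ _+_ (h 0 (s≤s z≤n)) (sumTo-zero n (λ i p → h (suc i) (s≤s p)))

sumTo-snoc : ∀ n (f : ℕ → ℕ) → sumTo (suc n) f ≡ sumTo n f + f n
sumTo-snoc zero    f = +-comm (f 0) 0
sumTo-snoc (suc n) f = trans (cong (f 0 +_) (sumTo-snoc n (f ∘ suc))) (sym (+-assoc (f 0) _ _))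

-- Termwise inequality leaves no slack once the totals are reversed. It is applied to parts, in
-- `part-rigid` and `one-box`, and to prefix sums, in `rank-strict`.
sumTo-rigid : ∀ n {f g : ℕ → ℕ} → (∀ i → i < n → f i ≤ g i) → sumTo n g ≤ sumTo n f →
              ∀ i → i < n → f i ≡ g i
sumTo-rigid (suc n) {f} {g} h e zero p =
  ≤-antisym (h 0 p) (+-cancelʳ-≤ (sumTo n (f ∘ suc)) (g 0) (f 0)
    (≤-trans (+-monoʳ-≤ (g 0) (sumTo-mono n (λ i q → h (suc i) (s≤s q)))) e))
sumTo-rigid (suc n) {f} {g} h e (suc i) (s≤s p) =
  sumTo-rigid n (λ j q → h (suc j) (s≤s q))
    (+-cancelˡ-≤ (f 0) _ _ (≤-trans (+-monoˡ-≤ (sumTo n (g ∘ suc)) (h 0 (s≤s z≤n))) e)) i p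

-- Partitions as weakly decreasing, eventually zero functions

tail-wf : ∀ {a} l → IsPartition (a ∷ l) → IsPartition l
tail-wf []      _       = tt
tail-wf (b ∷ l) (_ , p) = p

head-pos : ∀ a l → IsPartition (a ∷ l) → 1 ≤ a
head-pos a []      p       = p
head-pos a (b ∷ l) (q , p) = ≤-trans (head-pos b l p) q

cons-wf : ∀ {a} l → 1 ≤ a → nth l 0 ≤ a → IsPartition l → IsPartition (a ∷ l)
cons-wf []      p q r = p
cons-wf (b ∷ l) p q r = q , r

nth-mono : ∀ l → IsPartition l → ∀ i → nth l (suc i) ≤ nth l i
nth-mono []          _       i       = z≤n
nth-mono (a ∷ [])    _       i       = z≤n
nth-mono (a ∷ b ∷ l) (p , q) zero    = p
nth-mono (a ∷ b ∷ l) (p , q) (suc i) = nth-mono (b ∷ l) q i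

nth-beyond : ∀ l {i} → length l ≤ i → nth l i ≡ 0
nth-beyond []      p       = refl
nth-beyond (a ∷ l) (s≤s p) = nth-beyond l p

nth-pos : ∀ l → IsPartition l → ∀ {i} → i < length l → 1 ≤ nth l i
nth-pos (a ∷ l) w {zero}  p       = head-pos a l w
nth-pos (a ∷ l) w {suc i} (s≤s p) = nth-pos l (tail-wf l w) p

nth-ext : ∀ l l′ → IsPartition l → IsPartition l′ → (∀ i → nth l i ≡ nth l′ i) → l ≡ l′
nth-ext []      []       _ _  h = refl
nth-ext []      (b ∷ l′) _ w′ h = contradiction (h 0) (<⇒≢ (head-pos b l′ w′))
nth-ext (a ∷ l) []       w _  h = contradiction (sym (h 0)) (<⇒≢ (head-pos a l w))
nth-ext (a ∷ l) (b ∷ l′) w w′ h =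
  cong₂ _∷_ (h 0) (nth-ext l l′ (tail-wf l w) (tail-wf l′ w′) (h ∘ suc))

height : Partition → ℕ
height μ = length (parts μ)

part-mono : ∀ μ i → part μ (suc i) ≤ part μ i
part-mono (mkPartition l w) i = ≤-rec (nth-mono l w i)

part-anti : ∀ μ {i j} → i ≤ j → part μ j ≤ part μ i
part-anti μ {i} {j} p = go (≤⇒≤′ p)
  where
  go : ∀ {j} → i ≤′ j → part μ j ≤ part μ i
  go ≤′-refl           = ≤-refl
  go (≤′-step {n = k} q) = ≤-trans (part-mono μ k) (go q)

part-beyond : ∀ μ {i} → height μ ≤ i → part μ i ≡ 0
part-beyond μ = nth-beyond (parts μ)

part-pos : ∀ μ {i} → i < height μ → 1 ≤ part μ i
part-pos (mkPartition l w) p = ≤-rec (nth-pos l w p)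

height-≤ : ∀ μ N → part μ N ≡ 0 → height μ ≤ N
height-≤ μ N e = ≮⇒≥ λ p → <⇒≢ (part-pos μ p) (sym e)

parts-inj : ∀ {μ ν} → parts μ ≡ parts ν → μ ≡ ν
parts-inj refl = refl

infix 4 _≟ₚ_
_≟ₚ_ : (μ ν : Partition) → Dec (μ ≡ ν)
μ ≟ₚ ν with ≡-dec _≟_ (parts μ) (parts ν)
... | yes e = yes (parts-inj e)
... | no ne = no λ { refl → ne refl }

≡ₚ-rec : {μ ν : Partition} → Recomputable (μ ≡ ν)
≡ₚ-rec {μ} {ν} = recompute (μ ≟ₚ ν)

part-ext : ∀ {μ ν} → (∀ i → part μ i ≡ part ν i) → μ ≡ ν
part-ext {mkPartition l w} {mkPartition l′ w′} h = ≡ₚ-rec (parts-inj (nth-ext l l′ w w′ h))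

-- The list stops at the first zero, since parts must be positive; `N` only bounds the recursion.
trim : (ℕ → ℕ) → ℕ → List ℕ
trim f zero    = []
trim f (suc N) with f 0
... | zero  = []
... | suc a = suc a ∷ trim (f ∘ suc) N

Decreasing : (ℕ → ℕ) → Set
Decreasing f = ∀ i → f (suc i) ≤ f i

decreasing-zero : ∀ {f} → Decreasing f → f 0 ≡ 0 → ∀ i → f i ≡ 0
decreasing-zero d e zero    = e
decreasing-zero d e (suc i) = n≤0⇒n≡0 (≤-trans (d i) (≤-reflexive (decreasing-zero d e i)))

nth-trim : ∀ f N → Decreasing f → f N ≡ 0 → ∀ i → nth (trim f N) i ≡ f i
nth-trim f zero    d e i = sym (decreasing-zero d e i)
nth-trim f (suc N) d e i with f 0 in eq
nth-trim f (suc N) d e i       | zero  = sym (decreasing-zero d eq i)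
nth-trim f (suc N) d e zero    | suc a = sym eq
nth-trim f (suc N) d e (suc i) | suc a = nth-trim (f ∘ suc) N (d ∘ suc) e i

trim-wf : ∀ f N → Decreasing f → f N ≡ 0 → IsPartition (trim f N)
trim-wf f zero    d e = tt
trim-wf f (suc N) d e with f 0 in eq
... | zero  = tt
... | suc a = cons-wf (trim (f ∘ suc) N) (s≤s z≤n)
  (≤-trans (≤-reflexive (nth-trim (f ∘ suc) N (d ∘ suc) e 0)) (≤-trans (d 0) (≤-reflexive eq)))
  (trim-wf (f ∘ suc) N (d ∘ suc) e)

fromFun : ∀ f N → .(Decreasing f) → .(f N ≡ 0) → Partition
fromFun f N d e = mkPartition (trim f N) (trim-wf f N d e)

part-fromFun : ∀ f N → .(d : Decreasing f) → .(e : f N ≡ 0) → ∀ i → part (fromFun f N d e) i ≡ f i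
part-fromFun f N d e i = ≡-rec (nth-trim f N d e i)

sum-nth : ∀ l {N} → length l ≤ N → sum l ≡ sumTo N (nth l)
sum-nth []      {N} p       = sym (sumTo-zero N (λ _ _ → refl))
sum-nth (a ∷ l)     (s≤s p) = cong (a +_) (sum-nth l p)

size-sumTo : ∀ μ {N} → height μ ≤ N → size μ ≡ sumTo N (part μ)
size-sumTo μ = sum-nth (parts μ)

size-mono : ∀ μ ν → (∀ i → part μ i ≤ part ν i) → size μ ≤ size ν
size-mono μ ν h = subst₂ _≤_ (sym (size-sumTo μ (m≤m⊔n (height μ) (height ν))))
                            (sym (size-sumTo ν (m≤n⊔m (height μ) (height ν))))
                            (sumTo-mono (height μ ⊔ height ν) (λ i _ → h i))

part-rigid : ∀ {μ ν} → (∀ i → part μ i ≤ part ν i) → size μ ≡ size ν → μ ≡ ν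
part-rigid {μ} {ν} h e = part-ext λ i →
  sumTo-rigid (height μ ⊔ height ν ⊔ suc i) (λ j _ → h j)
    (≤-reflexive (trans (sym (size-sumTo ν (≤-trans (m≤n⊔m (height μ) (height ν)) (m≤m⊔n _ (suc i)))))
      (trans (sym e) (size-sumTo μ (≤-trans (m≤m⊔n (height μ) (height ν)) (m≤m⊔n _ (suc i)))))))
    i (m≤n⊔m _ (suc i))

height≤size : ∀ μ → height μ ≤ size μ
height≤size (mkPartition l w) = ≤-rec (go l w)
  where
  go : ∀ l → IsPartition l → length l ≤ sum l
  go []      _ = z≤n
  go (a ∷ l) w = +-mono-≤ (head-pos a l w) (go l (tail-wf l w))

size-zero : ∀ {μ} → size μ ≡ 0 → μ ≡ ∅ₚ
size-zero {μ} e = sym (part-rigid (λ _ → z≤n) (sym e))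

-- Horizontal strips and the local growth rule

Interlace : Partition → Partition → Set
Interlace ν μ = ∀ i → part μ i ≤ part ν i × part ν (suc i) ≤ part μ i

-- ν/μ is a horizontal strip of size a: ν₀ ≥ μ₀ ≥ ν₁ ≥ μ₁ ≥ ….
record HS (a : ℕ) (ν μ : Partition) : Set where
  constructor mkHS
  field .strip : Interlace ν μ × size ν ≡ a + size μ

openHS : ∀ {a ν μ} → HS a ν μ → Interlace ν μ × size ν ≡ a + size μ
openHS (mkHS c) = (Π-recompute _ (λ i → ≤-rec ×-recompute ≤-rec) ×-recompute ≡-rec) c

-- Reflection of the interval from `lo` to `hi`: it stays inside, has constant sum with `x`, and is
-- an involution. Truncated subtraction is exact because `x ≤ hi`.
reflect-lemma : ∀ {lo hi x} → lo ≤ x → x ≤ hi →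
  lo ≤ hi + lo ∸ x × hi + lo ∸ x ≤ hi × x + (hi + lo ∸ x) ≡ hi + lo × hi + lo ∸ (hi + lo ∸ x) ≡ x
reflect-lemma {lo} {hi} {x} p q =
  ≤-trans (≤-reflexive (sym (m+n∸m≡n x lo))) (∸-monoˡ-≤ x (+-monoˡ-≤ lo q)) ,
  ≤-trans (∸-monoʳ-≤ (hi + lo) p) (≤-reflexive (m+n∸n≡m hi lo)) ,
  m+[n∸m]≡n x≤ ,
  m∸[m∸n]≡n x≤
  where x≤ = ≤-trans q (m≤m+n hi lo)

⊓+⊔ : ∀ m n → m ⊓ n + (m ⊔ n) ≡ m + n
⊓+⊔ m n with ≤-total m n
... | inj₁ p rewrite m≤n⇒m⊓n≡m p | m≤n⇒m⊔n≡n p = refl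
... | inj₂ p rewrite m≥n⇒m⊓n≡n p | m≥n⇒m⊔n≡m p = +-comm n m

-- Fomin's local growth rule in the piecewise linear form: all parts of ν but the first are
-- reflected in the interval of values allowed by μ and ρ, and j is the excess of the first part.
module LocalRule (μ ρ : Partition) where

  lo hi : ℕ → ℕ
  lo i = part μ (suc i) ⊔ part ρ (suc i)
  hi i = part μ i ⊓ part ρ i

  top : ℕ
  top = part μ 0 ⊔ part ρ 0

  ⊓≤⊔ : ∀ m n → m ⊓ n ≤ m ⊔ n
  ⊓≤⊔ m n = ≤-trans (m⊓n≤m m n) (m≤m⊔n m n)

  Reflected : Partition → Partition → Set
  Reflected ν τ = ∀ i → part ν (suc i) + part τ i ≡ hi i + lo i

  -- Summed over all rows, the minima `hi` and the maxima `lo` nearly account for |μ| + |ρ|, since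
  -- min + max = sum in each row; only the maximum in row 0 is missing, and that is `top`. This
  -- conservation law fixes the strip sizes on both sides of the local rule.
  size-balance : ∀ ν τ → Reflected ν τ → size ν + size τ + top ≡ part ν 0 + (size μ + size ρ)
  size-balance ν τ h = begin
    size ν + size τ + top
      ≡⟨ cong₂ (λ x y → x + y + top) (size-sumTo ν hν) (size-sumTo τ hτ) ⟩
    part ν 0 + sumTo N (part ν ∘ suc) + sumTo N (part τ) + top
      ≡⟨ lem₁ (part ν 0) _ _ top ⟩
    part ν 0 + (sumTo N (part ν ∘ suc) + sumTo N (part τ) + top)
      ≡⟨ cong (λ x → part ν 0 + (x + top)) (sym (sumTo-+ N (part ν ∘ suc) (part τ))) ⟩
    part ν 0 + (sumTo N (λ i → part ν (suc i) + part τ i) + top)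
      ≡⟨ cong (λ x → part ν 0 + (x + top)) (trans (sumTo-cong N (λ i _ → h i)) (sumTo-+ N hi lo)) ⟩
    part ν 0 + (sumTo N hi + sumTo N lo + top)
      -- The maxima, completed by `top`, run over one more row than the minima; the range of the
      -- minima can be enlarged because `hi N` vanishes.
      ≡⟨ cong (λ x → part ν 0 + (x + sumTo N lo + top))
           (sym (trans (sumTo-snoc N hi) (trans (cong (sumTo N hi +_) hiN) (+-identityʳ _)))) ⟩
    part ν 0 + (sumTo (suc N) hi + sumTo N lo + top)
      ≡⟨ cong (part ν 0 +_) (lem₂ (sumTo (suc N) hi) _ top) ⟩
    part ν 0 + (sumTo (suc N) hi + sumTo (suc N) (λ i → part μ i ⊔ part ρ i))
      ≡⟨ cong (part ν 0 +_) (trans (sym (sumTo-+ (suc N) hi (λ i → part μ i ⊔ part ρ i)))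
           (sumTo-cong (suc N) (λ i _ → ⊓+⊔ (part μ i) (part ρ i)))) ⟩
    part ν 0 + sumTo (suc N) (λ i → part μ i + part ρ i)
      ≡⟨ cong (part ν 0 +_) (sumTo-+ (suc N) (part μ) (part ρ)) ⟩
    part ν 0 + (sumTo (suc N) (part μ) + sumTo (suc N) (part ρ))
      ≡⟨ cong (part ν 0 +_) (sym (cong₂ _+_ (size-sumTo μ (m≤n⇒m≤1+n hμ)) (size-sumTo ρ hρ))) ⟩
    part ν 0 + (size μ + size ρ) ∎
    where
    open ≡-Reasoning
    N = height μ + height ρ + height ν + height τ
    hμ : height μ ≤ N
    hμ = ≤-trans (m≤m+n _ _) (≤-trans (m≤m+n (height μ + height ρ) (height ν)) (m≤m+n _ _))
    hρ : height ρ ≤ suc N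
    hρ = m≤n⇒m≤1+n (≤-trans (m≤n+m _ _) (≤-trans (m≤m+n (height μ + height ρ) (height ν)) (m≤m+n _ _)))
    hν : height ν ≤ suc N
    hν = m≤n⇒m≤1+n (≤-trans (m≤n+m (height ν) (height μ + height ρ)) (m≤m+n _ _))
    hτ : height τ ≤ N
    hτ = m≤n+m _ _
    hiN : hi N ≡ 0
    hiN = n≤0⇒n≡0 (≤-trans (m⊓n≤m _ _) (≤-reflexive (part-beyond μ hμ)))
    lem₁ : ∀ a b c d → a + b + c + d ≡ a + (b + c + d)
    lem₁ = solve-∀
    lem₂ : ∀ a b c → a + b + c ≡ a + (c + b)
    lem₂ = solve-∀

  module Down (ν : Partition) (p : Interlace ν μ) (q : Interlace ν ρ) where

    lo≤ : ∀ i → lo i ≤ part ν (suc i)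
    lo≤ i = ⊔-lub (proj₁ (p (suc i))) (proj₁ (q (suc i)))

    ≤hi : ∀ i → part ν (suc i) ≤ hi i
    ≤hi i = ⊓-glb (proj₂ (p i)) (proj₂ (q i))

    f : ℕ → ℕ
    f i = hi i + lo i ∸ part ν (suc i)

    f-lo : ∀ i → lo i ≤ f i
    f-lo i = proj₁ (reflect-lemma (lo≤ i) (≤hi i))

    f-hi : ∀ i → f i ≤ hi i
    f-hi i = proj₁ (proj₂ (reflect-lemma (lo≤ i) (≤hi i)))

    -- The intervals are stacked: `hi (suc i)` is the minimum and `lo i` the maximum of the same two
    -- parts, so any choice of one value from each interval is decreasing.
    f-decreasing : Decreasing f
    f-decreasing i = ≤-trans (f-hi (suc i)) (≤-trans (⊓≤⊔ (part μ (suc i)) _) (f-lo i))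

    f-end : f (height μ) ≡ 0
    f-end = n≤0⇒n≡0 (≤-trans (f-hi (height μ)) (≤-trans (m⊓n≤m _ _) (≤-reflexive (part-beyond μ ≤-refl))))

    top≤ : top ≤ part ν 0
    top≤ = ⊔-lub (proj₁ (p 0)) (proj₁ (q 0))

  module Up (j : ℕ) (τ : Partition) (p : Interlace μ τ) (q : Interlace ρ τ) where

    lo≤ : ∀ i → lo i ≤ part τ i
    lo≤ i = ⊔-lub (proj₂ (p i)) (proj₂ (q i))

    ≤hi : ∀ i → part τ i ≤ hi i
    ≤hi i = ⊓-glb (proj₁ (p i)) (proj₁ (q i))

    g : ℕ → ℕ
    g zero    = top + j
    g (suc i) = hi i + lo i ∸ part τ i

    g-lo : ∀ i → lo i ≤ g (suc i)
    g-lo i = proj₁ (reflect-lemma (lo≤ i) (≤hi i))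

    g-hi : ∀ i → g (suc i) ≤ hi i
    g-hi i = proj₁ (proj₂ (reflect-lemma (lo≤ i) (≤hi i)))

    g-decreasing : Decreasing g
    g-decreasing zero    = ≤-trans (g-hi 0) (≤-trans (⊓≤⊔ (part μ 0) _) (m≤m+n top j))
    g-decreasing (suc i) = ≤-trans (g-hi (suc i)) (≤-trans (⊓≤⊔ (part μ (suc i)) _) (g-lo i))

    g-end : g (suc (height μ)) ≡ 0
    g-end = n≤0⇒n≡0 (≤-trans (g-hi (height μ)) (≤-trans (m⊓n≤m _ _) (≤-reflexive (part-beyond μ ≤-refl))))

  Above : ℕ → ℕ → Set
  Above a b = Σ[ ν ∈ Partition ] (HS a ν μ × HS b ν ρ)

  -- The number `j` is the exponent in the geometric series (1 - xy)⁻¹ = Σ (xy)^j, hence it counts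
  -- towards both `a` and `b`. Opposite sides of the diamond μ, ν, ρ, τ have equal size up to this
  -- excess.
  Below : ℕ → ℕ → Set
  Below a b = Σ[ j ∈ ℕ ] Σ[ a′ ∈ ℕ ] Σ[ b′ ∈ ℕ ] (Irrelevant (j + a′ ≡ a × j + b′ ≡ b) ×
              Σ[ τ ∈ Partition ] (HS b′ μ τ × HS a′ ρ τ))

  down : ∀ {a b} → Above a b → Below a b
  down {a} {b} (ν , h , k) with openHS h | openHS k
  ... | p , s | q , t = part ν 0 ∸ top , size ρ ∸ size τ , size μ ∸ size τ ,
        [ eqa , eqb ] , τ , mkHS ((λ i → τ≤μ i , μ≤τ i) , eqμ) , mkHS ((λ i → τ≤ρ i , ρ≤τ i) , eqρ)
    where
    open Down ν p q
    τ = fromFun f (height μ) f-decreasing f-end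
    τf : ∀ i → part τ i ≡ f i
    τf = part-fromFun f (height μ) f-decreasing f-end
    τ≤μ : ∀ i → part τ i ≤ part μ i
    τ≤μ i = subst (_≤ _) (sym (τf i)) (≤-trans (f-hi i) (m⊓n≤m _ _))
    τ≤ρ : ∀ i → part τ i ≤ part ρ i
    τ≤ρ i = subst (_≤ _) (sym (τf i)) (≤-trans (f-hi i) (m⊓n≤n _ _))
    μ≤τ : ∀ i → part μ (suc i) ≤ part τ i
    μ≤τ i = subst (_ ≤_) (sym (τf i)) (≤-trans (m≤m⊔n _ _) (f-lo i))
    ρ≤τ : ∀ i → part ρ (suc i) ≤ part τ i
    ρ≤τ i = subst (_ ≤_) (sym (τf i)) (≤-trans (m≤n⊔m _ _) (f-lo i))
    balance : size ν + size τ + top ≡ part ν 0 + (size μ + size ρ)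
    balance = size-balance ν τ λ i → trans (cong (part ν (suc i) +_) (τf i))
      (proj₁ (proj₂ (proj₂ (reflect-lemma (lo≤ i) (≤hi i)))))
    eqμ : size μ ≡ size μ ∸ size τ + size τ
    eqμ = sym (m∸n+n≡m (size-mono τ μ τ≤μ))
    eqρ : size ρ ≡ size ρ ∸ size τ + size τ
    eqρ = sym (m∸n+n≡m (size-mono τ ρ τ≤ρ))
    solve-excess : ∀ x y c → c + y + size τ + top ≡ part ν 0 + (y + x) → size τ ≤ x →
                   part ν 0 ∸ top + (x ∸ size τ) ≡ c
    solve-excess x y c e le = +-cancelʳ-≡ (y + size τ + top) _ _ (begin
        part ν 0 ∸ top + (x ∸ size τ) + (y + size τ + top)
          ≡⟨ lem (part ν 0 ∸ top) (x ∸ size τ) y (size τ) top ⟩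
        part ν 0 ∸ top + top + (y + (x ∸ size τ + size τ))
          ≡⟨ cong₂ (λ u v → u + (y + v)) (m∸n+n≡m top≤) (m∸n+n≡m le) ⟩
        part ν 0 + (y + x)
          ≡⟨ sym e ⟩
        c + y + size τ + top
          ≡⟨ lem′ c y (size τ) top ⟩
        c + (y + size τ + top) ∎)
      where
      open ≡-Reasoning
      lem : ∀ a b c d e → a + b + (c + d + e) ≡ a + e + (c + (b + d))
      lem = solve-∀
      lem′ : ∀ a b c d → a + b + c + d ≡ a + (b + c + d)
      lem′ = solve-∀
    eqa : part ν 0 ∸ top + (size ρ ∸ size τ) ≡ a
    eqa = solve-excess (size ρ) (size μ) a
      (trans (cong (λ x → x + size τ + top) (sym s)) balance) (size-mono τ ρ τ≤ρ)
    eqb : part ν 0 ∸ top + (size μ ∸ size τ) ≡ b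
    eqb = solve-excess (size μ) (size ρ) b
      (trans (cong (λ x → x + size τ + top) (sym t))
        (trans balance (cong (part ν 0 +_) (+-comm (size μ) (size ρ))))) (size-mono τ μ τ≤μ)

  up : ∀ {a b} → Below a b → Above a b
  up {a} {b} (j , a′ , b′ , e , τ , h , k) with unsquash (≡-rec ×-recompute ≡-rec) e | openHS h | openHS k
  ... | ea , eb | p , s | q , t = ν , mkHS ((λ i → μ≤ν i , ν≤μ i) , eqμ) , mkHS ((λ i → ρ≤ν i , ν≤ρ i) , eqρ)
    where
    open Up j τ p q
    ν = fromFun g (suc (height μ)) g-decreasing g-end
    νg : ∀ i → part ν i ≡ g i
    νg = part-fromFun g (suc (height μ)) g-decreasing g-end
    μ≤ν : ∀ i → part μ i ≤ part ν i
    μ≤ν zero    = subst (_ ≤_) (sym (νg 0)) (≤-trans (m≤m⊔n _ _) (m≤m+n top j))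
    μ≤ν (suc i) = subst (_ ≤_) (sym (νg (suc i))) (≤-trans (m≤m⊔n _ _) (g-lo i))
    ρ≤ν : ∀ i → part ρ i ≤ part ν i
    ρ≤ν zero    = subst (_ ≤_) (sym (νg 0)) (≤-trans (m≤n⊔m (part μ 0) _) (m≤m+n top j))
    ρ≤ν (suc i) = subst (_ ≤_) (sym (νg (suc i))) (≤-trans (m≤n⊔m _ _) (g-lo i))
    ν≤μ : ∀ i → part ν (suc i) ≤ part μ i
    ν≤μ i = subst (_≤ _) (sym (νg (suc i))) (≤-trans (g-hi i) (m⊓n≤m _ _))
    ν≤ρ : ∀ i → part ν (suc i) ≤ part ρ i
    ν≤ρ i = subst (_≤ _) (sym (νg (suc i))) (≤-trans (g-hi i) (m⊓n≤n _ _))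
    balance : size ν + size τ + top ≡ part ν 0 + (size μ + size ρ)
    balance = size-balance ν τ λ i → trans (cong (_+ part τ i) (νg (suc i)))
      (trans (+-comm _ (part τ i)) (proj₁ (proj₂ (proj₂ (reflect-lemma (lo≤ i) (≤hi i))))))
    size-ν : size ν + (size τ + top) ≡ j + (size μ + size ρ) + top
    size-ν = trans (sym (+-assoc (size ν) _ _)) (trans balance
      (trans (cong (_+ (size μ + size ρ)) (νg 0)) (lem top j _)))
      where
      lem : ∀ a b c → a + b + c ≡ b + c + a
      lem = solve-∀
    eqμ : size ν ≡ a + size μ
    eqμ = +-cancelʳ-≡ (size τ + top) _ _ (trans size-ν (trans
      (cong (λ x → j + (size μ + x) + top) t) (trans (lem j (size μ) a′ (size τ) top)
      (cong (λ x → x + size μ + (size τ + top)) ea))))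
      where
      lem : ∀ j m a t p → j + (m + (a + t)) + p ≡ j + a + m + (t + p)
      lem = solve-∀
    eqρ : size ν ≡ b + size ρ
    eqρ = +-cancelʳ-≡ (size τ + top) _ _ (trans size-ν (trans
      (cong (λ x → j + (x + size ρ) + top) s) (trans (lem j (size ρ) b′ (size τ) top)
      (cong (λ x → x + size ρ + (size τ + top)) eb))))
      where
      lem : ∀ j m a t p → j + (a + t + m) + p ≡ j + a + m + (t + p)
      lem = solve-∀

  below-≡ : ∀ {a b} {x y : Below a b} → proj₁ x ≡ proj₁ y →
            (∀ i → part (proj₁ (proj₂ (proj₂ (proj₂ (proj₂ x))))) i ≡ part (proj₁ (proj₂ (proj₂ (proj₂ (proj₂ y))))) i) →
            x ≡ y
  below-≡ {x = j , a , b , [ e ] , τ , h , k} {y = .j , a′ , b′ , [ e′ ] , τ′ , h′ , k′} refl f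
    with +-cancelˡ-≡ j a a′ (≡-rec (trans (proj₁ e) (sym (proj₁ e′))))
       | +-cancelˡ-≡ j b b′ (≡-rec (trans (proj₂ e) (sym (proj₂ e′)))) | part-ext {τ} {τ′} f
  ... | refl | refl | refl = refl

  above-≡ : ∀ {a b} {x y : Above a b} → (∀ i → part (proj₁ x) i ≡ part (proj₁ y) i) → x ≡ y
  above-≡ {x = ν , h , k} {y = ν′ , h′ , k′} f with part-ext {ν} {ν′} f
  ... | refl = refl

  local-rule : ∀ a b → Above a b ↔ Below a b
  local-rule a b = mk↔ₛ′ down up down-up up-down
    where
    down-up : ∀ x → down (up x) ≡ x
    down-up x@(j , a′ , b′ , e , τ , h , k) = below-≡ excess λ i → trans (Dn.τf i) (trans
        (cong (hi i + lo i ∸_) (νg (suc i))) (proj₂ (proj₂ (proj₂ (reflect-lemma (lo≤ i) (≤hi i))))))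
      where
      open Up j τ (proj₁ (openHS h)) (proj₁ (openHS k))
      ν = proj₁ (up x)
      νg : ∀ i → part ν i ≡ g i
      νg = part-fromFun g (suc (height μ)) g-decreasing g-end
      module Dn where
        open Down ν (proj₁ (openHS (proj₁ (proj₂ (up x))))) (proj₁ (openHS (proj₂ (proj₂ (up x)))))
        τf : ∀ i → part (fromFun f (height μ) f-decreasing f-end) i ≡ f i
        τf = part-fromFun f (height μ) f-decreasing f-end
      excess : part ν 0 ∸ top ≡ j
      excess = trans (cong (_∸ top) (νg 0)) (m+n∸m≡n top j)
    up-down : ∀ x → up (down x) ≡ x
    up-down x@(ν , h , k) = above-≡ λ { zero → trans (Up′.νg 0) (m+[n∸m]≡n top≤)
                                      ; (suc i) → trans (Up′.νg (suc i)) (trans (cong (hi i + lo i ∸_) (τf i))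
                                          (proj₂ (proj₂ (proj₂ (reflect-lemma (lo≤ i) (≤hi i)))))) }
      where
      open Down ν (proj₁ (openHS h)) (proj₁ (openHS k))
      τf : ∀ i → part (fromFun f (height μ) f-decreasing f-end) i ≡ f i
      τf = part-fromFun f (height μ) f-decreasing f-end
      y = down x
      module Up′ where
        open Up (proj₁ y) (proj₁ (proj₂ (proj₂ (proj₂ (proj₂ y))))) (proj₁ (openHS (proj₁ (proj₂ (proj₂ (proj₂ (proj₂ (proj₂ y))))))))
                          (proj₁ (openHS (proj₂ (proj₂ (proj₂ (proj₂ (proj₂ (proj₂ y))))))))
        νg : ∀ i → part (fromFun g (suc (height μ)) g-decreasing g-end) i ≡ g i
        νg = part-fromFun g (suc (height μ)) g-decreasing g-end
open LocalRule public using (local-rule; Above; Below)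

-- Bijections between dependent sums

Σ-cong : {A : Set} {F G : A → Set} → (∀ x → F x ↔ G x) → Σ A F ↔ Σ A G
Σ-cong h = mk↔ₛ′ (λ { (x , y) → x , Inverse.to (h x) y }) (λ { (x , y) → x , Inverse.from (h x) y })
  (λ { (x , y) → cong (x ,_) (Inverse.strictlyInverseˡ (h x) y) })
  (λ { (x , y) → cong (x ,_) (Inverse.strictlyInverseʳ (h x) y) })

×-congʳ : {A B C : Set} → B ↔ C → (A × B) ↔ (A × C)
×-congʳ h = Σ-cong (λ _ → h)

infixr 2 _↔⟨_⟩_ _↔˘⟨_⟩_
infix  3 _↔∎

_↔⟨_⟩_ : (A : Set) {B C : Set} → A ↔ B → B ↔ C → A ↔ C
A ↔⟨ f ⟩ g = ↔-trans f g

_↔˘⟨_⟩_ : (A : Set) {B C : Set} → B ↔ A → B ↔ C → A ↔ C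
A ↔˘⟨ f ⟩ g = ↔-trans (↔-sym f) g

_↔∎ : (A : Set) → A ↔ A
A ↔∎ = ↔-refl

-- Tableaux as chains of strips, and the Pieri rule

vsum : ∀ {k} → Vec ℕ k → ℕ
vsum α = sum (toList α)

-- Semistandard tableaux as chains ∅ = ν⁰ ⊆ … ⊆ νᵏ = ν.  Contents are listed from the
-- last variable to the first, so that the head records the outermost strip.
Chain : ∀ {k} → Vec ℕ k → Partition → Set
Chain []      ν = Irrelevant (ν ≡ ∅ₚ)
Chain (a ∷ α) ν = Σ[ μ ∈ Partition ] (HS a ν μ × Chain α μ)

chain-size : ∀ {k} (α : Vec ℕ k) {ν} → Chain α ν → size ν ≡ vsum α
chain-size []      e           = cong size (unsquash ≡ₚ-rec e)
chain-size (a ∷ α) (μ , h , t) = trans (proj₂ (openHS h)) (cong (a +_) (chain-size α t))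

infix 4 _⊞_≡_
record _⊞_≡_ {k} (α β γ : Vec ℕ k) : Set where
  constructor ⊞-eq
  field .split : zipWith _+_ α β ≡ γ

⊞-open : ∀ {k} {α β γ : Vec ℕ k} → α ⊞ β ≡ γ → zipWith _+_ α β ≡ γ
⊞-open (⊞-eq e) = recompute (≡ᵥ-dec _≟_ _ _) e

⊞-cons : ∀ {k} {α β γ : Vec ℕ k} {a b c} → .(a + b ≡ c) → α ⊞ β ≡ γ → a ∷ α ⊞ b ∷ β ≡ c ∷ γ
⊞-cons e (⊞-eq s) = ⊞-eq (cong₂ _∷_ e s)

⊞-head : ∀ {k} {α β γ : Vec ℕ k} {a b c} → a ∷ α ⊞ b ∷ β ≡ c ∷ γ → a + b ≡ c
⊞-head s = proj₁ (∷-injective (⊞-open s))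

⊞-tail : ∀ {k} {α β γ : Vec ℕ k} {a b c} → a ∷ α ⊞ b ∷ β ≡ c ∷ γ → α ⊞ β ≡ γ
⊞-tail (⊞-eq s) = ⊞-eq (proj₂ (∷-injective s))

-- Both sides express x + γ + y = α, and `w` is determined by the second equation. It moves a factor
-- of content `γ` from one tableau of a product to the other.
⊞-swap : ∀ {k} (x γ y α : Vec ℕ k) →
         (Σ[ w ∈ Vec ℕ k ] (x ⊞ w ≡ α × γ ⊞ y ≡ w)) ↔ (Σ[ w ∈ Vec ℕ k ] (w ⊞ y ≡ α × γ ⊞ x ≡ w))
⊞-swap x γ y α = mk↔ₛ′
  (λ { (w , s , t) → zipWith _+_ γ x , ⊞-eq (trans swap (trans (cong (zipWith _+_ x) (⊞-open t)) (⊞-open s))) , ⊞-eq refl })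
  (λ { (w , s , t) → zipWith _+_ γ y , ⊞-eq (trans (sym swap) (trans (cong (λ u → zipWith _+_ u y) (⊞-open t)) (⊞-open s))) , ⊞-eq refl })
  (λ { (w , s , t) → uniq₁ (⊞-open t) })
  (λ { (w , s , t) → uniq₂ (⊞-open t) })
  where
  swap : zipWith _+_ (zipWith _+_ γ x) y ≡ zipWith _+_ x (zipWith _+_ γ y)
  swap = trans (cong (λ u → zipWith _+_ u y) (zipWith-comm +-comm γ x)) (zipWith-assoc +-assoc x γ y)
  uniq₁ : ∀ {w w′} {s : w ⊞ y ≡ α} {t : γ ⊞ x ≡ w} {s′ : w′ ⊞ y ≡ α} {t′ : γ ⊞ x ≡ w′} → w ≡ w′ → (w , s , t) ≡ (w′ , s′ , t′)
  uniq₁ refl = refl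
  uniq₂ : ∀ {w w′} {s : x ⊞ w ≡ α} {t : γ ⊞ y ≡ w} {s′ : x ⊞ w′ ≡ α} {t′ : γ ⊞ y ≡ w′} → w ≡ w′ → (w , s , t) ≡ (w′ , s′ , t′)
  uniq₂ refl = refl

-- The coefficient of x^α in h_b s_σ: a vector `γ` of total `b` is a monomial of h_b.
Skewed : ∀ {k} → ℕ → Vec ℕ k → Partition → Set
Skewed {k} b α σ = Σ[ γ ∈ Vec ℕ k ] Σ[ α′ ∈ Vec ℕ k ] (γ ⊞ α′ ≡ α × Irrelevant (vsum γ ≡ b) × Chain α′ σ)

-- The Pieri rule h_b s_σ = Σ s_μ: the removal of the outer strip μ/σ is commuted
-- past all the strips of the chain.
pieri : ∀ {k} b (α : Vec ℕ k) σ → (Σ[ μ ∈ Partition ] (HS b μ σ × Chain α μ)) ↔ Skewed b α σ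
pieri b [] σ = mk↔ₛ′ to from
  (λ { ([] , [] , _) → refl })
  (λ { (μ , h , [ e ]) → uniq (sym (≡ₚ-rec e)) })
  where
  to : Σ[ μ ∈ Partition ] (HS b μ σ × Irrelevant (μ ≡ ∅ₚ)) → Skewed b [] σ
  to (μ , h , e) = [] , [] , ⊞-eq refl , [ sym (m+n≡0⇒m≡0 b total) ] , [ size-zero (m+n≡0⇒n≡0 b total) ]
    where
    total : b + size σ ≡ 0
    total = trans (sym (proj₂ (openHS h))) (cong size (unsquash ≡ₚ-rec e))
  from : Skewed b [] σ → Σ[ μ ∈ Partition ] (HS b μ σ × Irrelevant (μ ≡ ∅ₚ))
  from ([] , [] , _ , [ p ] , [ e ]) =
    ∅ₚ , mkHS ((λ i → ≤-reflexive (cong (λ μ → part μ i) (≡ₚ-rec e)) , z≤n) , cong₂ _+_ (≡-rec p) (sym (cong size (≡ₚ-rec e)))) , [ refl ]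
  uniq : ∀ {μ μ′} {h : HS b μ σ} {h′ : HS b μ′ σ} {e : Irrelevant (μ ≡ ∅ₚ)} {e′ : Irrelevant (μ′ ≡ ∅ₚ)} → μ ≡ μ′ →
         (Σ[ μ ∈ Partition ] (HS b μ σ × Irrelevant (μ ≡ ∅ₚ)) ∋ (μ , h , e)) ≡ (μ′ , h′ , e′)
  uniq refl = refl
pieri b (a ∷ α) σ =
  (Σ[ ν ∈ Partition ] (HS b ν σ × Σ[ μ ∈ Partition ] (HS a ν μ × Chain α μ)))
    ↔⟨ mk↔ₛ′ (λ { (ν , h , μ , g , t) → μ , t , ν , g , h }) (λ { (μ , t , ν , g , h) → ν , h , μ , g , t })
             (λ _ → refl) (λ _ → refl) ⟩
  (Σ[ μ ∈ Partition ] (Chain α μ × Above μ σ a b))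
    -- The outer strip ν/σ and the last strip ν/μ of the chain form the upper half of a diamond.
    ↔⟨ Σ-cong (λ μ → ×-congʳ (local-rule μ σ a b)) ⟩
  (Σ[ μ ∈ Partition ] (Chain α μ × Below μ σ a b))
    ↔⟨ mk↔ₛ′ (λ { (μ , t , j , a′ , b′ , e , τ , h , g) → j , a′ , b′ , e , τ , g , μ , h , t })
             (λ { (j , a′ , b′ , e , τ , g , μ , h , t) → μ , t , j , a′ , b′ , e , τ , h , g })
             (λ _ → refl) (λ _ → refl) ⟩
  (Σ[ j ∈ ℕ ] Σ[ a′ ∈ ℕ ] Σ[ b′ ∈ ℕ ] (Irrelevant (j + a′ ≡ a × j + b′ ≡ b) ×
    Σ[ τ ∈ Partition ] (HS a′ σ τ × Σ[ μ ∈ Partition ] (HS b′ μ τ × Chain α μ))))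
    ↔⟨ Σ-cong (λ j → Σ-cong λ a′ → Σ-cong λ b′ → ×-congʳ (Σ-cong λ τ → ×-congʳ (pieri b′ α τ))) ⟩
  (Σ[ j ∈ ℕ ] Σ[ a′ ∈ ℕ ] Σ[ b′ ∈ ℕ ] (Irrelevant (j + a′ ≡ a × j + b′ ≡ b) ×
    Σ[ τ ∈ Partition ] (HS a′ σ τ × Skewed b′ α τ)))
    ↔⟨ mk↔ₛ′
      -- The excess `j` of the local rule becomes the exponent of the current variable in the
      -- monomial of h_b; the rest of the outer strip, of size `b′`, passes to the remaining
      -- variables.
      (λ { (j , a′ , b′ , [ e ] , τ , g , γ , α′ , s , [ p ] , t) →
           j ∷ γ , a′ ∷ α′ , ⊞-cons (proj₁ e) s , [ trans (cong (j +_) (≡-rec p)) (proj₂ e) ] , τ , g , t })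
      (λ { (j ∷ γ , a′ ∷ α′ , s , [ p ] , τ , g , t) →
           j , a′ , vsum γ , [ ⊞-head s , p ] , τ , g , γ , α′ , ⊞-tail s , [ refl ] , t })
      (λ { (_ ∷ _ , _ ∷ _ , _) → refl })
      (λ { (j , a′ , b′ , [ e ] , τ , g , γ , α′ , s , [ p ] , t) → uniq (≡-rec p) }) ⟩
  Skewed b (a ∷ α) σ ↔∎
  where
  uniq : ∀ {j a′ b′ b″ τ γ α′} {e : Irrelevant (j + a′ ≡ a × j + b′ ≡ b)} {e″ : Irrelevant (j + a′ ≡ a × j + b″ ≡ b)}
         {g : HS a′ σ τ} {s : γ ⊞ α′ ≡ α} {p : Irrelevant (vsum γ ≡ b′)} {p″ : Irrelevant (vsum γ ≡ b″)} {t : Chain α′ τ} →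
         b′ ≡ b″ →
         ((Σ[ j ∈ ℕ ] Σ[ a′ ∈ ℕ ] Σ[ b′ ∈ ℕ ] (Irrelevant (j + a′ ≡ a × j + b′ ≡ b) ×
           Σ[ τ ∈ Partition ] (HS a′ σ τ × Skewed b′ α τ))) ∋
         (j , a′ , b′ , e , τ , g , γ , α′ , s , p , t)) ≡ (j , a′ , b″ , e″ , τ , g , γ , α′ , s , p″ , t)
  uniq refl = refl

-- Oscillating tableaux and Littlewood's identity

PairedFun : (ℕ → ℕ) → Set
PairedFun f = ∀ i → f (i * 2) ≡ f (suc (i * 2))

-- β′ is even exactly when the rows of β come in equal pairs.
record Paired (β : Partition) : Set where
  constructor mkPaired
  field .pairs : PairedFun (part β)

openPaired : ∀ {β} → Paired β → PairedFun (part β)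
openPaired (mkPaired p) = Π-recompute _ (λ i → ≡-rec) p

-- On the parts of μ these are μ₀, μ₀, μ₂, μ₂, ... and μ₁, μ₁, μ₃, μ₃, ...: the unique shapes with
-- even columns that lie a horizontal strip outside and inside μ.
evens odds : (ℕ → ℕ) → ℕ → ℕ
evens f zero          = f 0
evens f (suc zero)    = f 0
evens f (suc (suc i)) = evens (f ∘ suc ∘ suc) i
odds  f zero          = f 1
odds  f (suc zero)    = f 1
odds  f (suc (suc i)) = odds (f ∘ suc ∘ suc) i

evens-paired : ∀ f → PairedFun (evens f)
evens-paired f zero    = refl
evens-paired f (suc i) = evens-paired (f ∘ suc ∘ suc) i

odds-paired : ∀ f → PairedFun (odds f)
odds-paired f zero    = refl
odds-paired f (suc i) = odds-paired (f ∘ suc ∘ suc) i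

evens-above : ∀ {f} → Decreasing f → ∀ i → f i ≤ evens f i
evens-above d zero          = ≤-refl
evens-above d (suc zero)    = d 0
evens-above d (suc (suc i)) = evens-above (d ∘ suc ∘ suc) i

evens-below : ∀ {f} → Decreasing f → ∀ i → evens f (suc i) ≤ f i
evens-below d zero          = ≤-refl
evens-below d (suc zero)    = d 1
evens-below d (suc (suc i)) = evens-below (d ∘ suc ∘ suc) i

odds-below : ∀ {f} → Decreasing f → ∀ i → odds f i ≤ f i
odds-below d zero          = d 0
odds-below d (suc zero)    = ≤-refl
odds-below d (suc (suc i)) = odds-below (d ∘ suc ∘ suc) i

odds-above : ∀ {f} → Decreasing f → ∀ i → f (suc i) ≤ odds f i
odds-above d zero          = ≤-refl
odds-above d (suc zero)    = d 1
odds-above d (suc (suc i)) = odds-above (d ∘ suc ∘ suc) i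

sum-evens-odds : ∀ n f → sumTo (n * 2) (evens f) + sumTo (n * 2) (odds f) ≡ sumTo (n * 2) f + sumTo (n * 2) f
sum-evens-odds zero    f = refl
sum-evens-odds (suc n) f = trans (lem (f 0) (f 1) _ _)
  (trans (cong (f 0 + f 0 + (f 1 + f 1) +_) (sum-evens-odds n (f ∘ suc ∘ suc))) (sym (lem′ (f 0) (f 1) _)))
  where
  lem : ∀ a b x y → (a + (a + x)) + (b + (b + y)) ≡ a + a + (b + b) + (x + y)
  lem = solve-∀
  lem′ : ∀ a b x → (a + (b + x)) + (a + (b + x)) ≡ a + a + (b + b) + (x + x)
  lem′ = solve-∀

-- The two members of a pair of `g` are equal and are squeezed from both sides: f₀ ≤ g₀ = g₁ ≤ f₀,
-- and likewise two rows further on.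
evens-unique : ∀ {f g} → PairedFun g → (∀ i → f i ≤ g i) → (∀ i → g (suc i) ≤ f i) → ∀ i → evens f i ≡ g i
evens-unique p l u zero          = ≤-antisym (l 0) (≤-trans (≤-reflexive (p 0)) (u 0))
evens-unique p l u (suc zero)    = ≤-antisym (≤-trans (l 0) (≤-reflexive (p 0))) (u 0)
evens-unique p l u (suc (suc i)) = evens-unique (p ∘ suc) (l ∘ suc ∘ suc) (u ∘ suc ∘ suc) i

odds-unique : ∀ {f g} → PairedFun g → (∀ i → g i ≤ f i) → (∀ i → f (suc i) ≤ g i) → ∀ i → odds f i ≡ g i
odds-unique p u l zero          = ≤-antisym (l 0) (≤-trans (≤-reflexive (p 0)) (u 1))
odds-unique p u l (suc zero)    = ≤-antisym (≤-trans (l 0) (≤-reflexive (p 0))) (u 1)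
odds-unique p u l (suc (suc i)) = odds-unique (p ∘ suc) (u ∘ suc ∘ suc) (l ∘ suc ∘ suc) i

size-evens-odds : ∀ μ β γ → (∀ i → part β i ≡ evens (part μ) i) → (∀ i → part γ i ≡ odds (part μ) i) →
                  size β + size γ ≡ size μ + size μ
size-evens-odds μ β γ e o = begin
  size β + size γ
    ≡⟨ cong₂ _+_ (size-sumTo β hβ) (size-sumTo γ hγ) ⟩
  sumTo (N * 2) (part β) + sumTo (N * 2) (part γ)
    ≡⟨ cong₂ _+_ (sumTo-cong (N * 2) (λ i _ → e i)) (sumTo-cong (N * 2) (λ i _ → o i)) ⟩
  sumTo (N * 2) (evens (part μ)) + sumTo (N * 2) (odds (part μ))
    ≡⟨ sum-evens-odds N (part μ) ⟩
  sumTo (N * 2) (part μ) + sumTo (N * 2) (part μ)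
    ≡⟨ sym (cong₂ _+_ (size-sumTo μ hμ) (size-sumTo μ hμ)) ⟩
  size μ + size μ ∎
  where
  open ≡-Reasoning
  N = height μ + height β + height γ
  N≤ : N ≤ N * 2
  N≤ = m≤m*n N 2
  hμ : height μ ≤ N * 2
  hμ = ≤-trans (≤-trans (m≤m+n _ _) (m≤m+n (height μ + height β) _)) N≤
  hβ : height β ≤ N * 2
  hβ = ≤-trans (≤-trans (m≤n+m (height β) (height μ)) (m≤m+n _ _)) N≤
  hγ : height γ ≤ N * 2
  hγ = ≤-trans (m≤n+m _ _) N≤

balanced-strip : ∀ {x y z b} → x + z ≡ y + y → x ≡ b + y → y ≡ b + z
balanced-strip {x} {y} {z} {b} e refl = sym (+-cancelʳ-≡ y (b + z) y (trans (lem b z y) e))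
  where
  lem : ∀ b z y → b + z + y ≡ b + y + z
  lem = solve-∀

balanced-strip′ : ∀ {x y z b} → x + z ≡ y + y → y ≡ b + z → x ≡ b + y
balanced-strip′ {x} {y} {z} {b} e refl = +-cancelʳ-≡ z _ _ (trans e (lem b z))
  where
  lem : ∀ b z → b + z + (b + z) ≡ b + (b + z) + z
  lem = solve-∀

-- With E the formal sum of all β with β′ even, this says h_b^⊥ E = h_b E:
-- both strips are forced by μ, and |β| + |γ| = 2|μ|.
even-exchange : ∀ b μ → (Σ[ β ∈ Partition ] (Paired β × HS b β μ)) ↔ (Σ[ γ ∈ Partition ] (Paired γ × HS b μ γ))
even-exchange b μ = mk↔ₛ′ to from (λ { (γ , p , h) → uniq₂ (γ≡ γ p h) }) (λ { (β , p , h) → uniq₁ (β≡ β p h) })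
  where
  d : Decreasing (part μ)
  d = part-mono μ
  e-end : evens (part μ) (suc (height μ)) ≡ 0
  e-end = n≤0⇒n≡0 (≤-trans (evens-below d (height μ)) (≤-reflexive (part-beyond μ ≤-refl)))
  o-end : odds (part μ) (height μ) ≡ 0
  o-end = n≤0⇒n≡0 (≤-trans (odds-below d (height μ)) (≤-reflexive (part-beyond μ ≤-refl)))
  e-dec : Decreasing (evens (part μ))
  e-dec i = ≤-trans (evens-below d i) (evens-above d i)
  o-dec : Decreasing (odds (part μ))
  o-dec i = ≤-trans (odds-below d (suc i)) (odds-above d i)
  β₀ γ₀ : Partition
  β₀ = fromFun (evens (part μ)) (suc (height μ)) e-dec e-end
  γ₀ = fromFun (odds (part μ)) (height μ) o-dec o-end
  β₀-part : ∀ i → part β₀ i ≡ evens (part μ) i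
  β₀-part = part-fromFun (evens (part μ)) (suc (height μ)) e-dec e-end
  γ₀-part : ∀ i → part γ₀ i ≡ odds (part μ) i
  γ₀-part = part-fromFun (odds (part μ)) (height μ) o-dec o-end
  β≡ : ∀ β → Paired β → HS b β μ → β₀ ≡ β
  β≡ β p h = part-ext λ i → trans (β₀-part i)
    (evens-unique (openPaired p) (λ i → proj₁ (proj₁ (openHS h) i)) (λ i → proj₂ (proj₁ (openHS h) i)) i)
  γ≡ : ∀ γ → Paired γ → HS b μ γ → γ₀ ≡ γ
  γ≡ γ p h = part-ext λ i → trans (γ₀-part i)
    (odds-unique (openPaired p) (λ i → proj₁ (proj₁ (openHS h) i)) (λ i → proj₂ (proj₁ (openHS h) i)) i)
  balance : size β₀ + size γ₀ ≡ size μ + size μ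
  balance = size-evens-odds μ β₀ γ₀ β₀-part γ₀-part
  to : Σ[ β ∈ Partition ] (Paired β × HS b β μ) → Σ[ γ ∈ Partition ] (Paired γ × HS b μ γ)
  to (β , p , h) = γ₀ , mkPaired (λ i → trans (γ₀-part (i * 2)) (trans (odds-paired (part μ) i) (sym (γ₀-part (suc (i * 2)))))) ,
    mkHS ((λ i → ≤-trans (≤-reflexive (γ₀-part i)) (odds-below d i) , ≤-trans (odds-above d i) (≤-reflexive (sym (γ₀-part i)))) ,
          balanced-strip balance (trans (cong size (β≡ β p h)) (proj₂ (openHS h))))
  from : Σ[ γ ∈ Partition ] (Paired γ × HS b μ γ) → Σ[ β ∈ Partition ] (Paired β × HS b β μ)
  from (γ , p , h) = β₀ , mkPaired (λ i → trans (β₀-part (i * 2)) (trans (evens-paired (part μ) i) (sym (β₀-part (suc (i * 2)))))) ,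
    mkHS ((λ i → ≤-trans (evens-above d i) (≤-reflexive (sym (β₀-part i))) , ≤-trans (≤-reflexive (β₀-part (suc i))) (evens-below d i)) ,
          balanced-strip′ balance (trans (proj₂ (openHS h)) (cong (λ ν → b + size ν) (sym (γ≡ γ p h)))))
  uniq₁ : ∀ {β β′ p p′ h h′} → β ≡ β′ → (Σ[ β ∈ Partition ] (Paired β × HS b β μ) ∋ (β , p , h)) ≡ (β′ , p′ , h′)
  uniq₁ refl = refl
  uniq₂ : ∀ {β β′ p p′ h h′} → β ≡ β′ → (Σ[ β ∈ Partition ] (Paired β × HS b μ β) ∋ (β , p , h)) ≡ (β′ , p′ , h′)
  uniq₂ refl = refl

-- SSOTs starting at p and ending at ν, contents again listed from the last variable.
OscillatingFrom : Partition → ∀ {k} → Vec ℕ k → Partition → Set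
OscillatingFrom p []      ν = Irrelevant (ν ≡ p)
OscillatingFrom p (a ∷ α) ν = Σ[ σ ∈ Partition ] Σ[ μ ∈ Partition ] Σ[ b ∈ ℕ ] Σ[ c ∈ ℕ ]
  (Irrelevant (b + c ≡ a) × HS b μ σ × HS c ν σ × OscillatingFrom p α μ)

Oscillating : ∀ {k} → Vec ℕ k → Partition → Set
Oscillating = OscillatingFrom ∅ₚ

-- The coefficient of x^α in E s_ν, where E is the sum of all s_β with β′ even.
PairedProduct : ∀ {k} → Vec ℕ k → Partition → Set
PairedProduct {k} α ν = Σ[ β ∈ Partition ] (Paired β × Σ[ α₁ ∈ Vec ℕ k ] Σ[ α₂ ∈ Vec ℕ k ]
  (α₁ ⊞ α₂ ≡ α × Chain α₁ β × Chain α₂ ν))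

-- The last variable removes a strip μ/σ of size `b` and adds a strip ν/σ of size `c`. By induction
-- μ carries E s_μ in the other variables, and the Pieri rule sums s_μ over the removed strips to
-- h_b s_σ. The factor h_b is moved from s_σ to E, where the Pieri rule, read backwards, makes it an
-- outer strip on an even-column shape. After `even-exchange` it is the outermost strip of a tableau
-- of even-column shape, so the last variable has exponent `b` there and exponent `c` in the tableau
-- of shape ν.
oscillating-product : ∀ {k} (α : Vec ℕ k) ν → Oscillating α ν ↔ PairedProduct α ν
oscillating-product [] ν = mk↔ₛ′
  (λ e → ∅ₚ , mkPaired (λ _ → refl) , [] , [] , ⊞-eq refl , [ refl ] , e)
  (λ { (_ , _ , [] , [] , _ , _ , e) → e })
  (λ { (β , p , [] , [] , _ , [ z ] , e) → uniq (sym (≡ₚ-rec z)) })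
  (λ _ → refl)
  where
  uniq : ∀ {β β′ p p′ s z z′} {e : Irrelevant (ν ≡ ∅ₚ)} → β ≡ β′ →
         (PairedProduct [] ν ∋ (β , p , [] , [] , s , z , e)) ≡ (β′ , p′ , [] , [] , s , z′ , e)
  uniq refl = refl
oscillating-product {suc k} (a ∷ α) ν =
  Oscillating (a ∷ α) ν
    ↔⟨ Σ-cong (λ σ → Σ-cong λ μ → Σ-cong λ b → Σ-cong λ c → ×-congʳ (×-congʳ (×-congʳ (oscillating-product α μ)))) ⟩
  (Σ[ σ ∈ Partition ] Σ[ μ ∈ Partition ] Σ[ b ∈ ℕ ] Σ[ c ∈ ℕ ]
    (Irrelevant (b + c ≡ a) × HS b μ σ × HS c ν σ × PairedProduct α μ))
    ↔⟨ mk↔ₛ′ (λ { (σ , μ , b , c , e , h , g , β , p , α₁ , α₂ , s , t , u) → σ , b , c , e , g , β , p , α₁ , t , α₂ , s , μ , h , u })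
             (λ { (σ , b , c , e , g , β , p , α₁ , t , α₂ , s , μ , h , u) → σ , μ , b , c , e , h , g , β , p , α₁ , α₂ , s , t , u })
             (λ _ → refl) (λ _ → refl) ⟩
  Outer (λ σ b β → Σ[ α₁ ∈ Vec ℕ k ] (Chain α₁ β × Σ[ α₂ ∈ Vec ℕ k ] (α₁ ⊞ α₂ ≡ α × Σ[ μ ∈ Partition ] (HS b μ σ × Chain α₂ μ))))
    ↔⟨ outer-cong (λ σ b β → Σ-cong λ α₁ → ×-congʳ (Σ-cong λ α₂ → ×-congʳ (pieri b α₂ σ))) ⟩
  Outer (λ σ b β → Σ[ α₁ ∈ Vec ℕ k ] (Chain α₁ β × Σ[ α₂ ∈ Vec ℕ k ] (α₁ ⊞ α₂ ≡ α × Skewed b α₂ σ)))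
    -- Here h_b changes its partner, from s_σ to the Schur function with even columns.
    ↔⟨ outer-cong reassociate ⟩
  Outer (λ σ b γ → Σ[ α₂ ∈ Vec ℕ k ] (Chain α₂ σ × Σ[ α₁ ∈ Vec ℕ k ] (α₁ ⊞ α₂ ≡ α × Skewed b α₁ γ)))
    ↔˘⟨ outer-cong (λ σ b β → Σ-cong λ α₁ → ×-congʳ (Σ-cong λ α₂ → ×-congʳ (pieri b α₂ β))) ⟩
  Outer (λ σ b γ → Σ[ α₂ ∈ Vec ℕ k ] (Chain α₂ σ × Σ[ α₁ ∈ Vec ℕ k ] (α₁ ⊞ α₂ ≡ α × Σ[ μ ∈ Partition ] (HS b μ γ × Chain α₁ μ))))
    ↔⟨ mk↔ₛ′ (λ { (σ , b , c , e , g , γ , p , α₂ , t , α₁ , s , μ , h , u) → σ , b , c , e , g , α₂ , t , α₁ , s , μ , u , γ , p , h })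
             (λ { (σ , b , c , e , g , α₂ , t , α₁ , s , μ , u , γ , p , h) → σ , b , c , e , g , γ , p , α₂ , t , α₁ , s , μ , h , u })
             (λ _ → refl) (λ _ → refl) ⟩
  Inner (λ b μ → Σ[ γ ∈ Partition ] (Paired γ × HS b μ γ))
    ↔˘⟨ Σ-cong (λ σ → Σ-cong λ b → Σ-cong λ c → ×-congʳ (×-congʳ (Σ-cong λ α₂ → ×-congʳ (Σ-cong λ α₁ → ×-congʳ
          (Σ-cong λ μ → ×-congʳ (even-exchange b μ)))))) ⟩
  Inner (λ b μ → Σ[ β ∈ Partition ] (Paired β × HS b β μ))
    ↔⟨ mk↔ₛ′ (λ { (σ , b , c , [ e ] , g , α₂ , t , α₁ , s , μ , u , β , p , h) → β , p , b ∷ α₁ , c ∷ α₂ , ⊞-cons e s , (μ , h , u) , (σ , g , t) })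
             (λ { (β , p , b ∷ α₁ , c ∷ α₂ , s , (μ , h , u) , (σ , g , t)) → σ , b , c , [ ⊞-head s ] , g , α₂ , t , α₁ , ⊞-tail s , μ , u , β , p , h })
             (λ { (_ , _ , _ ∷ _ , _ ∷ _ , _) → refl }) (λ _ → refl) ⟩
  PairedProduct (a ∷ α) ν ↔∎
  where
  Outer : (Partition → ℕ → Partition → Set) → Set
  Outer F = Σ[ σ ∈ Partition ] Σ[ b ∈ ℕ ] Σ[ c ∈ ℕ ] (Irrelevant (b + c ≡ a) × HS c ν σ ×
    Σ[ β ∈ Partition ] (Paired β × F σ b β))
  outer-cong : ∀ {F G} → (∀ σ b β → F σ b β ↔ G σ b β) → Outer F ↔ Outer G
  outer-cong h = Σ-cong λ σ → Σ-cong λ b → Σ-cong λ c → ×-congʳ (×-congʳ (Σ-cong λ β → ×-congʳ (h σ b β)))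
  Inner : (ℕ → Partition → Set) → Set
  Inner F = Σ[ σ ∈ Partition ] Σ[ b ∈ ℕ ] Σ[ c ∈ ℕ ] (Irrelevant (b + c ≡ a) × HS c ν σ ×
    Σ[ α₂ ∈ Vec ℕ k ] (Chain α₂ σ × Σ[ α₁ ∈ Vec ℕ k ] (α₁ ⊞ α₂ ≡ α × Σ[ μ ∈ Partition ] (Chain α₁ μ × F b μ))))
  reassociate : ∀ σ b β →
    (Σ[ α₁ ∈ Vec ℕ k ] (Chain α₁ β × Σ[ α₂ ∈ Vec ℕ k ] (α₁ ⊞ α₂ ≡ α × Skewed b α₂ σ))) ↔
    (Σ[ α₂ ∈ Vec ℕ k ] (Chain α₂ σ × Σ[ α₁ ∈ Vec ℕ k ] (α₁ ⊞ α₂ ≡ α × Skewed b α₁ β)))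
  reassociate σ b β =
    _ ↔⟨ mk↔ₛ′ (λ { (x , t , w , s , γ , y , r , p , u) → x , y , γ , (t , u , p) , w , s , r })
               (λ { (x , y , γ , (t , u , p) , w , s , r) → x , t , w , s , γ , y , r , p , u })
               (λ _ → refl) (λ _ → refl) ⟩
    (Σ[ x ∈ Vec ℕ k ] Σ[ y ∈ Vec ℕ k ] Σ[ γ ∈ Vec ℕ k ] ((Chain x β × Chain y σ × Irrelevant (vsum γ ≡ b)) ×
      Σ[ w ∈ Vec ℕ k ] (x ⊞ w ≡ α × γ ⊞ y ≡ w)))
      ↔⟨ Σ-cong (λ x → Σ-cong λ y → Σ-cong λ γ → ×-congʳ (⊞-swap x γ y α)) ⟩
    (Σ[ x ∈ Vec ℕ k ] Σ[ y ∈ Vec ℕ k ] Σ[ γ ∈ Vec ℕ k ] ((Chain x β × Chain y σ × Irrelevant (vsum γ ≡ b)) ×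
      Σ[ w ∈ Vec ℕ k ] (w ⊞ y ≡ α × γ ⊞ x ≡ w)))
      ↔⟨ mk↔ₛ′ (λ { (x , y , γ , (t , u , p) , w , s , r) → y , u , w , s , γ , x , r , p , t })
               (λ { (y , u , w , s , γ , x , r , p , t) → x , y , γ , (t , u , p) , w , s , r })
               (λ _ → refl) (λ _ → refl) ⟩
    _ ↔∎

-- Finite types

Finite : Set → Set
Finite A = Σ[ n ∈ ℕ ] (A ↔ Fin n)

finite-↔ : {A B : Set} → A ↔ B → Finite A → Finite B
finite-↔ f (n , g) = n , ↔-trans (↔-sym f) g

finite-⊤ : Finite ⊤
finite-⊤ = 1 , ↔-sym 1↔⊤

finite-prop : {A : Set} → (∀ (x y : A) → x ≡ y) → Dec A → Finite A
finite-prop u (yes a) = 1 , ↔-trans (mk↔ₛ′ (λ _ → tt) (λ _ → a) (λ _ → refl) (u a)) (↔-sym 1↔⊤)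
finite-prop u (no ¬a) = 0 , ↔-trans (mk↔ₛ′ ¬a (λ ()) (λ ()) (λ a → contradiction a ¬a)) (↔-sym 0↔⊥)

finite-Fin : ∀ n → Finite (Fin n)
finite-Fin n = n , ↔-refl

finite-⊎ : {A B : Set} → Finite A → Finite B → Finite (A ⊎ B)
finite-⊎ (m , f) (n , g) = m + n , ↔-trans (f ⊎-↔ g) (↔-sym +↔⊎)

finite-× : {A B : Set} → Finite A → Finite B → Finite (A × B)
finite-× (m , f) (n , g) = m * n , ↔-trans (f ×-↔ g) (↔-sym *↔×)

Σ-reindex : {A B : Set} (e : A ↔ B) (F : A → Set) → Σ A F ↔ Σ B (F ∘ Inverse.from e)
Σ-reindex {A} {B} e F = mk↔ₛ′
  (λ { (a , x) → to a , subst F (sym (strictlyInverseʳ a)) x })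
  (λ { (b , x) → from b , x })
  (λ { (b , x) → lem₁ (from b) x (to (from b)) (strictlyInverseʳ (from b)) b (strictlyInverseˡ b) refl })
  (λ { (a , x) → lem₂ x (strictlyInverseʳ a) })
  where
  open Inverse e
  lem₂ : ∀ {a a′} (x : F a) (q : a′ ≡ a) → (a′ , subst F (sym q) x) ≡ (a , x)
  lem₂ x refl = refl
  -- The two inverse laws come without a triangle identity. Matching both `q` and `r` with `refl`
  -- replaces it by uniqueness of identity proofs.
  lem₁ : ∀ a (x : F a) b′ (q : from b′ ≡ a) b → b′ ≡ b → (r : from b ≡ a) →
         (Σ B (F ∘ from) ∋ (b′ , subst F (sym q) x)) ≡ (b , subst F (sym r) x)
  lem₁ a x b′ refl .b′ refl refl = refl

finite-ΣFin : ∀ n (F : Fin n → Set) → (∀ i → Finite (F i)) → Finite (Σ (Fin n) F)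
finite-ΣFin zero    F h = finite-↔ (mk↔ₛ′ (λ ()) (λ { (() , _) }) (λ { (() , _) }) (λ ())) (finite-Fin 0)
finite-ΣFin (suc n) F h = finite-↔
  (mk↔ₛ′ (λ { (inj₁ x) → Fin.zero , x ; (inj₂ (i , x)) → Fin.suc i , x })
         (λ { (Fin.zero , x) → inj₁ x ; (Fin.suc i , x) → inj₂ (i , x) })
         (λ { (Fin.zero , x) → refl ; (Fin.suc i , x) → refl })
         (λ { (inj₁ x) → refl ; (inj₂ (i , x)) → refl }))
  (finite-⊎ (h Fin.zero) (finite-ΣFin n (F ∘ Fin.suc) (h ∘ Fin.suc)))

finite-Σ : {A : Set} {F : A → Set} → Finite A → (∀ a → Finite (F a)) → Finite (Σ A F)
finite-Σ {F = F} (n , e) h = finite-↔ (↔-sym (Σ-reindex e F)) (finite-ΣFin n _ (λ i → h (Inverse.from e i)))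

finite-card : {A B : Set} (f : Finite A) (g : Finite B) → A ↔ B → proj₁ f ≡ proj₁ g
finite-card (m , f) (n , g) e = ↔⇒≡ (↔-trans (↔-sym f) (↔-trans e g))

same-card : {A B : Set} (f : Finite A) (g : Finite B) → proj₁ f ≡ proj₁ g → A ↔ B
same-card (m , f) (.m , g) refl = ↔-trans f (↔-sym g)

-- Subtraction of bijections: pass to cardinalities, cancel in ℕ, and return along the enumerations.
-- The resulting bijection is not canonical and does not depend on how `g` mixes the summands.
⊎-cancel : {A B C D : Set} → Finite A → Finite B → Finite C → Finite D →
           A ↔ C → (A ⊎ B) ↔ (C ⊎ D) → B ↔ D
⊎-cancel fA fB fC fD e g = same-card fB fD (+-cancelˡ-≡ (proj₁ fA) _ _
  (trans (finite-card (finite-⊎ fA fB) (finite-⊎ fC fD) g) (cong (_+ proj₁ fD) (sym (finite-card fA fC e)))))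

×-cancel : {A B T : Set} → Finite A → Finite B → Finite T → T → (A × T) ↔ (B × T) → A ↔ B
×-cancel fA fB (zero  , h) t g = contradiction (Inverse.to h t) (λ ())
×-cancel fA fB fT@(suc n , h) t g = same-card fA fB (*-cancelʳ-≡ (proj₁ fA) (proj₁ fB) (suc n)
  (finite-card (finite-× fA fT) (finite-× fB fT) g))

-- Enumeration of partitions, strips and chains

Below< : ℕ → Set
Below< m = Σ[ a ∈ ℕ ] Irrelevant (a < m)

finite-Below< : ∀ m → Finite (Below< m)
finite-Below< m = m , mk↔ₛ′ (λ { (a , [ p ]) → Fin.fromℕ< p }) (λ i → toℕ i , [ toℕ<n i ])
  (λ i → fromℕ<-toℕ i (toℕ<n i)) (λ { (a , [ p ]) → uniq (toℕ-fromℕ< (recompute (_ <? _) p)) })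
  where
  uniq : ∀ {a b} {p : Irrelevant (a < m)} {q : Irrelevant (b < m)} → a ≡ b → (Below< m ∋ (a , p)) ≡ (b , q)
  uniq refl = refl

Boxed : ℕ → ℕ → Set
Boxed N m = Σ[ l ∈ List ℕ ] Irrelevant (IsPartition l × nth l 0 ≤ m × length l ≤ N)

-- Recursion on the number of rows: a nonempty partition is its first part `suc a`, at most `m`,
-- followed by a partition with one row fewer in a box of width `suc a`.
finite-Boxed : ∀ N m → Finite (Boxed N m)
finite-Boxed zero m = finite-↔ (mk↔ₛ′ (λ _ → [] , [ tt , z≤n , z≤n ]) (λ _ → tt)
  (λ { ([] , _) → refl ; (_ ∷ _ , [ p ]) → ⊥-elim′ (proj₂ (proj₂ p)) }) (λ _ → refl)) finite-⊤
  where
  ⊥-elim′ : ∀ {A : Set} {n} → .(suc n ≤ 0) → A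
  ⊥-elim′ ()
finite-Boxed (suc N) m = finite-↔ (mk↔ₛ′ to from to-from from-to)
  (finite-⊎ finite-⊤ (finite-Σ (finite-Below< m) (λ a → finite-Boxed N (suc (proj₁ a)))))
  where
  to : ⊤ ⊎ Σ (Below< m) (λ a → Boxed N (suc (proj₁ a))) → Boxed (suc N) m
  to (inj₁ _) = [] , [ tt , z≤n , z≤n ]
  to (inj₂ ((a , [ p ]) , l , [ q ])) = suc a ∷ l , [ cons-wf l (s≤s z≤n) (proj₁ (proj₂ q)) (proj₁ q) , p , s≤s (proj₂ (proj₂ q)) ]
  head≢0 : ∀ {A : Set} l → .(IsPartition (0 ∷ l)) → A
  head≢0 l w = ⊥-elim (<⇒≢ (≤-rec (head-pos 0 l w)) refl)
  from : Boxed (suc N) m → ⊤ ⊎ Σ (Below< m) (λ a → Boxed N (suc (proj₁ a)))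
  from ([]        , _)     = inj₁ tt
  from (zero ∷ l  , [ q ]) = head≢0 l (proj₁ q)
  from (suc a ∷ l , [ q ]) = inj₂ ((a , [ proj₁ (proj₂ q) ]) , l , [ tail-wf l (proj₁ q) , nth-mono (suc a ∷ l) (proj₁ q) 0 , s≤s⁻¹ (proj₂ (proj₂ q)) ])
  to-from : ∀ x → to (from x) ≡ x
  to-from ([]        , _)     = refl
  to-from (zero ∷ l  , [ q ]) = head≢0 l (proj₁ q)
  to-from (suc a ∷ l , [ q ]) = refl
  from-to : ∀ x → from (to x) ≡ x
  from-to (inj₁ _) = refl
  from-to (inj₂ _) = refl

Sized : ℕ → Set
Sized n = Σ[ μ ∈ Partition ] Irrelevant (size μ ≡ n)

finite-Sized : ∀ n → Finite (Sized n)
finite-Sized n = finite-↔ (mk↔ₛ′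
  (λ { ((l , [ w ]) , [ e ]) → mkPartition l (proj₁ w) , [ e ] })
  (λ { (mkPartition l w , [ e ]) → (l , [ w , bound₀ l e , ≤-trans (height≤size (mkPartition l w)) (≤-reflexive e) ]) , [ e ] })
  (λ _ → refl) (λ _ → refl))
  -- A partition of `n` has at most `n` rows and first part at most `n`, so the square box contains
  -- it.
  (finite-Σ (finite-Boxed n n) (λ x → finite-prop (λ _ _ → refl) (map′ (λ p → [ p ]) (unsquash ≡-rec) (sum (proj₁ x) ≟ n))))
  where
  bound₀ : ∀ l → sum l ≡ n → nth l 0 ≤ n
  bound₀ []      e = z≤n
  bound₀ (a ∷ l) e = ≤-trans (m≤m+n a _) (≤-reflexive e)

finite-Σ-sized : ∀ n {F : Partition → Set} → (∀ μ → F μ → size μ ≡ n) → (∀ μ → Finite (F μ)) → Finite (Σ Partition F)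
finite-Σ-sized n {F} s h = finite-↔
  (mk↔ₛ′ (λ { ((μ , _) , x) → μ , x }) (λ { (μ , x) → (μ , [ s μ x ]) , x }) (λ _ → refl) (λ _ → refl))
  (finite-Σ (finite-Sized n) (λ x → h (proj₁ x)))

eventually-dec : {P : ℕ → Set} → (∀ i → Dec (P i)) → ∀ N → (∀ i → N ≤ i → P i) → Dec (∀ i → P i)
eventually-dec {P} P? N h = map′ (λ (f : ∀ {j} → j < N → P j) i → case i f) (λ f {i} _ → f i) (allUpTo? P? N)
  where
  case : ∀ i → (∀ {j} → j < N → P j) → P i
  case i f with i <? N
  ... | yes p = f p
  ... | no ¬p = h i (≮⇒≥ ¬p)

HS? : ∀ a ν μ → Dec (HS a ν μ)
HS? a ν μ = map′ (λ c → mkHS c) openHS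
  (eventually-dec (λ i → (_ ≤? _) ×-dec (_ ≤? _)) (height μ ⊔ height ν) end ×-dec (size ν ≟ a + size μ))
  where
  end : ∀ i → height μ ⊔ height ν ≤ i → part μ i ≤ part ν i × part ν (suc i) ≤ part μ i
  end i p = ≤-trans (≤-reflexive (part-beyond μ (≤-trans (m≤m⊔n _ _) p))) z≤n ,
            ≤-trans (≤-reflexive (part-beyond ν (m≤n⇒m≤1+n (≤-trans (m≤n⊔m (height μ) _) p)))) z≤n

finite-HS : ∀ a ν μ → Finite (HS a ν μ)
finite-HS a ν μ = finite-prop (λ _ _ → refl) (HS? a ν μ)

HS-size-below : ∀ {a ν μ} → HS a ν μ → size μ ≡ size ν ∸ a
HS-size-below {a} {ν} {μ} h = sym (trans (cong (_∸ a) (proj₂ (openHS h))) (m+n∸m≡n a (size μ)))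

finite-Chain : ∀ {k} (α : Vec ℕ k) ν → Finite (Chain α ν)
finite-Chain []      ν = finite-prop (λ _ _ → refl) (map′ (λ p → [ p ]) (unsquash ≡ₚ-rec) (ν ≟ₚ ∅ₚ))
finite-Chain (a ∷ α) ν = finite-Σ-sized (size ν ∸ a) (λ μ x → HS-size-below (proj₁ x))
  (λ μ → finite-× (finite-HS a ν μ) (finite-Chain α μ))

-- Unitriangularity of the Kostka matrix, and uniqueness of Schur expansions

-- The exponents of x^ν in the first `r` variables, last variable first, as `Chain` expects them.
content : Partition → ∀ r → Vec ℕ r
content ν zero    = []
content ν (suc r) = part ν r ∷ content ν r

vsum-content : ∀ ν r → vsum (content ν r) ≡ sumTo r (part ν)
vsum-content ν zero    = refl
vsum-content ν (suc r) = trans (cong (part ν r +_) (vsum-content ν r))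
  (trans (+-comm (part ν r) _) (sym (sumTo-snoc r (part ν))))

take-wf : ∀ r l → IsPartition l → IsPartition (take r l)
take-wf zero    l       w = tt
take-wf (suc r) []      w = tt
take-wf (suc r) (a ∷ l) w = cons-wf (take r l) (head-pos a l w) (go r l (nth-mono (a ∷ l) w 0)) (take-wf r l (tail-wf l w))
  where
  go : ∀ r l → nth l 0 ≤ a → nth (take r l) 0 ≤ a
  go zero    l       p = z≤n
  go (suc r) []      p = z≤n
  go (suc r) (b ∷ l) p = p

firstRows : ℕ → Partition → Partition
firstRows r (mkPartition l w) = mkPartition (take r l) (take-wf r l w)

nth-take-mono : ∀ r l i → nth (take r l) i ≤ nth (take (suc r) l) i
nth-take-mono zero    l       i       = z≤n
nth-take-mono (suc r) []      i       = z≤n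
nth-take-mono (suc r) (a ∷ l) zero    = ≤-refl
nth-take-mono (suc r) (a ∷ l) (suc i) = nth-take-mono r l i

nth-take-shift : ∀ r l → IsPartition l → ∀ i → nth (take (suc r) l) (suc i) ≤ nth (take r l) i
nth-take-shift r       []          w i       = z≤n
nth-take-shift zero    (a ∷ l)     w i       = z≤n
nth-take-shift (suc r) (a ∷ [])    w i       = z≤n
nth-take-shift (suc r) (a ∷ b ∷ l) w zero    = proj₁ w
nth-take-shift (suc r) (a ∷ b ∷ l) w (suc i) = nth-take-shift r (b ∷ l) (proj₂ w) i

sum-take : ∀ r l → sum (take (suc r) l) ≡ nth l r + sum (take r l)
sum-take zero    []      = refl
sum-take zero    (a ∷ l) = refl
sum-take (suc r) []      = refl
sum-take (suc r) (a ∷ l) = trans (cong (a +_) (sum-take r l)) (lem a (nth l r) (sum (take r l)))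
  where
  lem : ∀ a b c → a + (b + c) ≡ b + (a + c)
  lem = solve-∀

-- The superstandard tableau, in which each row is filled with a single letter: every strip of the
-- chain is one full row.
row-chain : ∀ ν r → Chain (content ν r) (firstRows r ν)
row-chain ν                   zero    = [ refl ]
row-chain ν@(mkPartition l w) (suc r) = firstRows r ν ,
  mkHS ((λ i → nth-take-mono r l i , nth-take-shift r l w i) , sum-take r l) , row-chain ν r

superstandard : ∀ ν → Chain (content ν (size ν)) ν
superstandard ν = subst (Chain (content ν (size ν))) (parts-inj (take-all (size ν) (parts ν) (height≤size ν))) (row-chain ν (size ν))

chain-rows : ∀ {k} (α : Vec ℕ k) {μ} → Chain α μ → part μ k ≡ 0
chain-rows []      e           = cong (λ μ → part μ 0) (unsquash ≡ₚ-rec e)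
chain-rows (a ∷ α) (ρ , h , t) = n≤0⇒n≡0 (≤-trans (proj₂ (proj₁ (openHS h) _)) (≤-reflexive (chain-rows α t)))

-- The first j letters fill a shape with at most j rows and exactly ν₀ + ... + ν_{j-1} boxes, and
-- this shape lies inside μ. Hence the first j rows of μ contain at least that many boxes.
dominance : ∀ ν r {μ} → Chain (content ν r) μ → ∀ j → j ≤ r → sumTo j (part ν) ≤ sumTo j (part μ)
dominance ν zero    t           .zero z≤n = z≤n
dominance ν (suc r) {μ} t@(ρ , h , u) j p with m≤n⇒m<n∨m≡n p
... | inj₁ q    = ≤-trans (dominance ν r u j (s≤s⁻¹ q)) (sumTo-mono j (λ i _ → proj₁ (proj₁ (openHS h) i)))
... | inj₂ refl = ≤-reflexive (trans (sym (vsum-content ν (suc r))) (trans (sym (chain-size (content ν (suc r)) t))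
                    (size-sumTo μ (height-≤ μ (suc r) (chain-rows (content ν (suc r)) t)))))

-- A linear extension of the dominance order.
rank : ℕ → Partition → ℕ
rank n μ = sumTo (suc n) (λ j → sumTo j (part μ))

sumTo-prefix : ∀ j m (f : ℕ → ℕ) → sumTo j f ≤ sumTo (j + m) f
sumTo-prefix zero    m f = z≤n
sumTo-prefix (suc j) m f = +-monoʳ-≤ (f 0) (sumTo-prefix j m (f ∘ suc))

sumTo≤size : ∀ j μ → sumTo j (part μ) ≤ size μ
sumTo≤size j μ = ≤-trans (sumTo-prefix j (height μ) (part μ)) (≤-reflexive (sym (size-sumTo μ (m≤n+m _ j))))

-- Dominance bounds each prefix sum of ν by that of μ. If the ranks did not increase, rigidity would
-- make all prefix sums agree, and their differences are the parts.
rank-strict : ∀ ν {μ} → Chain (content ν (size ν)) μ → ¬ μ ≡ ν → rank (size ν) ν < rank (size ν) μ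
rank-strict ν {μ} t μ≢ν = ≰⇒> λ le → μ≢ν (sym (part-ext (agree le)))
  where
  n = size ν
  prefix : rank n μ ≤ rank n ν → ∀ j → j ≤ n → sumTo j (part ν) ≡ sumTo j (part μ)
  prefix le j p = sumTo-rigid (suc n) (λ i q → dominance ν n t i (s≤s⁻¹ q)) le j (s≤s p)
  agree : rank n μ ≤ rank n ν → ∀ i → part ν i ≡ part μ i
  agree le i with i <? n
  ... | yes p = +-cancelˡ-≡ (sumTo i (part ν)) _ _ (begin
      sumTo i (part ν) + part ν i ≡⟨ sym (sumTo-snoc i (part ν)) ⟩
      sumTo (suc i) (part ν)      ≡⟨ prefix le (suc i) p ⟩
      sumTo (suc i) (part μ)      ≡⟨ sumTo-snoc i (part μ) ⟩
      sumTo i (part μ) + part μ i ≡⟨ cong (_+ part μ i) (sym (prefix le i (<⇒≤ p))) ⟩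
      sumTo i (part ν) + part μ i ∎)
    where open ≡-Reasoning
  -- A chain in `n` variables has at most `n` rows, so below that row both partitions are empty.
  ... | no ¬p = trans (part-beyond ν (≤-trans (height≤size ν) (≮⇒≥ ¬p)))
                      (sym (part-beyond μ (≤-trans (height-≤ μ n (chain-rows (content ν n) t)) (≮⇒≥ ¬p))))

chain-sized : ∀ ν {μ} → Chain (content ν (size ν)) μ → size μ ≡ size ν
chain-sized ν t = trans (chain-size (content ν (size ν)) t) (trans (vsum-content ν (size ν)) (sym (size-sumTo ν (height≤size ν))))

split-at : (ν : Partition) (F : Partition → Set) →
           Σ Partition F ↔ ((Σ[ μ ∈ Partition ] (Irrelevant (¬ μ ≡ ν) × F μ)) ⊎ F ν)
split-at ν F = mk↔ₛ′ to from to-from from-to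
  where
  to : Σ Partition F → (Σ[ μ ∈ Partition ] (Irrelevant (¬ μ ≡ ν) × F μ)) ⊎ F ν
  to (μ , x) with μ ≟ₚ ν
  ... | yes refl = inj₂ x
  ... | no  ne   = inj₁ (μ , [ ne ] , x)
  from : (Σ[ μ ∈ Partition ] (Irrelevant (¬ μ ≡ ν) × F μ)) ⊎ F ν → Σ Partition F
  from (inj₁ (μ , _ , x)) = μ , x
  from (inj₂ x)           = ν , x
  to-from : ∀ y → to (from y) ≡ y
  to-from (inj₁ (μ , [ ne ] , x)) with μ ≟ₚ ν
  ... | yes e = ⊥-elim-irr (ne e)
  ... | no _  = refl
  to-from (inj₂ x) with ν ≟ₚ ν
  ... | yes refl = refl
  ... | no ne    = contradiction refl ne
  from-to : ∀ x → from (to x) ≡ x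
  from-to (μ , x) with μ ≟ₚ ν
  ... | yes refl = refl
  ... | no _     = refl

-- By descending induction on rank: the monomial x^ν only occurs in s_ν and in s_μ with μ
-- of larger rank, whose contributions cancel because all the types involved are finite.
unique-expansion : (A B : Partition → Set) → (∀ ν → Finite (A ν)) → (∀ ν → Finite (B ν)) →
  (∀ {k} (α : Vec ℕ k) → (Σ[ ν ∈ Partition ] (A ν × Chain α ν)) ↔ (Σ[ ν ∈ Partition ] (B ν × Chain α ν))) →
  ∀ ν → A ν ↔ B ν
unique-expansion A B fA fB expand ν₀ =
  descend (suc bound) ν₀ refl (m≤n+m (suc bound) (rank n ν₀))
  where
  n = size ν₀
  bound = sumTo (suc n) (λ _ → n)
  rank-bound : ∀ ν → size ν ≡ n → rank n ν ≤ bound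
  rank-bound ν e = sumTo-mono (suc n) (λ j _ → ≤-trans (sumTo≤size j ν) (≤-reflexive e))
  -- The fuel `d` decreases while the rank grows, so `bound < rank n ν + d` persists. At `d = 0` it
  -- would contradict `rank-bound`: a rank is a sum of n + 1 prefix sums, each at most `n`.
  descend : ∀ d ν → size ν ≡ n → bound < rank n ν + d → A ν ↔ B ν
  descend zero    ν e p = contradiction (rank-bound ν e) (<⇒≱ (subst (bound <_) (+-identityʳ _) p))
  -- After the larger ranks are cancelled, A and B remain multiplied by the number of tableaux of
  -- shape and content ν, which is nonzero by the superstandard tableau.
  descend (suc d) ν e p = ×-cancel (fA ν) (fB ν) (finite-Chain α ν) (superstandard ν)
    (⊎-cancel (finite-rest fA) (finite-× (fA ν) (finite-Chain α ν))
              (finite-rest fB) (finite-× (fB ν) (finite-Chain α ν)) rest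
              (↔-trans (↔-sym (split-at ν _)) (↔-trans (expand α) (split-at ν _))))
    where
    α = content ν (size ν)
    finite-rest : {C : Partition → Set} → (∀ ν → Finite (C ν)) →
                  Finite (Σ[ μ ∈ Partition ] (Irrelevant (¬ μ ≡ ν) × C μ × Chain α μ))
    finite-rest fC = finite-Σ-sized (size ν) (λ μ x → chain-sized ν (proj₂ (proj₂ x)))
      (λ μ → finite-× (finite-prop (λ _ _ → refl) (≢-dec μ)) (finite-× (fC μ) (finite-Chain α μ)))
      where
      ≢-dec : ∀ μ → Dec (Irrelevant (¬ μ ≡ ν))
      ≢-dec μ with μ ≟ₚ ν
      ... | yes e = no λ { [ ne ] → ⊥-elim-irr (ne e) }
      ... | no ne = yes [ ne ]
    lower : ∀ {μ} → ¬ μ ≡ ν → Chain α μ → A μ ↔ B μ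
    lower {μ} ne t = descend d μ (trans (chain-sized ν t) e)
      (≤-trans p (≤-trans (≤-reflexive (+-suc (rank n ν) d))
        (+-monoˡ-≤ d (subst (λ m → rank m ν < rank m μ) e (rank-strict ν t ne)))))
    rest : (Σ[ μ ∈ Partition ] (Irrelevant (¬ μ ≡ ν) × A μ × Chain α μ)) ↔
           (Σ[ μ ∈ Partition ] (Irrelevant (¬ μ ≡ ν) × B μ × Chain α μ))
    rest = mk↔ₛ′
      (λ { (μ , [ ne ] , a , t) → μ , [ ne ] , Inverse.to (lower (¬-recompute ne) t) a , t })
      (λ { (μ , [ ne ] , b , t) → μ , [ ne ] , Inverse.from (lower (¬-recompute ne) t) b , t })
      (λ { (μ , [ ne ] , b , t) → cong (λ z → μ , [ ne ] , z , t) (Inverse.strictlyInverseˡ (lower (¬-recompute ne) t) b) })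
      (λ { (μ , [ ne ] , a , t) → cong (λ z → μ , [ ne ] , z , t) (Inverse.strictlyInverseʳ (lower (¬-recompute ne) t) a) })

-- Single boxes and dominoes

bump dent : ℕ → (ℕ → ℕ) → ℕ → ℕ
bump r f i with i ≟ r
... | yes _ = suc (f i)
... | no  _ = f i
dent r f i with i ≟ r
... | yes _ = pred (f i)
... | no  _ = f i

bump-at : ∀ r f → bump r f r ≡ suc (f r)
bump-at r f with r ≟ r
... | yes _ = refl
... | no ne = contradiction refl ne

bump-off : ∀ r f {i} → ¬ i ≡ r → bump r f i ≡ f i
bump-off r f {i} ne with i ≟ r
... | yes e = contradiction e ne
... | no  _ = refl

dent-at : ∀ r f → dent r f r ≡ pred (f r)
dent-at r f with r ≟ r
... | yes _ = refl
... | no ne = contradiction refl ne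

dent-off : ∀ r f {i} → ¬ i ≡ r → dent r f i ≡ f i
dent-off r f {i} ne with i ≟ r
... | yes e = contradiction e ne
... | no  _ = refl

dent-≤ : ∀ r f i → dent r f i ≤ f i
dent-≤ r f i with i ≟ r
... | yes _ = pred[n]≤n
... | no  _ = ≤-refl

n≤suc-pred : ∀ n → n ≤ suc (pred n)
n≤suc-pred zero    = z≤n
n≤suc-pred (suc n) = ≤-refl

≤-suc-dent : ∀ r f i → f i ≤ suc (dent r f i)
≤-suc-dent r f i with i ≟ r
... | yes _ = n≤suc-pred (f i)
... | no  _ = n≤1+n _

bump-dent : ∀ r f → 1 ≤ f r → ∀ i → f i ≡ bump r (dent r f) i
bump-dent r f p i with i ≟ r
... | yes refl = sym (trans (cong suc (dent-at r f)) (suc-pred (f r) ⦃ >-nonZero p ⦄))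
... | no ne    = sym (dent-off r f ne)

sum-bump : ∀ n r f → r < n → sumTo n (bump r f) ≡ suc (sumTo n f)
sum-bump (suc n) zero    f p       = cong suc (cong (f 0 +_) (sumTo-cong n (λ i _ → bump-off 0 f {suc i} (λ ()))))
sum-bump (suc n) (suc r) f (s≤s p) = trans (cong (f 0 +_) (trans (sumTo-cong n (λ i _ → shift i)) (sum-bump n r (f ∘ suc) p))) (+-suc (f 0) _)
  where
  shift : ∀ i → bump (suc r) f (suc i) ≡ bump r (f ∘ suc) i
  shift i with i ≟ r
  ... | yes refl = bump-at (suc i) f
  ... | no ne    = bump-off (suc r) f (λ e → ne (suc-injective e))

Box : ℕ → Partition → Partition → Set
Box r γ μ = ∀ i → part γ i ≡ bump r (part μ) i

box-size : ∀ {r} γ μ → Box r γ μ → size γ ≡ suc (size μ)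
box-size {r} γ μ h = begin
  size γ                    ≡⟨ size-sumTo γ (≤-trans (m≤m+n _ _) (m≤m+n (height γ + height μ) _)) ⟩
  sumTo N (part γ)          ≡⟨ sumTo-cong N (λ i _ → h i) ⟩
  sumTo N (bump r (part μ)) ≡⟨ sum-bump N r (part μ) (m≤n+m (suc r) (height γ + height μ)) ⟩
  suc (sumTo N (part μ))    ≡⟨ cong suc (sym (size-sumTo μ (≤-trans (m≤n+m _ _) (m≤m+n (height γ + height μ) _)))) ⟩
  suc (size μ)              ∎
  where
  open ≡-Reasoning
  N = height γ + height μ + suc r

-- If the functions agree below `N`, the value is `N`. The specification assumes a strict inequality
-- of sums, which excludes this case.
firstDiff : ℕ → (ℕ → ℕ) → (ℕ → ℕ) → ℕ
firstDiff zero    f g = 0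
firstDiff (suc N) f g with f 0 ≟ g 0
... | yes _ = suc (firstDiff N (f ∘ suc) (g ∘ suc))
... | no  _ = 0

firstDiff-spec : ∀ N {f g} → (∀ i → f i ≤ g i) → sumTo N f < sumTo N g →
                 f (firstDiff N f g) < g (firstDiff N f g) × (∀ i → i < firstDiff N f g → f i ≡ g i)
firstDiff-spec (suc N) {f} {g} le lt with f 0 ≟ g 0
... | no ne = ≤∧≢⇒< (le 0) ne , λ i ()
... | yes e with firstDiff-spec N {f ∘ suc} {g ∘ suc} (le ∘ suc)
                   (+-cancelˡ-< (g 0) _ _ (subst (λ x → x + sumTo N (f ∘ suc) < g 0 + sumTo N (g ∘ suc)) e lt))
...   | p , q = p , λ { zero _ → e ; (suc i) (s≤s r) → q i r }

firstRow : Partition → Partition → ℕ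
firstRow γ μ = firstDiff (height γ ⊔ height μ) (part μ) (part γ)

firstRow-spec : ∀ γ μ → (∀ i → part μ i ≤ part γ i) → size μ < size γ →
                part μ (firstRow γ μ) < part γ (firstRow γ μ) × (∀ i → i < firstRow γ μ → part μ i ≡ part γ i)
firstRow-spec γ μ le lt = firstDiff-spec (height γ ⊔ height μ) le
  (subst₂ _<_ (size-sumTo μ (m≤n⊔m (height γ) _)) (size-sumTo γ (m≤m⊔n _ _)) lt)

bump-≤ : ∀ {r} {f g : ℕ → ℕ} → (∀ i → f i ≤ g i) → f r < g r → ∀ i → bump r f i ≤ g i
bump-≤ {r} le lt i with i ≟ r
... | yes refl = lt
... | no  _    = le i

-- Adding a box to μ in the first row that differs keeps it inside γ and already reaches the size of
-- γ, so rigidity gives equality.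
one-box : ∀ γ μ → (∀ i → part μ i ≤ part γ i) → size γ ≡ suc (size μ) → ∃ λ r → Box r γ μ
one-box γ μ le e = r , λ i → sym (sumTo-rigid (N + suc i) (λ j _ → bump-≤ {r} {part μ} {part γ} le lt j) (≤-reflexive (total i)) i (m≤n+m (suc i) N))
  where
  r = firstRow γ μ
  N = height γ + height μ + suc r
  lt = proj₁ (firstRow-spec γ μ le (≤-reflexive (sym e)))
  total : ∀ i → sumTo (N + suc i) (part γ) ≡ sumTo (N + suc i) (bump r (part μ))
  total i = begin
    sumTo (N + suc i) (part γ)
      ≡⟨ sym (size-sumTo γ (≤-trans (m≤m+n _ _) (≤-trans (m≤m+n (height γ + height μ) _) (m≤m+n N _)))) ⟩
    size γ
      ≡⟨ trans e (cong suc (size-sumTo μ (≤-trans (m≤n+m _ (height γ)) (≤-trans (m≤m+n (height γ + height μ) _) (m≤m+n N _))))) ⟩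
    suc (sumTo (N + suc i) (part μ))
      ≡⟨ sym (sum-bump (N + suc i) r (part μ) (≤-trans (m≤n+m (suc r) (height γ + height μ)) (m≤m+n N _))) ⟩
    sumTo (N + suc i) (bump r (part μ)) ∎
    where open ≡-Reasoning

-- A single box is always a horizontal strip. In a row `i` without the new box, γ_{i+1} ≤ γ_i = μ_i;
-- in its own row, the next row is unchanged and μ is decreasing.
box-HS : ∀ γ μ → (∀ i → part μ i ≤ part γ i) → size γ ≡ suc (size μ) → HS 1 γ μ
box-HS γ μ le e with one-box γ μ le e
... | r , box = mkHS ((λ i → le i , above i) , e)
  where
  above : ∀ i → part γ (suc i) ≤ part μ i
  above i with i ≟ r
  ... | yes refl = ≤-trans (≤-reflexive (trans (box (suc i)) (bump-off i (part μ) (1+n≢n)))) (part-mono μ i)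
  ... | no ne    = ≤-trans (part-mono γ i) (≤-reflexive (trans (box i) (bump-off r (part μ) ne)))

-- γ/β is a vertical strip of size 2, not necessarily connected.
record Domino (γ β : Partition) : Set where
  constructor mkDomino
  field .domino : (∀ i → part β i ≤ part γ i × part γ i ≤ suc (part β i)) × size γ ≡ 2 + size β

openDomino : ∀ {γ β} → Domino γ β → (∀ i → part β i ≤ part γ i × part γ i ≤ suc (part β i)) × size γ ≡ 2 + size β
openDomino (mkDomino c) = (Π-recompute _ (λ i → ≤-rec ×-recompute ≤-rec) ×-recompute ≡-rec) c

Domino? : ∀ γ β → Dec (Domino γ β)
Domino? γ β = map′ (λ c → mkDomino c) openDomino
  (eventually-dec (λ i → (_ ≤? _) ×-dec (_ ≤? _)) (height β ⊔ height γ) end ×-dec (size γ ≟ 2 + size β))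
  where
  end : ∀ i → height β ⊔ height γ ≤ i → part β i ≤ part γ i × part γ i ≤ suc (part β i)
  end i p = ≤-trans (≤-reflexive (part-beyond β (≤-trans (m≤m⊔n _ _) p))) z≤n ,
            ≤-trans (≤-reflexive (part-beyond γ (≤-trans (m≤n⊔m (height β) _) p))) z≤n

finite-Domino : ∀ γ β → Finite (Domino γ β)
finite-Domino γ β = finite-prop (λ _ _ → refl) (Domino? γ β)

-- h₁² = h₂ + e₂: two boxes are added in succession, and the sum is split by whether
-- the second one lies in the first row r where γ and β differ.
module TwoBoxes (γ β : Partition) where

  r : ℕ
  r = firstRow γ β

  Between : Set
  Between = Σ[ μ ∈ Partition ] (HS 1 μ β × HS 1 γ μ)

  module Split {μ} (h : HS 1 μ β) (g : HS 1 γ μ) where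

    β≤μ : ∀ i → part β i ≤ part μ i
    β≤μ i = proj₁ (proj₁ (openHS h) i)

    μ≤γ : ∀ i → part μ i ≤ part γ i
    μ≤γ i = proj₁ (proj₁ (openHS g) i)

    size2 : size γ ≡ 2 + size β
    size2 = trans (proj₂ (openHS g)) (cong suc (proj₂ (openHS h)))

    first : part β r < part γ r × (∀ i → i < r → part β i ≡ part γ i)
    first = firstRow-spec γ β (λ i → ≤-trans (β≤μ i) (μ≤γ i)) (≤-trans (n≤1+n _) (≤-reflexive (sym size2)))

    second-in-first : ¬ part γ r ≡ part μ r → Box r γ μ
    second-in-first ne with one-box γ μ μ≤γ (proj₂ (openHS g))
    ... | s , box with r ≟ s
    ...   | yes refl = box
    ...   | no  r≢s  = contradiction (trans (box r) (bump-off s (part μ) r≢s)) ne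

    first-in-first : part γ r ≡ part μ r → Box r μ β
    first-in-first e with one-box μ β β≤μ (proj₂ (openHS h))
    ... | s , box with r ≟ s
    ...   | yes refl = box
    ...   | no  r≢s  = contradiction (trans e (trans (box r) (bump-off s (part β) r≢s))) (<⇒≢ (proj₁ first) ∘ sym)

    horizontal : ¬ part γ r ≡ part μ r → HS 2 γ β
    horizontal ne = mkHS ((λ i → ≤-trans (β≤μ i) (μ≤γ i) , above i) , size2)
      where
      above : ∀ i → part γ (suc i) ≤ part β i
      -- Row `r` is bounded by the row above it, where γ and β agree. The other rows of γ are those
      -- of μ, and μ/β is a horizontal strip.
      above i with suc i ≟ r
      ... | yes e = ≤-trans (part-mono γ i) (≤-reflexive (sym (proj₂ first i (≤-reflexive e))))
      ... | no s≢r = ≤-trans (≤-reflexive (trans (second-in-first ne (suc i)) (bump-off r (part μ) s≢r)))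
                             (proj₂ (proj₁ (openHS h) i))

    vertical : part γ r ≡ part μ r → Domino γ β
    vertical e = mkDomino ((λ i → ≤-trans (β≤μ i) (μ≤γ i) , thin i) , size2)
      where
      second = one-box γ μ μ≤γ (proj₂ (openHS g))
      s = proj₁ second
      s≢r : ¬ s ≡ r
      s≢r q = 1+n≢n (trans (sym (bump-at r (part μ))) (trans (sym (subst (λ x → Box x γ μ) q (proj₂ second) r)) e))
      bump-≤-suc : ∀ i → bump r (part β) i ≤ suc (part β i)
      bump-≤-suc i with i ≟ r
      ... | yes _ = ≤-refl
      ... | no  _ = n≤1+n _
      thin : ∀ i → part γ i ≤ suc (part β i)
      thin i with i ≟ s
      ... | yes refl = ≤-reflexive (trans (proj₂ second i) (trans (bump-at i (part μ))
                         (cong suc (trans (first-in-first e i) (bump-off r (part β) s≢r)))))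
      ... | no  i≢s  = ≤-trans (≤-reflexive (trans (proj₂ second i) (trans (bump-off s (part μ) i≢s) (first-in-first e i))))
                               (bump-≤-suc i)

  -- Two boxes in different rows and columns can be added in either order and are both a horizontal
  -- and a vertical strip. The order decides: finishing in row `r` counts as horizontal, starting
  -- there and finishing elsewhere as vertical.
  to : Between → HS 2 γ β ⊎ Domino γ β
  to (μ , h , g) with part γ r ≟ part μ r
  ... | yes e = inj₂ (Split.vertical h g e)
  ... | no ne = inj₁ (Split.horizontal h g ne)

  -- A box of row `r` has to be added last, so the middle shape is γ with the end of that row
  -- removed.
  module FromHorizontal (k : HS 2 γ β) where

    β≤γ : ∀ i → part β i ≤ part γ i
    β≤γ i = proj₁ (proj₁ (openHS k) i)

    first : part β r < part γ r × (∀ i → i < r → part β i ≡ part γ i)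
    first = firstRow-spec γ β β≤γ (≤-trans (n≤1+n _) (≤-reflexive (sym (proj₂ (openHS k)))))

    f : ℕ → ℕ
    f = dent r (part γ)

    f-dec : Decreasing f
    f-dec i with i ≟ r
    ... | yes refl = ≤-trans (dent-≤ i (part γ) (suc i)) (≤-trans (proj₂ (proj₁ (openHS k) i)) (<⇒≤pred (proj₁ first)))
    ... | no  _    = ≤-trans (dent-≤ r (part γ) (suc i)) (part-mono γ i)

    f-end : f (height γ) ≡ 0
    f-end = n≤0⇒n≡0 (≤-trans (dent-≤ r (part γ) (height γ)) (≤-reflexive (part-beyond γ ≤-refl)))

    middle : Partition
    middle = fromFun f (height γ) f-dec f-end

    middle-part : ∀ i → part middle i ≡ f i
    middle-part = part-fromFun f (height γ) f-dec f-end

    box : Box r γ middle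
    box i = trans (bump-dent r (part γ) (≤-trans (s≤s z≤n) (proj₁ first)) i) (lem i)
      where
      lem : ∀ i → bump r f i ≡ bump r (part middle) i
      lem i with i ≟ r
      ... | yes _ = cong suc (sym (middle-part i))
      ... | no  _ = sym (middle-part i)

    middle≤ : ∀ i → part middle i ≤ part γ i
    middle≤ i = ≤-trans (≤-reflexive (middle-part i)) (dent-≤ r (part γ) i)

    ≤middle : ∀ i → part β i ≤ part middle i
    ≤middle i = ≤-trans (lem i) (≤-reflexive (sym (middle-part i)))
      where
      lem : ∀ i → part β i ≤ f i
      lem i with i ≟ r
      ... | yes refl = <⇒≤pred (proj₁ first)
      ... | no  _    = β≤γ i

    size-γ : size γ ≡ suc (size middle)
    size-γ = box-size γ middle box

    result : Between
    result = middle , box-HS middle β ≤middle (suc-injective (trans (sym size-γ) (proj₂ (openHS k)))) ,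
                      box-HS γ middle middle≤ size-γ

  -- The box of row `r`, the upper one, has to be added first. The result is a partition because row
  -- r - 1 already has its length in γ.
  module FromDomino (k : Domino γ β) where

    β≤γ : ∀ i → part β i ≤ part γ i
    β≤γ i = proj₁ (proj₁ (openDomino k) i)

    first : part β r < part γ r × (∀ i → i < r → part β i ≡ part γ i)
    first = firstRow-spec γ β β≤γ (≤-trans (n≤1+n _) (≤-reflexive (sym (proj₂ (openDomino k)))))

    f : ℕ → ℕ
    f = bump r (part β)

    f≤γ : ∀ i → f i ≤ part γ i
    f≤γ = bump-≤ {r} {part β} {part γ} β≤γ (proj₁ first)

    ≤f : ∀ i → part β i ≤ f i
    ≤f i with i ≟ r
    ... | yes _ = n≤1+n _
    ... | no  _ = ≤-refl

    f-dec : Decreasing f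
    f-dec i with suc i ≟ r
    ... | yes e = ≤-trans (subst (λ j → suc (part β j) ≤ part γ j) (sym e) (proj₁ first))
                    (≤-trans (part-mono γ i) (≤-trans (≤-reflexive (sym (proj₂ first i (≤-reflexive e)))) (≤f i)))
    ... | no  _ = ≤-trans (part-mono β i) (≤f i)

    f-end : f (height γ) ≡ 0
    f-end = n≤0⇒n≡0 (≤-trans (f≤γ (height γ)) (≤-reflexive (part-beyond γ ≤-refl)))

    middle : Partition
    middle = fromFun f (height γ) f-dec f-end

    middle-part : ∀ i → part middle i ≡ f i
    middle-part = part-fromFun f (height γ) f-dec f-end

    size-middle : size middle ≡ suc (size β)
    size-middle = box-size middle β middle-part

    result : Between
    result = middle , box-HS middle β (λ i → ≤-trans (≤f i) (≤-reflexive (sym (middle-part i)))) size-middle ,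
             box-HS γ middle (λ i → ≤-trans (≤-reflexive (middle-part i)) (f≤γ i))
               (trans (proj₂ (openDomino k)) (cong suc (sym size-middle)))

  from : HS 2 γ β ⊎ Domino γ β → Between
  from (inj₁ k) = FromHorizontal.result k
  from (inj₂ k) = FromDomino.result k

  between-≡ : ∀ {x y : Between} → (∀ i → part (proj₁ x) i ≡ part (proj₁ y) i) → x ≡ y
  between-≡ {x = μ , h , g} {y = μ′ , h′ , g′} e with part-ext {μ} {μ′} e
  ... | refl = refl

  to-horizontal : ∀ {x} k → ¬ part γ r ≡ part (proj₁ x) r → to x ≡ inj₁ k
  to-horizontal {μ , h , g} k ne with part γ r ≟ part μ r
  ... | yes e = contradiction e ne
  ... | no  _ = refl

  to-vertical : ∀ {x} k → part γ r ≡ part (proj₁ x) r → to x ≡ inj₂ k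
  to-vertical {μ , h , g} k e with part γ r ≟ part μ r
  ... | yes _ = refl
  ... | no ne = contradiction e ne

  to-from : ∀ y → to (from y) ≡ y
  to-from (inj₁ k) = to-horizontal {FromHorizontal.result k} k
    λ e → 1+n≢n (trans (sym (bump-at r (part (FromHorizontal.middle k)))) (trans (sym (FromHorizontal.box k r)) e))
  to-from (inj₂ k) = to-vertical {FromDomino.result k} k (≤-antisym
      (≤-trans (proj₂ (proj₁ (openDomino k) r)) (≤-reflexive (sym middle-r)))
      (≤-trans (≤-reflexive middle-r) (proj₁ (FromDomino.first k))))
    where
    middle-r : part (FromDomino.middle k) r ≡ suc (part β r)
    middle-r = trans (FromDomino.middle-part k r) (bump-at r (part β))

  from-to : ∀ x → from (to x) ≡ x
  from-to (μ , h , g) with part γ r ≟ part μ r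
  ... | yes e = between-≡ λ i → trans (FromDomino.middle-part (Split.vertical h g e) i) (sym (Split.first-in-first h g e i))
  ... | no ne = between-≡ λ i → trans (FromHorizontal.middle-part (Split.horizontal h g ne) i) (undo i)
    where
    undo : ∀ i → dent r (part γ) i ≡ part μ i
    undo i with i ≟ r
    ... | yes refl = trans (cong pred (Split.second-in-first h g ne i)) (cong pred (bump-at i (part μ)))
    ... | no  i≢r  = trans (Split.second-in-first h g ne i) (bump-off r (part μ) i≢r)

  two-boxes : Between ↔ (HS 2 γ β ⊎ Domino γ β)
  two-boxes = mk↔ₛ′ to from to-from from-to
open TwoBoxes public using (two-boxes; Between)

-- Multiplication by s_λ commutes with h_b and e₂

⊞-comm : ∀ {k} {x y z : Vec ℕ k} → (x ⊞ y ≡ z) ↔ (y ⊞ x ≡ z)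
⊞-comm {x = x} {y} = mk↔ₛ′ (λ s → ⊞-eq (trans (zipWith-comm +-comm y x) (⊞-open s)))
                           (λ s → ⊞-eq (trans (zipWith-comm +-comm x y) (⊞-open s))) (λ _ → refl) (λ _ → refl)

-- Coefficients of s_β s_λ, with reversed contents.
ChainProduct : Partition → Partition → ∀ {k} → Vec ℕ k → Set
ChainProduct β lam {k} α = Σ[ α₁ ∈ Vec ℕ k ] Σ[ α₂ ∈ Vec ℕ k ] (α₁ ⊞ α₂ ≡ α × Chain α₁ β × Chain α₂ lam)

zeros-empty : ∀ {k} (α : Vec ℕ k) → vsum α ≡ 0 → Chain α ∅ₚ
zeros-empty []         e = [ refl ]
zeros-empty (zero ∷ α) e = ∅ₚ , mkHS ((λ i → z≤n , z≤n) , refl) , zeros-empty α e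

chain-∅-unique : ∀ {k} (α : Vec ℕ k) (t u : Chain α ∅ₚ) → t ≡ u
chain-∅-unique []      t u = refl
chain-∅-unique (a ∷ α) (μ , h , t) (μ′ , h′ , t′) = go μ h t μ′ h′ t′ (below h) (below h′)
  where
  below : ∀ {μ} → HS a ∅ₚ μ → μ ≡ ∅ₚ
  below {μ} h = part-ext λ i → n≤0⇒n≡0 (proj₁ (proj₁ (openHS h) i))
  go : ∀ μ (h : HS a ∅ₚ μ) (t : Chain α μ) μ′ (h′ : HS a ∅ₚ μ′) (t′ : Chain α μ′) → μ ≡ ∅ₚ → μ′ ≡ ∅ₚ →
       (Chain (a ∷ α) ∅ₚ ∋ (μ , h , t)) ≡ (μ′ , h′ , t′)
  go _ h t _ h′ t′ refl refl = cong (λ z → ∅ₚ , h , z) (chain-∅-unique α t t′)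

-- This is s_∅ = h_0 = 1; it lets a product with s_∅ be read as `Skewed 0`.
chain-∅ : ∀ {k} (α : Vec ℕ k) → Chain α ∅ₚ ↔ Irrelevant (vsum α ≡ 0)
chain-∅ α = mk↔ₛ′ (λ t → [ sym (chain-size α t) ]) (λ { [ e ] → zeros-empty α (≡-rec e) })
  (λ _ → refl) (λ t → chain-∅-unique α _ t)

module LittlewoodRichardson
  (lam : Partition) (c : Partition → Partition → ℕ)
  (lr : ∀ β {k} (α : Vec ℕ k) → ChainProduct β lam α ↔ (Σ[ ν ∈ Partition ] (Fin (c β ν) × Chain α ν)))
  where

  -- `R` is the matrix of multiplication by a symmetric function on Schur functions: `HS b` for h_b,
  -- `Between` for h_1², `Domino` for e_2. The two types count the coefficient of s_ν when this
  -- multiplication precedes or follows that by s_λ.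
  RaiseThenMultiply MultiplyThenRaise : (Partition → Partition → Set) → Partition → Partition → Set
  RaiseThenMultiply R β ν = Σ[ γ ∈ Partition ] (R γ β × Fin (c γ ν))
  MultiplyThenRaise R β ν = Σ[ μ ∈ Partition ] (R ν μ × Fin (c β μ))

  finite-raise : ∀ n (R : Partition → Partition → Set) β ν → (∀ γ → R γ β → size γ ≡ n + size β) →
                 (∀ γ → Finite (R γ β)) → Finite (RaiseThenMultiply R β ν)
  finite-raise n R β ν s f = finite-Σ-sized (n + size β) (λ γ x → s γ (proj₁ x)) (λ γ → finite-× (f γ) (finite-Fin _))

  finite-multiply : ∀ n (R : Partition → Partition → Set) β ν → (∀ μ → R ν μ → size ν ≡ n + size μ) →
                    (∀ μ → Finite (R ν μ)) → Finite (MultiplyThenRaise R β ν)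
  finite-multiply n R β ν s f = finite-Σ-sized (size ν ∸ n)
    (λ μ x → sym (trans (cong (_∸ n) (s μ (proj₁ x))) (m+n∸m≡n n (size μ)))) (λ μ → finite-× (f μ) (finite-Fin _))

  finite-raise-HS : ∀ b β ν → Finite (RaiseThenMultiply (HS b) β ν)
  finite-raise-HS b β ν = finite-raise b (HS b) β ν (λ γ h → proj₂ (openHS h)) (λ γ → finite-HS b γ β)

  finite-multiply-HS : ∀ b β ν → Finite (MultiplyThenRaise (HS b) β ν)
  finite-multiply-HS b β ν = finite-multiply b (HS b) β ν (λ μ h → proj₂ (openHS h)) (λ μ → finite-HS b ν μ)

  -- (h_b s_β) s_λ = h_b (s_β s_λ)
  strip-commute : ∀ b β ν → RaiseThenMultiply (HS b) β ν ↔ MultiplyThenRaise (HS b) β ν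
  strip-commute b β = unique-expansion (RaiseThenMultiply (HS b) β) (MultiplyThenRaise (HS b) β)
    (finite-raise-HS b β) (finite-multiply-HS b β) expand
    where
    expand : ∀ {k} (α : Vec ℕ k) → (Σ[ ν ∈ Partition ] (RaiseThenMultiply (HS b) β ν × Chain α ν)) ↔
                                   (Σ[ ν ∈ Partition ] (MultiplyThenRaise (HS b) β ν × Chain α ν))
    expand {k} α =
      (Σ[ ν ∈ Partition ] (RaiseThenMultiply (HS b) β ν × Chain α ν))
        ↔⟨ mk↔ₛ′ (λ { (ν , (γ , h , x) , t) → γ , h , ν , x , t }) (λ { (γ , h , ν , x , t) → ν , (γ , h , x) , t })
                 (λ _ → refl) (λ _ → refl) ⟩
      (Σ[ γ ∈ Partition ] (HS b γ β × Σ[ ν ∈ Partition ] (Fin (c γ ν) × Chain α ν)))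
        ↔˘⟨ Σ-cong (λ γ → ×-congʳ (lr γ α)) ⟩
      (Σ[ γ ∈ Partition ] (HS b γ β × ChainProduct γ lam α))
        ↔⟨ mk↔ₛ′ (λ { (γ , h , α₁ , α₂ , s , t , u) → α₁ , α₂ , s , u , γ , h , t })
                 (λ { (α₁ , α₂ , s , u , γ , h , t) → γ , h , α₁ , α₂ , s , t , u })
                 (λ _ → refl) (λ _ → refl) ⟩
      (Σ[ α₁ ∈ Vec ℕ k ] Σ[ α₂ ∈ Vec ℕ k ] (α₁ ⊞ α₂ ≡ α × Chain α₂ lam × Σ[ γ ∈ Partition ] (HS b γ β × Chain α₁ γ)))
        ↔⟨ Σ-cong (λ α₁ → Σ-cong λ α₂ → ×-congʳ (×-congʳ (pieri b α₁ β))) ⟩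
      (Σ[ α₁ ∈ Vec ℕ k ] Σ[ α₂ ∈ Vec ℕ k ] (α₁ ⊞ α₂ ≡ α × Chain α₂ lam × Skewed b α₁ β))
        ↔⟨ mk↔ₛ′ (λ { (w , y , s , u , γ , x , r , p , t) → x , y , γ , p , t , u , w , s , r })
                 (λ { (x , y , γ , p , t , u , w , s , r) → w , y , s , u , γ , x , r , p , t })
                 (λ _ → refl) (λ _ → refl) ⟩
      Terms (λ x y γ → Σ[ w ∈ Vec ℕ k ] (w ⊞ y ≡ α × γ ⊞ x ≡ w))
        ↔⟨ terms-cong (λ x y γ → Σ-cong λ w → ×-congʳ ⊞-comm) ⟩
      Terms (λ x y γ → Σ[ w ∈ Vec ℕ k ] (w ⊞ y ≡ α × x ⊞ γ ≡ w))
        -- Associativity of the product: the content `γ` of h_b is taken out of the first factor.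
        ↔˘⟨ terms-cong (λ x y γ → ⊞-swap γ x y α) ⟩
      Terms (λ x y γ → Σ[ w ∈ Vec ℕ k ] (γ ⊞ w ≡ α × x ⊞ y ≡ w))
        ↔⟨ mk↔ₛ′ (λ { (x , y , γ , p , t , u , w , s , r) → γ , w , s , p , x , y , r , t , u })
                 (λ { (γ , w , s , p , x , y , r , t , u) → x , y , γ , p , t , u , w , s , r })
                 (λ _ → refl) (λ _ → refl) ⟩
      (Σ[ γ ∈ Vec ℕ k ] Σ[ w ∈ Vec ℕ k ] (γ ⊞ w ≡ α × Irrelevant (vsum γ ≡ b) × ChainProduct β lam w))
        ↔⟨ Σ-cong (λ γ → Σ-cong λ w → ×-congʳ (×-congʳ (lr β w))) ⟩
      (Σ[ γ ∈ Vec ℕ k ] Σ[ w ∈ Vec ℕ k ] (γ ⊞ w ≡ α × Irrelevant (vsum γ ≡ b) ×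
        Σ[ μ ∈ Partition ] (Fin (c β μ) × Chain w μ)))
        ↔⟨ mk↔ₛ′ (λ { (γ , w , s , p , μ , x , t) → μ , x , γ , w , s , p , t })
                 (λ { (μ , x , γ , w , s , p , t) → γ , w , s , p , μ , x , t })
                 (λ _ → refl) (λ _ → refl) ⟩
      (Σ[ μ ∈ Partition ] (Fin (c β μ) × Skewed b α μ))
        ↔˘⟨ Σ-cong (λ μ → ×-congʳ (pieri b α μ)) ⟩
      (Σ[ μ ∈ Partition ] (Fin (c β μ) × Σ[ ν ∈ Partition ] (HS b ν μ × Chain α ν)))
        ↔⟨ mk↔ₛ′ (λ { (μ , x , ν , h , t) → ν , (μ , h , x) , t }) (λ { (ν , (μ , h , x) , t) → μ , x , ν , h , t })
                 (λ _ → refl) (λ _ → refl) ⟩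
      (Σ[ ν ∈ Partition ] (MultiplyThenRaise (HS b) β ν × Chain α ν)) ↔∎
      where
      Terms : (Vec ℕ k → Vec ℕ k → Vec ℕ k → Set) → Set
      Terms F = Σ[ x ∈ Vec ℕ k ] Σ[ y ∈ Vec ℕ k ] Σ[ γ ∈ Vec ℕ k ]
        (Irrelevant (vsum γ ≡ b) × Chain x β × Chain y lam × F x y γ)
      terms-cong : ∀ {F G} → (∀ x y γ → F x y γ ↔ G x y γ) → Terms F ↔ Terms G
      terms-cong h = Σ-cong λ x → Σ-cong λ y → Σ-cong λ γ → ×-congʳ (×-congʳ (×-congʳ (h x y γ)))

  boxes-commute : ∀ β ν → RaiseThenMultiply Between β ν ↔ MultiplyThenRaise Between β ν
  boxes-commute β ν =
    RaiseThenMultiply Between β ν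
      ↔⟨ mk↔ₛ′ (λ { (γ , (μ , h , g) , x) → μ , h , γ , g , x }) (λ { (μ , h , γ , g , x) → γ , (μ , h , g) , x })
               (λ _ → refl) (λ _ → refl) ⟩
    (Σ[ μ ∈ Partition ] (HS 1 μ β × RaiseThenMultiply (HS 1) μ ν))
      ↔⟨ Σ-cong (λ μ → ×-congʳ (strip-commute 1 μ ν)) ⟩
    (Σ[ μ ∈ Partition ] (HS 1 μ β × MultiplyThenRaise (HS 1) μ ν))
      ↔⟨ mk↔ₛ′ (λ { (μ , h , τ , g , x) → τ , g , μ , h , x }) (λ { (τ , g , μ , h , x) → μ , h , τ , g , x })
               (λ _ → refl) (λ _ → refl) ⟩
    (Σ[ τ ∈ Partition ] (HS 1 ν τ × RaiseThenMultiply (HS 1) β τ))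
      ↔⟨ Σ-cong (λ τ → ×-congʳ (strip-commute 1 β τ)) ⟩
    (Σ[ τ ∈ Partition ] (HS 1 ν τ × MultiplyThenRaise (HS 1) β τ))
      ↔⟨ mk↔ₛ′ (λ { (τ , g , σ , h , x) → σ , (τ , h , g) , x }) (λ { (σ , (τ , h , g) , x) → τ , g , σ , h , x })
               (λ _ → refl) (λ _ → refl) ⟩
    MultiplyThenRaise Between β ν ↔∎

  -- (e₂ s_β) s_λ = e₂ (s_β s_λ), by subtracting the identity for h₂ from the one for h₁².
  domino-commute : ∀ β ν → RaiseThenMultiply Domino β ν ↔ MultiplyThenRaise Domino β ν
  domino-commute β ν = ⊎-cancel (finite-raise-HS 2 β ν)
    (finite-raise 2 Domino β ν (λ γ k → proj₂ (openDomino k)) (λ γ → finite-Domino γ β))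
    (finite-multiply-HS 2 β ν)
    (finite-multiply 2 Domino β ν (λ μ k → proj₂ (openDomino k)) (λ μ → finite-Domino ν μ))
    (strip-commute 2 β ν)
    ( (RaiseThenMultiply (HS 2) β ν ⊎ RaiseThenMultiply Domino β ν)
        ↔⟨ distribute ⟩
      (Σ[ γ ∈ Partition ] ((HS 2 γ β ⊎ Domino γ β) × Fin (c γ ν)))
        ↔˘⟨ Σ-cong (λ γ → two-boxes γ β ×-↔ ↔-refl) ⟩
      RaiseThenMultiply Between β ν
        ↔⟨ boxes-commute β ν ⟩
      MultiplyThenRaise Between β ν
        ↔⟨ Σ-cong (λ μ → two-boxes ν μ ×-↔ ↔-refl) ⟩
      (Σ[ μ ∈ Partition ] ((HS 2 ν μ ⊎ Domino ν μ) × Fin (c β μ)))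
        ↔˘⟨ distribute ⟩
      (MultiplyThenRaise (HS 2) β ν ⊎ MultiplyThenRaise Domino β ν) ↔∎ )
    where
    distribute : {P Q F : Partition → Set} →
      ((Σ[ γ ∈ Partition ] (P γ × F γ)) ⊎ (Σ[ γ ∈ Partition ] (Q γ × F γ))) ↔ (Σ[ γ ∈ Partition ] ((P γ ⊎ Q γ) × F γ))
    distribute = mk↔ₛ′
      (λ { (inj₁ (γ , p , x)) → γ , inj₁ p , x ; (inj₂ (γ , q , x)) → γ , inj₂ q , x })
      (λ { (γ , inj₁ p , x) → inj₁ (γ , p , x) ; (γ , inj₂ q , x) → inj₂ (γ , q , x) })
      (λ { (γ , inj₁ p , x) → refl ; (γ , inj₂ q , x) → refl })
      (λ { (inj₁ (γ , p , x)) → refl ; (inj₂ (γ , q , x)) → refl })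

  -- The product s_∅ s_λ is h_0 s_λ, which the Pieri rule expands over strips of size 0. Uniqueness
  -- of expansions turns a nonzero `c ∅ₚ ν` into such a strip, and it forces ν = λ.
  lr-∅ : ∀ ν → Fin (c ∅ₚ ν) → ν ≡ lam
  lr-∅ ν x = sym (part-rigid (λ i → proj₁ (proj₁ (openHS strip) i)) (sym (proj₂ (openHS strip))))
    where
    strip : HS 0 ν lam
    strip = Inverse.to (unique-expansion (λ ν → Fin (c ∅ₚ ν)) (λ ν → HS 0 ν lam) (λ ν → finite-Fin _) (λ ν → finite-HS 0 ν lam)
      (λ {k} α →
        _ ↔˘⟨ lr ∅ₚ α ⟩
        ChainProduct ∅ₚ lam α
          ↔⟨ Σ-cong (λ α₁ → Σ-cong λ α₂ → ×-congʳ (chain-∅ α₁ ×-↔ ↔-refl)) ⟩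
        Skewed 0 α lam
          ↔˘⟨ pieri 0 α lam ⟩
        _ ↔∎) ν) x


-- Nonzero coefficients and chains of vertical dominoes

domino-VertStrip : ∀ {ν μ} → Domino ν μ → VertStrip ν μ
domino-VertStrip {ν} {μ} k =
  (λ i j p → ≤-trans p (proj₁ (proj₁ (openDomino k) i))) ,
  (λ { i j j′ (p , q) (p′ , q′) → trans (only i p q) (sym (only i p′ q′)) })
  where
  only : ∀ i {j} → j < part ν i → ¬ (j < part μ i) → j ≡ part μ i
  only i p q = ≤-antisym (s≤s⁻¹ (≤-trans p (proj₂ (proj₁ (openDomino k) i)))) (≮⇒≥ q)

domino-step : ∀ {lam μ ν} → VChain lam μ → Domino ν μ → VChain lam ν
domino-step {μ = μ} {ν} v k = step v (domino-VertStrip k)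
  (divides 1 (trans (cong (_∸ size μ) (proj₂ (openDomino k))) (m+n∸n≡m 2 (size μ))))

last-pair : ∀ N f → Decreasing f → PairedFun f → f N ≡ 0 → 1 ≤ f 0 → ∃ λ m → 1 ≤ f (m * 2) × f (suc m * 2) ≡ 0
last-pair zero    f d p e q = contradiction (sym e) (<⇒≢ q)
last-pair (suc N) f d p e q with f 2 in eq
... | zero  = 0 , q , eq
-- The search advances two rows while the bound drops by one, so the shifted function must vanish at
-- `N`; this holds since f (N + 2) ≤ f (N + 1) = 0.
... | suc a with last-pair N (f ∘ suc ∘ suc) (d ∘ suc ∘ suc) (p ∘ suc)
                   (n≤0⇒n≡0 (≤-trans (d (suc N)) (≤-reflexive e))) (≤-trans (s≤s z≤n) (≤-reflexive (sym eq)))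
...   | m , r , s = suc m , r , s

-- The last boxes of the last pair of rows are removed.
remove-domino-at : ∀ β → Paired β → ∀ m → 1 ≤ part β (m * 2) → part β (suc m * 2) ≡ 0 →
                   ∃ λ β′ → Paired β′ × Domino β β′
remove-domino-at β p m positive last = β′ , mkPaired paired , mkDomino ((λ i → β′≤ i , ≤β′ i) , size-β)
  where
  s = m * 2
  f = dent (suc s) (part β)
  g = dent s f
  f-dec : Decreasing f
  f-dec i with i ≟ suc s
  ... | yes refl = ≤-trans (dent-≤ (suc s) (part β) (suc i)) (≤-trans (≤-reflexive last) z≤n)
  ... | no  _    = ≤-trans (dent-≤ (suc s) (part β) (suc i)) (part-mono β i)
  f-s : f s ≡ part β s
  f-s = dent-off (suc s) (part β) (λ e → 1+n≢n (sym e))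
  g-dec : Decreasing g
  g-dec i with i ≟ s
  ... | yes refl = ≤-reflexive (trans (dent-off i f 1+n≢n) (trans (dent-at (suc i) (part β))
                     (cong pred (trans (sym (openPaired p m)) (sym f-s)))))
  ... | no  _    = ≤-trans (dent-≤ s f (suc i)) (f-dec i)
  f-end : f (height β) ≡ 0
  f-end = n≤0⇒n≡0 (≤-trans (dent-≤ (suc s) (part β) (height β)) (≤-reflexive (part-beyond β ≤-refl)))
  g-end : g (height β) ≡ 0
  g-end = n≤0⇒n≡0 (≤-trans (dent-≤ s f (height β)) (≤-reflexive f-end))
  -- The shape β″ serves to count boxes: β/β″ and β″/β′ are single boxes, the lower one removed
  -- first.
  β″ β′ : Partition
  β″ = fromFun f (height β) f-dec f-end
  β′ = fromFun g (height β) g-dec g-end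
  β″-part : ∀ i → part β″ i ≡ f i
  β″-part = part-fromFun f (height β) f-dec f-end
  β′-part : ∀ i → part β′ i ≡ g i
  β′-part = part-fromFun g (height β) g-dec g-end
  bump-cong : ∀ r {f g : ℕ → ℕ} → (∀ i → f i ≡ g i) → ∀ i → bump r f i ≡ bump r g i
  bump-cong r h i with i ≟ r
  ... | yes _ = cong suc (h i)
  ... | no  _ = h i
  size-β : size β ≡ 2 + size β′
  size-β = trans
    (box-size β β″ (λ i → trans (bump-dent (suc s) (part β) (subst (1 ≤_) (openPaired p m) positive) i)
                                (bump-cong (suc s) (λ j → sym (β″-part j)) i)))
    (cong suc (box-size β″ β′ (λ i → trans (β″-part i) (trans
      (bump-dent s f (subst (1 ≤_) (sym f-s) positive) i) (bump-cong s (λ j → sym (β′-part j)) i)))))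
  β′≤ : ∀ i → part β′ i ≤ part β i
  β′≤ i = ≤-trans (≤-reflexive (β′-part i)) (≤-trans (dent-≤ s f i) (dent-≤ (suc s) (part β) i))
  ≤g : ∀ i → part β i ≤ suc (g i)
  ≤g i with i ≟ s
  ... | yes refl = ≤-trans (≤-reflexive (sym f-s)) (n≤suc-pred (f i))
  ... | no  _    = ≤-suc-dent (suc s) (part β) i
  ≤β′ : ∀ i → part β i ≤ suc (part β′ i)
  ≤β′ i = ≤-trans (≤g i) (s≤s (≤-reflexive (sym (β′-part i))))
  g-paired : PairedFun g
  g-paired i with i ≟ m
  ... | yes refl = trans (dent-at s f) (sym (trans (dent-off s f 1+n≢n) (trans (dent-at (suc s) (part β))
                     (cong pred (trans (sym (openPaired p m)) (sym f-s))))))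
  ... | no i≢m = trans (trans (dent-off s f (i≢m ∘ *-cancelʳ-≡ i m 2)) (dent-off (suc s) (part β) (double≢ i m)))
                 (trans (openPaired p i) (sym (trans (dent-off s f (λ e → double≢ m i (sym e)))
                   (dent-off (suc s) (part β) (λ e → i≢m (*-cancelʳ-≡ i m 2 (suc-injective e)))))))
    where
    double≢ : ∀ a b → ¬ a * 2 ≡ suc (b * 2)
    double≢ (suc a) (suc b) e = double≢ a b (suc-injective (suc-injective e))
  paired : ∀ i → part β′ (i * 2) ≡ part β′ (suc (i * 2))
  paired i = trans (β′-part (i * 2)) (trans (g-paired i) (sym (β′-part (suc (i * 2)))))

remove-domino : ∀ β → Paired β → 1 ≤ part β 0 → ∃ λ β′ → Paired β′ × Domino β β′
remove-domino β p q with last-pair (height β) (part β) (part-mono β) (openPaired p) (part-beyond β ≤-refl) q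
... | m , positive , last = remove-domino-at β p m positive last

positive-size : ∀ β {a} → part β 0 ≡ suc a → 1 ≤ size β
positive-size (mkPartition (a ∷ l) w) refl = s≤s z≤n

module _
  {lam : Partition} {c : Partition → Partition → ℕ}
  (lr : ∀ β {k} (α : Vec ℕ k) → ChainProduct β lam α ↔ (Σ[ ν ∈ Partition ] (Fin (c β ν) × Chain α ν)))
  where
  open LittlewoodRichardson lam c lr

  -- An element of `Fin (c β ν)` witnesses that the coefficient is nonzero. Removing a domino β/β′
  -- exhibits ν in (e_2 s_β′) s_λ, and commutation produces some μ with `c β′ μ` nonzero and ν/μ a
  -- domino. The induction is on a bound `n` for |β|.
  paired-VChain : ∀ n β ν → size β ≤ n → Paired β → Fin (c β ν) → VChain lam ν
  paired-VChain n β ν le p x with part β 0 in eq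
  ... | zero = subst (VChain lam) (sym (lr-∅ ν (subst (λ β → Fin (c β ν)) β≡∅ x))) start
    where
    β≡∅ : β ≡ ∅ₚ
    β≡∅ = part-ext (decreasing-zero (part-mono β) eq)
  ... | suc a with n
  ...   | zero  = contradiction (≤-trans (positive-size β eq) le) (λ ())
  ...   | suc m = descend (remove-domino β p (≤-trans (s≤s z≤n) (≤-reflexive (sym eq))))
    where
    recurse : ∀ {β′} → Paired β′ → size β′ ≤ m → MultiplyThenRaise Domino β′ ν → VChain lam ν
    recurse p′ le′ (μ , l , y) = domino-step (paired-VChain m _ μ le′ p′ y) l
    descend : (∃ λ β′ → Paired β′ × Domino β β′) → VChain lam ν
    descend (β′ , p′ , k) = recurse p′
      (s≤s⁻¹ (≤-trans (≤-trans (n≤1+n _) (≤-reflexive (sym (proj₂ (openDomino k))))) le))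
      (Inverse.to (domino-commute β′ ν) (β , k , x))

-- Tableaux as chains of horizontal strips

by-cases : {P A : Set} → Dec P → (P → A) → (¬ P → A) → A
by-cases (yes p) f g = f p
by-cases (no np) f g = g np

count : {P : ℕ → Set} → (∀ x → Dec (P x)) → List ℕ → ℕ
count P? l = length (filter P? l)

count-++ : ∀ {P : ℕ → Set} (P? : ∀ x → Dec (P x)) xs ys → count P? (xs ++ ys) ≡ count P? xs + count P? ys
count-++ P? xs ys = trans (cong length (filter-++ P? xs ys)) (length-++ (filter P? xs))

count-all : ∀ {P : ℕ → Set} (P? : ∀ x → Dec (P x)) l → (∀ j → j < length l → P (nth l j)) → count P? l ≡ length l
count-all P? []      h = refl
count-all P? (x ∷ l) h with P? x
... | yes _ = cong suc (count-all P? l (λ j p → h (suc j) (s≤s p)))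
... | no np = contradiction (h 0 (s≤s z≤n)) np

count-none : ∀ {P : ℕ → Set} (P? : ∀ x → Dec (P x)) l → (∀ j → j < length l → ¬ P (nth l j)) → count P? l ≡ 0
count-none P? []      h = refl
count-none P? (x ∷ l) h with P? x
... | yes p = contradiction p (h 0 (s≤s z≤n))
... | no _  = count-none P? l (λ j p → h (suc j) (s≤s p))

nth-replicate : ∀ d x {j} → j < d → nth (replicate d x) j ≡ x
nth-replicate (suc d) x {zero}  p       = refl
nth-replicate (suc d) x {suc j} (s≤s p) = nth-replicate d x p

nth-++ˡ : ∀ xs {ys j} → j < length xs → nth (xs ++ ys) j ≡ nth xs j
nth-++ˡ (x ∷ xs) {j = zero}  p       = refl
nth-++ˡ (x ∷ xs) {j = suc j} (s≤s p) = nth-++ˡ xs p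

nth-++ʳ : ∀ xs {ys j} → length xs ≤ j → nth (xs ++ ys) j ≡ nth ys (j ∸ length xs)
nth-++ʳ []       p       = refl
nth-++ʳ (x ∷ xs) (s≤s p) = nth-++ʳ xs p

nth-take : ∀ m l {j} → j < m → nth (take m l) j ≡ nth l j
nth-take (suc m) []      p               = refl
nth-take (suc m) (x ∷ l) {zero}  p       = refl
nth-take (suc m) (x ∷ l) {suc j} (s≤s p) = nth-take m l p

take-++-length : ∀ (xs : List ℕ) ys → take (length xs) (xs ++ ys) ≡ xs
take-++-length []       ys = refl
take-++-length (x ∷ xs) ys = cong (x ∷_) (take-++-length xs ys)

list-ext : ∀ (l l′ : List ℕ) → length l ≡ length l′ → (∀ j → j < length l → nth l j ≡ nth l′ j) → l ≡ l′
list-ext []      []       e h = refl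
list-ext (x ∷ l) (y ∷ l′) e h =
  cong₂ _∷_ (h 0 (s≤s z≤n)) (list-ext l l′ (suc-injective e) (λ j p → h (suc j) (s≤s p)))

-- In a weakly increasing row the entries at most `k` form an initial segment, whose length is their
-- number.
nth≤-count : ∀ k (P? : ∀ x → Dec (x ≤ k)) l → (∀ j → suc j < length l → nth l j ≤ nth l (suc j)) → ∀ {j} → j < length l →
             (nth l j ≤ k → j < count P? l) × (j < count P? l → nth l j ≤ k)
nth≤-count k P? (x ∷ l) s {j} p with P? x
nth≤-count k P? (x ∷ l) s {zero}  p       | yes q = (λ _ → s≤s z≤n) , (λ _ → q)
nth≤-count k P? (x ∷ l) s {suc j} (s≤s p) | yes q with nth≤-count k P? l (λ i r → s (suc i) (s≤s r)) p
... | f , g = (λ r → s≤s (f r)) , (λ r → g (s≤s⁻¹ r))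
nth≤-count k P? (x ∷ l) s {j} p | no nq =
  (λ r → contradiction r (above j p)) ,
  (λ r → contradiction (subst (j <_) (count-none P? l (λ i q → above (suc i) (s≤s q))) r) (λ ()))
  where
  above : ∀ j → j < suc (length l) → ¬ nth (x ∷ l) j ≤ k
  above zero    p r = nq r
  above (suc j) p r = above j (≤-trans (n≤1+n _) p) (≤-trans (s j p) r)

rowAt : List (List ℕ) → ℕ → List ℕ
rowAt []      i       = []
rowAt (r ∷ T) zero    = r
rowAt (r ∷ T) (suc i) = rowAt T i

entry-rowAt : ∀ T i j → entry T i j ≡ nth (rowAt T i) j
entry-rowAt []      i       j = refl
entry-rowAt (r ∷ T) zero    j = refl
entry-rowAt (r ∷ T) (suc i) j = entry-rowAt T i j

length-rowAt : ∀ T {l} → map length T ≡ l → ∀ i → length (rowAt T i) ≡ nth l i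
length-rowAt []      refl i       = refl
length-rowAt (r ∷ T) refl zero    = refl
length-rowAt (r ∷ T) refl (suc i) = length-rowAt T refl i

rows-ext : ∀ T T′ → map length T ≡ map length T′ → (∀ i → rowAt T i ≡ rowAt T′ i) → T ≡ T′
rows-ext []      []       e h = refl
rows-ext (r ∷ T) (s ∷ T′) e h = cong₂ _∷_ (h 0) (rows-ext T T′ (∷-injectiveʳ e) (h ∘ suc))

rowAt-applyUpTo : ∀ (f : ℕ → List ℕ) h → (∀ i → h ≤ i → f i ≡ []) → ∀ i → rowAt (applyUpTo f h) i ≡ f i
rowAt-applyUpTo f zero    e i       = sym (e i z≤n)
rowAt-applyUpTo f (suc h) e zero    = refl
rowAt-applyUpTo f (suc h) e (suc i) = rowAt-applyUpTo (f ∘ suc) h (λ i p → e (suc i) (s≤s p)) i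

applyUpTo-nth : ∀ {f : ℕ → ℕ} l → (∀ i → i < length l → f i ≡ nth l i) → applyUpTo f (length l) ≡ l
applyUpTo-nth []      h = refl
applyUpTo-nth (x ∷ l) h = cong₂ _∷_ (h 0 (s≤s z≤n)) (applyUpTo-nth l (λ i p → h (suc i) (s≤s p)))

lengths-applyUpTo : ∀ (f : ℕ → List ℕ) μ → (∀ i → length (f i) ≡ part μ i) →
                    map length (applyUpTo f (height μ)) ≡ parts μ
lengths-applyUpTo f μ h = trans (map-applyUpTo f length (height μ)) (applyUpTo-nth (parts μ) (λ i _ → h i))

occ-concat : ∀ v T {N} → length T ≤ N → occ v (concat T) ≡ sumTo N (λ i → occ v (rowAt T i))
occ-concat v []      {N} p       = sym (sumTo-zero N (λ _ _ → refl))
occ-concat v (r ∷ T)     (s≤s p) = trans (count-++ (_≟ v) r (concat T)) (cong (occ v r +_) (occ-concat v T p))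

ReversedContent : ∀ {k} → Vec ℕ k → List (List ℕ) → Set
ReversedContent []              T = ⊤
ReversedContent {suc k} (b ∷ β) T = occ (suc k) (concat T) ≡ b × ReversedContent β T

-- IsSSYT with the content listed from the largest letter down.
IsTableau : Partition → ∀ {k} → Vec ℕ k → List (List ℕ) → Set
IsTableau ν {k} α T =
    map length T ≡ parts ν
  × (∀ i j → ν ∋cell i , j → 1 ≤ entry T i j × entry T i j ≤ k)
  × (∀ i j → ν ∋cell i , suc j → entry T i j ≤ entry T i (suc j))
  × (∀ i j → ν ∋cell suc i , j → entry T i j < entry T (suc i) j)
  × ReversedContent α T

record Tableau (ν : Partition) {k : ℕ} (α : Vec ℕ k) : Set where
  constructor mkTableau
  field
    rows   : List (List ℕ)
    .valid : IsTableau ν α rows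

module TableauRows (ν : Partition) {k} (α : Vec ℕ k) (T : List (List ℕ)) (v : IsTableau ν α T) where

  row-length : ∀ i → length (rowAt T i) ≡ part ν i
  row-length = length-rowAt T (proj₁ v)

  positive : ∀ i {j} → j < part ν i → 1 ≤ nth (rowAt T i) j
  positive i {j} p = subst (1 ≤_) (entry-rowAt T i j) (proj₁ (proj₁ (proj₂ v) i j p))

  bounded : ∀ i {j} → j < part ν i → nth (rowAt T i) j ≤ k
  bounded i {j} p = subst (_≤ k) (entry-rowAt T i j) (proj₂ (proj₁ (proj₂ v) i j p))

  weak : ∀ i j → suc j < part ν i → nth (rowAt T i) j ≤ nth (rowAt T i) (suc j)
  weak i j p = subst₂ _≤_ (entry-rowAt T i j) (entry-rowAt T i (suc j)) (proj₁ (proj₂ (proj₂ v)) i j p)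

  strict : ∀ i j → j < part ν (suc i) → nth (rowAt T i) j < nth (rowAt T (suc i)) j
  strict i j p = subst₂ _<_ (entry-rowAt T i j) (entry-rowAt T (suc i) j) (proj₁ (proj₂ (proj₂ (proj₂ v))) i j p)

  contents : ReversedContent α T
  contents = proj₂ (proj₂ (proj₂ (proj₂ v)))

isTableau : ∀ (ν : Partition) {k} (α : Vec ℕ k) T (f : ℕ → List ℕ) → (∀ i → rowAt T i ≡ f i) →
  map length T ≡ parts ν →
  (∀ i j → j < part ν i → 1 ≤ nth (f i) j × nth (f i) j ≤ k) →
  (∀ i j → suc j < part ν i → nth (f i) j ≤ nth (f i) (suc j)) →
  (∀ i j → j < part ν (suc i) → nth (f i) j < nth (f (suc i)) j) →
  ReversedContent α T → IsTableau ν α T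
isTableau ν {k} α T f e l b w s c = l ,
  (λ i j p → subst (1 ≤_) (sym (at i j)) (proj₁ (b i j p)) , subst (_≤ k) (sym (at i j)) (proj₂ (b i j p))) ,
  (λ i j p → subst₂ _≤_ (sym (at i j)) (sym (at i (suc j))) (w i j p)) ,
  (λ i j p → subst₂ _<_ (sym (at i j)) (sym (at (suc i) j)) (s i j p)) , c
  where
  at : ∀ i j → entry T i j ≡ nth (f i) j
  at i j = trans (entry-rowAt T i j) (cong (λ r → nth r j) (e i))

-- The letter `suc k` is the largest, so it occupies the end of each row: a tableau is its
-- restriction to smaller letters with the rows padded by this letter.
module Extend (ν : Partition) (k b : ℕ) (β : Vec ℕ k) where

  extendRow : Partition → List (List ℕ) → ℕ → List ℕ
  extendRow μ T i = rowAt T i ++ replicate (part ν i ∸ part μ i) (suc k)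

  extend : Partition → List (List ℕ) → List (List ℕ)
  extend μ T = applyUpTo (extendRow μ T) (height ν)

  -- The assumptions stop short of `IsTableau`, because the module is also applied to a restriction
  -- before that is known to be a tableau.
  module Extension (μ : Partition) (T : List (List ℕ)) (h : Interlace ν μ) (lengths : map length T ≡ parts μ)
                   (bound : ∀ i {j} → j < part μ i → nth (rowAt T i) j ≤ k) where

    len : ∀ i → length (rowAt T i) ≡ part μ i
    len = length-rowAt T lengths

    extendRow-length : ∀ i → length (extendRow μ T i) ≡ part ν i
    extendRow-length i = trans (length-++ (rowAt T i))
      (trans (cong₂ _+_ (len i) (length-replicate (part ν i ∸ part μ i))) (m+[n∸m]≡n (proj₁ (h i))))

    extend-lengths : map length (extend μ T) ≡ parts ν
    extend-lengths = lengths-applyUpTo (extendRow μ T) ν extendRow-length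

    rowAt-extend : ∀ i → rowAt (extend μ T) i ≡ extendRow μ T i
    rowAt-extend = rowAt-applyUpTo (extendRow μ T) (height ν) λ i p →
      empty (extendRow μ T i) (trans (extendRow-length i) (part-beyond ν p))
      where
      empty : ∀ (l : List ℕ) → length l ≡ 0 → l ≡ []
      empty [] e = refl

    old : ∀ i {j} → j < part μ i → nth (extendRow μ T i) j ≡ nth (rowAt T i) j
    old i p = nth-++ˡ (rowAt T i) (subst (_ <_) (sym (len i)) p)

    new : ∀ i {j} → part μ i ≤ j → j < part ν i → nth (extendRow μ T i) j ≡ suc k
    new i {j} p q = trans (nth-++ʳ (rowAt T i) (subst (_≤ j) (sym (len i)) p))
      (nth-replicate (part ν i ∸ part μ i) (suc k)
        (subst (λ x → j ∸ x < part ν i ∸ part μ i) (sym (len i)) (∸-monoˡ-< q p)))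

    N : ℕ
    N = height ν + height μ

    occ-row : ∀ v i → occ v (extendRow μ T i) ≡ occ v (rowAt T i) + occ v (replicate (part ν i ∸ part μ i) (suc k))
    occ-row v i = count-++ (_≟ v) (rowAt T i) _

    occ-extend : ∀ v → occ v (concat (extend μ T)) ≡ sumTo N (λ i → occ v (extendRow μ T i))
    occ-extend v = trans
      (occ-concat v (extend μ T) {N} (≤-trans (≤-reflexive (length-applyUpTo (extendRow μ T) (height ν))) (m≤m+n _ _)))
      (sumTo-cong N (λ i _ → cong (occ v) (rowAt-extend i)))

    height-T : length T ≤ N
    height-T = ≤-trans (≤-reflexive (trans (sym (length-map length T)) (cong length lengths))) (m≤n+m _ _)

    occ-old : ∀ v → v ≤ k → occ v (concat (extend μ T)) ≡ occ v (concat T)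
    occ-old v p = trans (occ-extend v) (trans (sumTo-cong N (λ i _ → trans (occ-row v i)
      (trans (cong (occ v (rowAt T i) +_) (count-none (_≟ v) (replicate (part ν i ∸ part μ i) (suc k)) (λ j q e →
        <⇒≢ (s≤s p) (sym (trans (sym (nth-replicate _ (suc k) (subst (j <_) (length-replicate (part ν i ∸ part μ i)) q))) e)))))
        (+-identityʳ _)))) (sym (occ-concat v T height-T)))

    occ-new : occ (suc k) (concat (extend μ T)) + size μ ≡ size ν
    occ-new = begin
      occ (suc k) (concat (extend μ T)) + size μ
        ≡⟨ cong₂ _+_ (trans (occ-extend (suc k)) (sumTo-cong N (λ i _ → row i))) (size-sumTo μ (m≤n+m (height μ) (height ν))) ⟩
      sumTo N (λ i → part ν i ∸ part μ i) + sumTo N (part μ)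
        ≡⟨ sym (sumTo-+ N _ (part μ)) ⟩
      sumTo N (λ i → part ν i ∸ part μ i + part μ i)
        ≡⟨ sumTo-cong N (λ i _ → m∸n+n≡m (proj₁ (h i))) ⟩
      sumTo N (part ν)
        ≡⟨ sym (size-sumTo ν (m≤m+n _ _)) ⟩
      size ν ∎
      where
      open ≡-Reasoning
      row : ∀ i → occ (suc k) (extendRow μ T i) ≡ part ν i ∸ part μ i
      row i = trans (occ-row (suc k) i) (cong₂ _+_
        (count-none (_≟ suc k) (rowAt T i) (λ j q e → <⇒≢ (s≤s (bound i (subst (j <_) (len i) q))) e))
        (trans (count-all (_≟ suc k) (replicate (part ν i ∸ part μ i) (suc k)) (λ j q →
                  nth-replicate _ (suc k) (subst (j <_) (length-replicate (part ν i ∸ part μ i)) q)))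
               (length-replicate (part ν i ∸ part μ i))))

    content-extend : ∀ {m} (γ : Vec ℕ m) → m ≤ k →
      (ReversedContent γ T → ReversedContent γ (extend μ T)) × (ReversedContent γ (extend μ T) → ReversedContent γ T)
    content-extend []      p = (λ x → x) , (λ x → x)
    content-extend (c ∷ γ) p with content-extend γ (≤-trans (n≤1+n _) p)
    ... | f , g = (λ { (x , y) → trans (occ-old _ p) x , f y }) , (λ { (x , y) → trans (sym (occ-old _ p)) x , g y })

  module Restrict (T : List (List ℕ)) (v : IsTableau ν (b ∷ β) T) where
    open TableauRows ν (b ∷ β) T v

    m : ℕ → ℕ
    m i = count (_≤? k) (rowAt T i)

    split : ∀ i {j} → j < part ν i → (nth (rowAt T i) j ≤ k → j < m i) × (j < m i → nth (rowAt T i) j ≤ k)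
    split i {j} p = nth≤-count k (_≤? k) (rowAt T i) (λ j q → weak i j (subst (suc j <_) (row-length i) q))
      (subst (j <_) (sym (row-length i)) p)

    m≤ : ∀ i → m i ≤ part ν i
    m≤ i = ≤-trans (length-filter (_≤? k) (rowAt T i)) (≤-reflexive (row-length i))

    -- Column strictness: an entry above a cell of row i + 1 is smaller than an entry bounded by k +
    -- 1, so it is at most `k` and lies in the initial segment counted by `m i`.
    ≤m : ∀ i → part ν (suc i) ≤ m i
    ≤m i = ≮⇒≥ λ p → <-irrefl refl (proj₁ (split i (≤-trans p (part-mono ν i)))
      (s≤s⁻¹ (≤-trans (strict i (m i) p) (bounded (suc i) p))))

    m-dec : Decreasing m
    m-dec i = ≤-trans (m≤ (suc i)) (≤m i)

    m-end : m (height ν) ≡ 0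
    m-end = n≤0⇒n≡0 (≤-trans (m≤ (height ν)) (≤-reflexive (part-beyond ν ≤-refl)))

  -- The argument `v` is irrelevant, so that the shape can be formed from the irrelevant field of a
  -- `Tableau`.
  inner : ∀ T → .(IsTableau ν (b ∷ β) T) → Partition
  inner T v = fromFun (λ i → count (_≤? k) (rowAt T i)) (height ν) (Restrict.m-dec T v) (Restrict.m-end T v)

  innerRows : ∀ T → .(IsTableau ν (b ∷ β) T) → List (List ℕ)
  innerRows T v = applyUpTo (λ i → take (count (_≤? k) (rowAt T i)) (rowAt T i)) (height (inner T v))

  module Restriction (T : List (List ℕ)) (v : IsTableau ν (b ∷ β) T) where
    open TableauRows ν (b ∷ β) T v
    open Restrict T v

    μ : Partition
    μ = inner T v

    T′ : List (List ℕ)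
    T′ = innerRows T v

    μ-part : ∀ i → part μ i ≡ m i
    μ-part = part-fromFun m (height ν) m-dec m-end

    interlace : Interlace ν μ
    interlace i = ≤-trans (≤-reflexive (μ-part i)) (m≤ i) , ≤-trans (≤m i) (≤-reflexive (sym (μ-part i)))

    row : ℕ → List ℕ
    row i = take (m i) (rowAt T i)

    row-len : ∀ i → length (row i) ≡ part μ i
    row-len i = trans (length-take (m i) (rowAt T i))
      (trans (m≤n⇒m⊓n≡m (≤-trans (m≤ i) (≤-reflexive (sym (row-length i))))) (sym (μ-part i)))

    rowAt-T′ : ∀ i → rowAt T′ i ≡ row i
    rowAt-T′ = rowAt-applyUpTo row (height μ) λ i p →
      cong (λ x → take x (rowAt T i)) (trans (sym (μ-part i)) (part-beyond μ p))

    lengths : map length T′ ≡ parts μ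
    lengths = lengths-applyUpTo row μ row-len

    kept : ∀ i {j} → j < part μ i → nth (row i) j ≡ nth (rowAt T i) j
    kept i {j} p = nth-take (m i) (rowAt T i) (subst (j <_) (μ-part i) p)

    inside : ∀ i {j} → j < part μ i → j < part ν i
    inside i p = ≤-trans p (proj₁ (interlace i))

    row-bounded : ∀ i {j} → j < part μ i → nth (row i) j ≤ k
    row-bounded i {j} p = subst (_≤ k) (sym (kept i p)) (proj₂ (split i (inside i p)) (subst (j <_) (μ-part i) p))

    open Extension μ T′ interlace lengths
      (λ i {j} p → subst (λ r → nth r j ≤ k) (sym (rowAt-T′ i)) (row-bounded i p))

    extend-restrict : extend μ T′ ≡ T
    extend-restrict = rows-ext _ _ (trans extend-lengths (sym (proj₁ v))) λ i →
      trans (rowAt-extend i) (list-ext _ _ (trans (extendRow-length i) (sym (row-length i))) λ j p →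
        agree i j (subst (j <_) (extendRow-length i) p))
      where
      agree : ∀ i j → j < part ν i → nth (extendRow μ T′ i) j ≡ nth (rowAt T i) j
      agree i j p = by-cases (j <? part μ i)
        (λ q → trans (old i q) (trans (cong (λ r → nth r j) (rowAt-T′ i)) (kept i q)))
        λ nq → trans (new i (≮⇒≥ nq) p) (≤-antisym
              (≰⇒> λ r → nq (subst (j <_) (sym (μ-part i)) (proj₁ (split i p) r))) (bounded i p))

    contents′ : ReversedContent (b ∷ β) (extend μ T′)
    contents′ = subst (ReversedContent (b ∷ β)) (sym extend-restrict) contents

    -- Letters are counted only for extensions; the count reaches `T` because extending its
    -- restriction gives `T` back.
    strip : Interlace ν μ × size ν ≡ b + size μ
    strip = interlace , trans (sym occ-new) (cong (_+ size μ) (proj₁ contents′))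

    tableau : IsTableau μ β T′
    tableau = isTableau μ β T′ row rowAt-T′ lengths
      (λ i j p → subst (1 ≤_) (sym (kept i p)) (positive i (inside i p)) , row-bounded i p)
      (λ i j p → subst₂ _≤_ (sym (kept i (≤-trans (n≤1+n _) p))) (sym (kept i p)) (weak i j (inside i p)))
      (λ i j p → subst₂ _<_ (sym (kept i (≤-trans p (part-mono μ i)))) (sym (kept (suc i) p)) (strict i j (inside (suc i) p)))
      (proj₂ (content-extend β ≤-refl) (proj₂ contents′))

  module Enlarge (μ : Partition) (T : List (List ℕ)) (h : Interlace ν μ) (s : size ν ≡ b + size μ) (v : IsTableau μ β T) where
    open TableauRows μ β T v
    open Extension μ T h (proj₁ v) bounded public

    bounds : ∀ i j → j < part ν i → 1 ≤ nth (extendRow μ T i) j × nth (extendRow μ T i) j ≤ suc k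
    bounds i j p = by-cases (j <? part μ i)
      (λ q → subst (λ x → 1 ≤ x × x ≤ suc k) (sym (old i q)) (positive i q , m≤n⇒m≤1+n (bounded i q)))
      (λ nq → subst (λ x → 1 ≤ x × x ≤ suc k) (sym (new i (≮⇒≥ nq) p)) (s≤s z≤n , ≤-refl))

    weak′ : ∀ i j → suc j < part ν i → nth (extendRow μ T i) j ≤ nth (extendRow μ T i) (suc j)
    weak′ i j p = by-cases (suc j <? part μ i)
      (λ q → subst₂ _≤_ (sym (old i (≤-trans (n≤1+n _) q))) (sym (old i q)) (weak i j q))
      (λ nq → subst (nth (extendRow μ T i) j ≤_) (sym (new i (≮⇒≥ nq) p)) (proj₂ (bounds i j (≤-trans (n≤1+n _) p))))

    strict′ : ∀ i j → j < part ν (suc i) → nth (extendRow μ T i) j < nth (extendRow μ T (suc i)) j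
    strict′ i j p = by-cases (j <? part μ (suc i))
      (λ q → subst₂ _<_ (sym (old i (≤-trans q (part-mono μ i)))) (sym (old (suc i) q)) (strict i j q))
      (λ nq → subst₂ _<_ (sym (old i (≤-trans p (proj₂ (h i))))) (sym (new (suc i) (≮⇒≥ nq) p))
                (s≤s (bounded i (≤-trans p (proj₂ (h i))))))

    tableau : IsTableau ν (b ∷ β) (extend μ T)
    tableau = isTableau ν (b ∷ β) (extend μ T) (extendRow μ T) rowAt-extend extend-lengths bounds weak′ strict′
      (+-cancelʳ-≡ (size μ) _ _ (trans occ-new s) , proj₁ (content-extend β ≤-refl) contents)

    count-row : ∀ i → count (_≤? k) (rowAt (extend μ T) i) ≡ part μ i
    count-row i = trans (cong (count (_≤? k)) (rowAt-extend i)) (trans (count-++ (_≤? k) (rowAt T i) _)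
      (trans (cong₂ _+_
        (count-all (_≤? k) (rowAt T i) (λ j p → bounded i (subst (j <_) (row-length i) p)))
        (count-none (_≤? k) (replicate (part ν i ∸ part μ i) (suc k)) (λ j p r → <-irrefl refl
          (subst (_≤ k) (nth-replicate _ (suc k) (subst (j <_) (length-replicate (part ν i ∸ part μ i)) p)) r))))
        (trans (+-identityʳ _) (row-length i))))

    inner-extend : inner (extend μ T) tableau ≡ μ
    inner-extend = part-ext λ i → trans (Restriction.μ-part (extend μ T) tableau i) (count-row i)

    innerRows-extend : innerRows (extend μ T) tableau ≡ T
    innerRows-extend = rows-ext _ _
      (trans (Restriction.lengths (extend μ T) tableau) (trans (cong parts inner-extend) (sym (proj₁ v))))
      λ i → trans (Restriction.rowAt-T′ (extend μ T) tableau i) (trans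
        (cong₂ take (trans (count-row i) (sym (row-length i))) (rowAt-extend i))
        (take-++-length (rowAt T i) _))


tableau-≡ : ∀ {ν k} {α : Vec ℕ k} {x y : Tableau ν α} → Tableau.rows x ≡ Tableau.rows y → x ≡ y
tableau-≡ refl = refl

peel : ∀ ν {k} b (β : Vec ℕ k) → Tableau ν (b ∷ β) ↔ (Σ[ μ ∈ Partition ] (HS b ν μ × Tableau μ β))
peel ν {k} b β = mk↔ₛ′ to from to-from from-to
  where
  open Extend ν k b β
  to : Tableau ν (b ∷ β) → Σ[ μ ∈ Partition ] (HS b ν μ × Tableau μ β)
  to (mkTableau T v) = inner T v , mkHS (Restriction.strip T v) , mkTableau (innerRows T v) (Restriction.tableau T v)
  from : Σ[ μ ∈ Partition ] (HS b ν μ × Tableau μ β) → Tableau ν (b ∷ β)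
  from (μ , mkHS s , mkTableau T v) = mkTableau (extend μ T) (Enlarge.tableau μ T (proj₁ s) (proj₂ s) v)
  from-to : ∀ x → from (to x) ≡ x
  from-to (mkTableau T v) = tableau-≡ (recompute (≡-dec (≡-dec _≟_) _ _) (Restriction.extend-restrict T v))
  pair-≡ : ∀ {μ μ′ h h′} {t : Tableau μ β} {t′ : Tableau μ′ β} → μ ≡ μ′ → Tableau.rows t ≡ Tableau.rows t′ →
           (Σ[ μ ∈ Partition ] (HS b ν μ × Tableau μ β) ∋ (μ , h , t)) ≡ (μ′ , h′ , t′)
  pair-≡ refl refl = refl
  to-from : ∀ y → to (from y) ≡ y
  to-from (μ , mkHS s , mkTableau T v) = pair-≡ (≡ₚ-rec (Enlarge.inner-extend μ T (proj₁ s) (proj₂ s) v))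
    (recompute (≡-dec (≡-dec _≟_) _ _) (Enlarge.innerRows-extend μ T (proj₁ s) (proj₂ s) v))

tableau-chain : ∀ {k} (α : Vec ℕ k) ν → Tableau ν α ↔ Chain α ν
tableau-chain [] ν = mk↔ₛ′ (λ { (mkTableau T v) → [ empty v ] }) (λ { [ e ] → mkTableau [] (from e) })
  (λ _ → refl) (λ { (mkTableau T v) → tableau-≡ (sym (recompute (≡-dec (≡-dec _≟_) _ _) (rows-empty T v))) })
  where
  empty : ∀ {T} → IsTableau ν [] T → ν ≡ ∅ₚ
  empty v = part-ext (decreasing-zero (part-mono ν) (n≤0⇒n≡0 (≮⇒≥ λ p →
    <-irrefl refl (≤-trans (proj₁ (proj₁ (proj₂ v) 0 0 p)) (proj₂ (proj₁ (proj₂ v) 0 0 p))))))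
  rows-empty : ∀ T → IsTableau ν [] T → T ≡ []
  rows-empty T v = rows-ext T [] (trans (proj₁ v) (cong parts (empty v))) λ i → nil (rowAt T i)
    (trans (TableauRows.row-length ν [] T v i) (cong (λ μ → part μ i) (empty v)))
    where
    nil : ∀ (l : List ℕ) → length l ≡ 0 → l ≡ []
    nil [] e = refl
  from : ν ≡ ∅ₚ → IsTableau ν [] []
  from refl = refl , (λ i j ()) , (λ i j ()) , (λ i j ()) , tt
tableau-chain (a ∷ α) ν = ↔-trans (peel ν a α) (Σ-cong λ μ → ×-congʳ (tableau-chain α μ))

-- Contents listed from the first or from the last letter

LettersFrom : ℕ → ∀ {k} → Vec ℕ k → List ℕ → Set
LettersFrom s []      w = ⊤
LettersFrom s (a ∷ α) w = occ s w ≡ a × LettersFrom (suc s) α w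

lettersFrom-lookup : ∀ s {k} (α : Vec ℕ k) w → LettersFrom s α w → ∀ (r : Fin k) → occ (s + toℕ r) w ≡ lookup α r
lettersFrom-lookup s (a ∷ α) w (e , h) Fin.zero    = trans (cong (λ x → occ x w) (+-identityʳ s)) e
lettersFrom-lookup s (a ∷ α) w (e , h) (Fin.suc r) =
  trans (cong (λ x → occ x w) (+-suc s (toℕ r))) (lettersFrom-lookup (suc s) α w h r)

lookup-lettersFrom : ∀ s {k} (α : Vec ℕ k) w → (∀ (r : Fin k) → occ (s + toℕ r) w ≡ lookup α r) → LettersFrom s α w
lookup-lettersFrom s []      w h = tt
lookup-lettersFrom s (a ∷ α) w h = trans (cong (λ x → occ x w) (sym (+-identityʳ s))) (h Fin.zero) ,
  lookup-lettersFrom (suc s) α w (λ r → trans (cong (λ x → occ x w) (sym (+-suc s (toℕ r)))) (h (Fin.suc r)))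

lettersFrom-snoc : ∀ s {k} (α : Vec ℕ k) b w →
  (LettersFrom s α w × occ (s + k) w ≡ b → LettersFrom s (α ∷ʳ b) w) ×
  (LettersFrom s (α ∷ʳ b) w → LettersFrom s α w × occ (s + k) w ≡ b)
lettersFrom-snoc s []      b w = (λ { (_ , e) → trans (cong (λ x → occ x w) (sym (+-identityʳ s))) e , tt }) ,
                                 (λ { (e , _) → tt , trans (cong (λ x → occ x w) (+-identityʳ s)) e })
lettersFrom-snoc s {suc k} (a ∷ α) b w with lettersFrom-snoc (suc s) α b w
... | f , g = (λ { ((e , h) , q) → e , f (h , trans (cong (λ x → occ x w) (sym (+-suc s k))) q) }) ,
              (λ { (e , h) → (e , proj₁ (g h)) , trans (cong (λ x → occ x w) (+-suc s k)) (proj₂ (g h)) })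

reversedContent-letters : ∀ {k} (α : Vec ℕ k) T →
  (ReversedContent α T → LettersFrom 1 (reverse α) (concat T)) × (LettersFrom 1 (reverse α) (concat T) → ReversedContent α T)
reversedContent-letters []      T = (λ x → x) , (λ x → x)
reversedContent-letters (b ∷ β) T rewrite reverse-∷ b β
  with reversedContent-letters β T | lettersFrom-snoc 1 (reverse β) b (concat T)
... | f , g | f′ , g′ = (λ { (e , h) → f′ (f h , e) }) , (λ h → proj₂ (g′ h) , g (proj₁ (g′ h)))

ssyt-chain : ∀ {k} (α : Vec ℕ k) ν → SSYT ν (reverse α) ↔ Chain α ν
ssyt-chain α ν = ↔-trans (mk↔ₛ′
  (λ { (mkSSYT T v) → mkTableau T (swap (λ h → proj₂ (reversedContent-letters α T) (lookup-lettersFrom 1 (reverse α) (concat T) h)) v) })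
  (λ { (mkTableau T v) → mkSSYT T (swap (λ h → lettersFrom-lookup 1 (reverse α) (concat T) (proj₁ (reversedContent-letters α T) h)) v) })
  (λ _ → refl) (λ _ → refl)) (tableau-chain α ν)
  where
  swap : {A B C D E F : Set} → (E → F) → A × B × C × D × E → A × B × C × D × F
  swap f (a , b , c , d , e) = a , b , c , d , f e

-- From the definitions of SSOTs and even conjugates

strip⇒interlace : ∀ ν μ → HorizStrip ν μ → Interlace ν μ
strip⇒interlace ν μ (sub , unique) i = ≮⇒≥ (λ p → <-irrefl refl (sub i (part ν i) p)) , ≮⇒≥ λ p →
  1+n≢n (sym (unique i (suc i) (part μ i)
    (≤-trans p (part-mono ν i) , <-irrefl refl) (p , λ q → <⇒≱ q (part-mono μ i))))

interlace⇒sub : ∀ ν μ → Interlace ν μ → μ ⊆ₚ ν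
interlace⇒sub ν μ h i j p = ≤-trans p (proj₁ (h i))

interlace⇒strip : ∀ ν μ → Interlace ν μ → HorizStrip ν μ
interlace⇒strip ν μ h = interlace⇒sub ν μ h , unique
  where
  below : ∀ i i′ j → i < i′ → InSkew ν μ i j → ¬ InSkew ν μ i′ j
  below i (suc i′) j (s≤s l) (_ , np) (p′ , _) =
    np (≤-trans p′ (≤-trans (part-anti ν {suc i} {suc i′} (s≤s l)) (proj₂ (h i))))
  unique : ∀ i i′ j → InSkew ν μ i j → InSkew ν μ i′ j → i ≡ i′
  unique i i′ j p q with <-cmp i i′
  ... | tri< l _ _ = contradiction q (below i i′ j l p)
  ... | tri≈ _ e _ = e
  ... | tri> _ _ l = contradiction p (below i′ i j l q)

Step : Partition → Partition → ℕ → Set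
Step p ν a = Σ[ σ ∈ Partition ] Σ[ b ∈ ℕ ] Σ[ c ∈ ℕ ] (Irrelevant (b + c ≡ a) × HS b p σ × HS c ν σ)

StepCondition : Partition → Partition → Partition → ℕ → Set
StepCondition p σ ν a = σ ⊆ₚ p × σ ⊆ₚ ν × HorizStrip p σ × HorizStrip ν σ × a ≡ skewSize p σ + skewSize ν σ

strip-HS : ∀ ν μ → .(HorizStrip ν μ) → HS (skewSize ν μ) ν μ
strip-HS ν μ s = mkHS (strip⇒interlace ν μ s ,
  sym (m∸n+n≡m (size-mono μ ν (λ i → proj₁ (strip⇒interlace ν μ s i)))))

HS-skewSize : ∀ {a ν μ} → HS a ν μ → skewSize ν μ ≡ a
HS-skewSize {a} {ν} {μ} h = trans (cong (_∸ size μ) (proj₂ (openHS h))) (m+n∸n≡m a (size μ))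

-- The sizes of both strips are determined by the shapes, so recording them in `Step` adds no
-- choices.
step-condition : ∀ p ν a → (Σ[ σ ∈ Partition ] Irrelevant (StepCondition p σ ν a)) ↔ Step p ν a
step-condition p ν a = mk↔ₛ′
  (λ { (σ , [ x ]) → σ , skewSize p σ , skewSize ν σ , [ sym (proj₂ (proj₂ (proj₂ (proj₂ x)))) ] ,
       strip-HS p σ (proj₁ (proj₂ (proj₂ x))) , strip-HS ν σ (proj₁ (proj₂ (proj₂ (proj₂ x)))) })
  (λ { (σ , b , c , [ e ] , h , g) → σ ,
       [ interlace⇒sub p σ (proj₁ (openHS h)) , interlace⇒sub ν σ (proj₁ (openHS g)) ,
         interlace⇒strip p σ (proj₁ (openHS h)) , interlace⇒strip ν σ (proj₁ (openHS g)) ,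
         trans (sym e) (sym (cong₂ _+_ (HS-skewSize h) (HS-skewSize g))) ] })
  (λ { (σ , b , c , [ e ] , h , g) → uniq (HS-skewSize h) (HS-skewSize g) })
  (λ _ → refl)
  where
  uniq : ∀ {σ b b′ c c′ e e′ h h′ g g′} → b ≡ b′ → c ≡ c′ →
         (Step p ν a ∋ (σ , b , c , e , h , g)) ≡ (σ , b′ , c′ , e′ , h′ , g′)
  uniq refl refl = refl

contract : (F : Partition → Set) (p : Partition) → (Σ[ μ ∈ Partition ] (F μ × Irrelevant (μ ≡ p))) ↔ F p
contract F p = mk↔ₛ′ (λ { (μ , x , [ e ]) → subst F (≡ₚ-rec e) x }) (λ x → p , x , [ refl ])
  (λ x → lem x _) (λ { (μ , x , [ e ]) → lem′ x (≡ₚ-rec e) })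
  where
  lem : ∀ x (e : p ≡ p) → subst F e x ≡ x
  lem x refl = refl
  lem′ : ∀ {μ} (x : F μ) (e : μ ≡ p) → (Σ[ μ ∈ Partition ] (F μ × Irrelevant (μ ≡ p)) ∋ (p , subst F e x , [ refl ])) ≡ (μ , x , [ e ])
  lem′ x refl = refl

contract′ : (F : Partition → Set) (p : Partition) → (Σ[ μ ∈ Partition ] (F μ × Irrelevant (p ≡ μ))) ↔ F p
contract′ F p = ↔-trans (Σ-cong λ μ → ×-congʳ (mk↔ₛ′ (λ { [ e ] → [ sym e ] }) (λ { [ e ] → [ sym e ] }) (λ _ → refl) (λ _ → refl))) (contract F p)

-- `OscillatingFrom` exposes the last step and an SSOT list the first. Splitting off the first step
-- moves the starting shape, which is why `p` is a parameter.
oscillating-snoc : ∀ p {k} (β : Vec ℕ k) a ν →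
  OscillatingFrom p (β ∷ʳ a) ν ↔ (Σ[ μ ∈ Partition ] (Step p μ a × OscillatingFrom μ β ν))
oscillating-snoc p [] a ν =
  OscillatingFrom p (a ∷ []) ν
    ↔⟨ mk↔ₛ′ (λ { (σ , μ , b , c , e , h , g , q) → μ , (σ , b , c , e , h , g) , q })
             (λ { (μ , (σ , b , c , e , h , g) , q) → σ , μ , b , c , e , h , g , q }) (λ _ → refl) (λ _ → refl) ⟩
  (Σ[ μ ∈ Partition ] (Step μ ν a × Irrelevant (μ ≡ p)))
    ↔⟨ contract (λ μ → Step μ ν a) p ⟩
  Step p ν a
    ↔˘⟨ contract′ (λ μ → Step p μ a) ν ⟩
  (Σ[ μ ∈ Partition ] (Step p μ a × OscillatingFrom μ [] ν)) ↔∎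
oscillating-snoc p (b ∷ β) a ν =
  _ ↔⟨ Σ-cong (λ σ → Σ-cong λ μ → Σ-cong λ b₁ → Σ-cong λ b₂ → ×-congʳ (×-congʳ (×-congʳ (oscillating-snoc p β a μ)))) ⟩
  (Σ[ σ ∈ Partition ] Σ[ μ ∈ Partition ] Σ[ b₁ ∈ ℕ ] Σ[ b₂ ∈ ℕ ] (Irrelevant (b₁ + b₂ ≡ b) × HS b₁ μ σ × HS b₂ ν σ ×
    (Σ[ τ ∈ Partition ] (Step p τ a × OscillatingFrom τ β μ))))
    ↔⟨ mk↔ₛ′ (λ { (σ , μ , b₁ , b₂ , e , h , g , τ , s , o) → τ , s , σ , μ , b₁ , b₂ , e , h , g , o })
             (λ { (τ , s , σ , μ , b₁ , b₂ , e , h , g , o) → σ , μ , b₁ , b₂ , e , h , g , τ , s , o })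
             (λ _ → refl) (λ _ → refl) ⟩
  (Σ[ τ ∈ Partition ] (Step p τ a × OscillatingFrom τ (b ∷ β) ν)) ↔∎

RawSSOT : Partition → ∀ {k} → Vec ℕ k → Partition → Set
RawSSOT p α ν = Σ[ st ∈ List (Partition × Partition) ] Irrelevant (ValidSSOT p st (toList α) ν)

raw-oscillating : ∀ p {k} (α : Vec ℕ k) ν → RawSSOT p α ν ↔ OscillatingFrom p (reverse α) ν
raw-oscillating p [] ν = mk↔ₛ′ to from (λ _ → refl) from-to
  where
  to : RawSSOT p [] ν → OscillatingFrom p [] ν
  to ([]    , [ e ]) = [ sym e ]
  to (_ ∷ _ , [ e ]) = ⊥-elim-irr e
  from : OscillatingFrom p [] ν → RawSSOT p [] ν
  from [ e ] = [] , [ sym e ]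
  from-to : ∀ x → from (to x) ≡ x
  from-to ([]    , _)     = refl
  from-to (_ ∷ _ , [ e ]) = ⊥-elim-irr e
raw-oscillating p (a ∷ α) ν =
  RawSSOT p (a ∷ α) ν
    ↔⟨ mk↔ₛ′ to from (λ _ → refl) from-to ⟩
  (Σ[ μ ∈ Partition ] ((Σ[ σ ∈ Partition ] Irrelevant (StepCondition p σ μ a)) × RawSSOT μ α ν))
    ↔⟨ Σ-cong (λ μ → step-condition p μ a ×-↔ raw-oscillating μ α ν) ⟩
  (Σ[ μ ∈ Partition ] (Step p μ a × OscillatingFrom μ (reverse α) ν))
    ↔˘⟨ oscillating-snoc p (reverse α) a ν ⟩
  OscillatingFrom p (reverse α ∷ʳ a) ν
    ↔⟨ subst (λ β → OscillatingFrom p β ν ↔ OscillatingFrom p (reverse (a ∷ α)) ν) (reverse-∷ a α) ↔-refl ⟩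
  OscillatingFrom p (reverse (a ∷ α)) ν ↔∎
  where
  to : RawSSOT p (a ∷ α) ν → Σ[ μ ∈ Partition ] ((Σ[ σ ∈ Partition ] Irrelevant (StepCondition p σ μ a)) × RawSSOT μ α ν)
  to ([] , [ e ]) = ⊥-elim-irr e
  to ((σ , μ) ∷ st , [ x ]) = μ , (σ , [ proj₁ x , proj₁ (proj₂ x) , proj₁ (proj₂ (proj₂ x)) ,
    proj₁ (proj₂ (proj₂ (proj₂ x))) , proj₁ (proj₂ (proj₂ (proj₂ (proj₂ x)))) ]) , st , [ proj₂ (proj₂ (proj₂ (proj₂ (proj₂ x)))) ]
  from : (Σ[ μ ∈ Partition ] ((Σ[ σ ∈ Partition ] Irrelevant (StepCondition p σ μ a)) × RawSSOT μ α ν)) → RawSSOT p (a ∷ α) ν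
  from (μ , (σ , [ x ]) , st , [ y ]) = (σ , μ) ∷ st , [ proj₁ x , proj₁ (proj₂ x) , proj₁ (proj₂ (proj₂ x)) ,
    proj₁ (proj₂ (proj₂ (proj₂ x))) , proj₂ (proj₂ (proj₂ (proj₂ x))) , y ]
  from-to : ∀ x → from (to x) ≡ x
  from-to ([]    , [ e ]) = ⊥-elim-irr e
  from-to (_ ∷ _ , _)     = refl

ssot-oscillating : ∀ {k} (α : Vec ℕ k) ν → SSOT ν (reverse α) ↔ Oscillating α ν
ssot-oscillating α ν = ↔-trans
  (mk↔ₛ′ (λ { (mkSSOT st v) → st , [ v ] }) (λ { (st , [ v ]) → mkSSOT st v }) (λ _ → refl) (λ _ → refl))
  (subst (λ β → RawSSOT ∅ₚ (reverse α) ν ↔ Oscillating β ν) (reverse-involutive α) (raw-oscillating ∅ₚ (reverse α) ν))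

-- Even columns as equal pairs of rows

data Doubled : List ℕ → Set where
  []  : Doubled []
  _∷_ : ∀ a {l} → Doubled l → Doubled (a ∷ a ∷ l)

doubled⇒paired : ∀ {l} → Doubled l → PairedFun (nth l)
doubled⇒paired []      i       = refl
doubled⇒paired (a ∷ d) zero    = refl
doubled⇒paired (a ∷ d) (suc i) = doubled⇒paired d i

paired⇒doubled : ∀ l → IsPartition l → PairedFun (nth l) → Doubled l
paired⇒doubled []          w p = []
paired⇒doubled (a ∷ [])    w p = contradiction (sym (p 0)) (<⇒≢ w)
paired⇒doubled (a ∷ b ∷ l) w p with p 0
... | refl = a ∷ paired⇒doubled l (tail-wf l (proj₂ w)) (p ∘ suc)

count-yes : {P : ℕ → Set} (P? : ∀ x → Dec (P x)) → ∀ {x} l → P x → count P? (x ∷ l) ≡ suc (count P? l)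
count-yes P? {x} l p with P? x
... | yes _ = refl
... | no np = contradiction p np

doubled⇒even : {P : ℕ → Set} (P? : ∀ x → Dec (P x)) → ∀ {l} → Doubled l → 2 ∣ count P? l
doubled⇒even P? []      = 2 ∣0
doubled⇒even P? (_∷_ a {l} d) with P? a in eq
... | no _ rewrite eq  = doubled⇒even P? d
... | yes _ rewrite eq = ∣m∣n⇒∣m+n ∣-refl (doubled⇒even P? d)

-- If the first row is longer than the second, of length `b`, then column `b` has exactly one box.
-- If the two rows are equal, deleting both shortens every remaining column by 2.
even⇒doubled : ∀ l → IsPartition l → (∀ j → j < nth l 0 → 2 ∣ count (j <?_) l) → Doubled l
even⇒doubled []          w h = []
even⇒doubled (a ∷ [])    w h = contradiction (∣1⇒≡1 (subst (2 ∣_) (count-yes (0 <?_) [] w) (h 0 w))) (λ ())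
even⇒doubled (a ∷ b ∷ l) w h with m≤n⇒m<n∨m≡n (proj₁ w)
... | inj₁ b<a = contradiction (∣1⇒≡1 (subst (2 ∣_) (trans (count-yes (b <?_) (b ∷ l) b<a)
                   (cong suc (count-none (b <?_) (b ∷ l) (λ j p q → <⇒≱ q (nth≤head j))))) (h b b<a))) (λ ())
  where
  nth≤head : ∀ j → nth (b ∷ l) j ≤ b
  nth≤head zero    = ≤-refl
  nth≤head (suc j) = ≤-trans (nth-mono (b ∷ l) (proj₂ w) j) (nth≤head j)
... | inj₂ refl = a ∷ even⇒doubled l (tail-wf l (proj₂ w)) λ j p →
  let q = ≤-trans p (nth-mono (a ∷ l) (proj₂ w) 0) in
  ∣m+n∣m⇒∣n (subst (2 ∣_) (trans (count-yes (j <?_) (a ∷ l) q) (cong suc (count-yes (j <?_) l q))) (h j q)) ∣-refl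

paired⇔conjEven : ∀ β → Irrelevant (ConjEven β) ↔ Paired β
paired⇔conjEven β@(mkPartition l w) = mk↔ₛ′
  (λ { [ e ] → mkPaired (doubled⇒paired (even⇒doubled l w (λ j p → AllP.applyUpTo⁻ (λ x → x) (part β 0) (AllP.map⁻ e) p))) })
  (λ { (mkPaired p) → [ AllP.map⁺ (All.universal (λ j → doubled⇒even (j <?_) (paired⇒doubled l w p)) (upTo (part β 0))) ] })
  (λ _ → refl) (λ _ → refl)

-- Reversal of contents in products

zipWith-∷ʳ : ∀ {k} (x y : Vec ℕ k) a b → zipWith _+_ (x ∷ʳ a) (y ∷ʳ b) ≡ zipWith _+_ x y ∷ʳ (a + b)
zipWith-∷ʳ []      []      a b = refl
zipWith-∷ʳ (c ∷ x) (d ∷ y) a b = cong (c + d ∷_) (zipWith-∷ʳ x y a b)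

zipWith-reverse : ∀ {k} (x y : Vec ℕ k) → zipWith _+_ (reverse x) (reverse y) ≡ reverse (zipWith _+_ x y)
zipWith-reverse []      []      = refl
zipWith-reverse (a ∷ x) (b ∷ y) = trans (cong₂ (zipWith _+_) (reverse-∷ a x) (reverse-∷ b y))
  (trans (zipWith-∷ʳ (reverse x) (reverse y) a b)
    (trans (cong (_∷ʳ (a + b)) (zipWith-reverse x y)) (sym (reverse-∷ (a + b) (zipWith _+_ x y)))))

vsum-∷ʳ : ∀ {k} (x : Vec ℕ k) a → vsum (x ∷ʳ a) ≡ vsum x + a
vsum-∷ʳ []      a = +-comm a 0
vsum-∷ʳ (b ∷ x) a = trans (cong (b +_) (vsum-∷ʳ x a)) (sym (+-assoc b _ a))

vsum-reverse : ∀ {k} (α : Vec ℕ k) → vsum (reverse α) ≡ vsum α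
vsum-reverse []      = refl
vsum-reverse (a ∷ α) = trans (cong vsum (reverse-∷ a α))
  (trans (vsum-∷ʳ (reverse α) a) (trans (+-comm _ a) (cong (a +_) (vsum-reverse α))))

reverse-↔ : ∀ {k} → Vec ℕ k ↔ Vec ℕ k
reverse-↔ = mk↔ₛ′ reverse reverse reverse-involutive reverse-involutive

product-chain : ∀ β lam {k} (α : Vec ℕ k) → ProdCoeff β lam (reverse α) ↔ ChainProduct β lam α
product-chain β lam {k} α =
  ProdCoeff β lam (reverse α)
    ↔⟨ Σ-reindex reverse-↔ _ ⟩
  (Σ[ α₁ ∈ Vec ℕ k ] Σ[ α₂ ∈ Vec ℕ k ]
    (Irrelevant (zipWith _+_ (reverse α₁) α₂ ≡ reverse α) × SSYT β (reverse α₁) × SSYT lam α₂))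
    ↔⟨ Σ-cong (λ α₁ → Σ-reindex reverse-↔ _) ⟩
  (Σ[ α₁ ∈ Vec ℕ k ] Σ[ α₂ ∈ Vec ℕ k ]
    (Irrelevant (zipWith _+_ (reverse α₁) (reverse α₂) ≡ reverse α) × SSYT β (reverse α₁) × SSYT lam (reverse α₂)))
    ↔⟨ Σ-cong (λ α₁ → Σ-cong λ α₂ → unreverse α₁ α₂ ×-↔ (ssyt-chain α₁ β ×-↔ ssyt-chain α₂ lam)) ⟩
  ChainProduct β lam α ↔∎
  where
  unreverse : ∀ α₁ α₂ → Irrelevant (zipWith _+_ (reverse α₁) (reverse α₂) ≡ reverse α) ↔ (α₁ ⊞ α₂ ≡ α)
  unreverse α₁ α₂ = mk↔ₛ′
    (λ { [ e ] → ⊞-eq (reverse-injective (trans (sym (zipWith-reverse α₁ α₂)) e)) })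
    (λ { (⊞-eq e) → [ trans (zipWith-reverse α₁ α₂) (cong reverse e) ] })
    (λ _ → refl) (λ _ → refl)

-- Comparison of the coefficients of both sides

module _ (lam : Partition) (n : ℕ) (c : Partition → Partition → ℕ) (isLR : IsLRCoeffs lam c) where

  chain-lr : ∀ β {k} (α : Vec ℕ k) → ChainProduct β lam α ↔ (Σ[ ν ∈ Partition ] (Fin (c β ν) × Chain α ν))
  chain-lr β {k} α =
    ChainProduct β lam α
      ↔˘⟨ product-chain β lam α ⟩
    ProdCoeff β lam (reverse α)
      ↔⟨ isLR β k (reverse α) ⟩
    LRExpansionCoeff c β (reverse α)
      ↔⟨ Σ-cong (λ ν → ×-congʳ (ssyt-chain α ν)) ⟩
    (Σ[ ν ∈ Partition ] (Fin (c β ν) × Chain α ν)) ↔∎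

  ssyt-size : ∀ {k} (α : Vec ℕ k) {ν} → SSYT ν (reverse α) → size ν ≡ weight (reverse α)
  ssyt-size α {ν} t = trans (chain-size α (Inverse.to (ssyt-chain α ν) t)) (sym (vsum-reverse α))

  expansion : ∀ {k} (α : Vec ℕ k) → SSCoeff lam n (reverse α) ↔ RHSCoeff c lam n (reverse α)
  expansion {k} α =
    SSCoeff lam n (reverse α)
      ↔⟨ ↔-trans (ssot-oscillating α lam) (oscillating-product α lam) ×-↔ ↔-refl ⟩
    ((Σ[ β ∈ Partition ] (Paired β × ChainProduct β lam α)) × Irrelevant (weight (reverse α) ≡ n))
      ↔˘⟨ Σ-cong (λ β → ×-congʳ (product-chain β lam α)) ×-↔ ↔-refl ⟩
    ((Σ[ β ∈ Partition ] (Paired β × ProdCoeff β lam (reverse α))) × Irrelevant (weight (reverse α) ≡ n))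
      ↔⟨ Σ-cong (λ β → ↔-sym (paired⇔conjEven β) ×-↔ isLR β k (reverse α)) ×-↔ ↔-refl ⟩
    ((Σ[ β ∈ Partition ] (Irrelevant (ConjEven β) × LRExpansionCoeff c β (reverse α))) × Irrelevant (weight (reverse α) ≡ n))
      -- Membership in `InV` is supplied here: |ν| is the weight because a tableau of shape ν has
      -- this content, and the chain comes from the element `x` of `Fin (c β ν)`. Backwards, |ν| = n
      -- returns the length condition.
      ↔⟨ mk↔ₛ′
        (λ { ((β , e , ν , x , t) , [ w ]) → β , ν , e ,
             [ trans (ssyt-size α t) w , paired-VChain chain-lr (size β) β ν ≤-refl (Inverse.to (paired⇔conjEven β) e) x ] , x , t })
        (λ { (β , ν , e , [ v ] , x , t) → (β , e , ν , x , t) , [ trans (sym (ssyt-size α t)) (proj₁ v) ] })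
        (λ _ → refl) (λ _ → refl) ⟩
    RHSCoeff c lam n (reverse α) ↔∎

theorem4p5 : (λ′ : Partition) (n : ℕ) → InN λ′ n →
    (c : Partition → Partition → ℕ) → IsLRCoeffs λ′ c →
    (k : ℕ) (α : Vec ℕ k) → SSCoeff λ′ n α ↔ RHSCoeff c λ′ n α
theorem4p5 λ′ n _ c isLR k α =
  subst (λ a → SSCoeff λ′ n a ↔ RHSCoeff c λ′ n a) (reverse-involutive α) (expansion λ′ n c isLR (reverse α))
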